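{- Let $p$ be an odd prime and let $T_p$ be the signed sum over starters in $\mathbb F_p$ defined in the context. Then $$T_p\equiv-\left(\frac{2}{p}\right)\pmod p,$$ where $\left(\frac{\cdot}{p}\right)$ is the Legendre symbol. In particular, $T_p^2\equiv1\pmod p$.
   Context: A starter in $\mathbb F_p$ is a perfect matching $A$ of $\mathbb F_p\setminus\{0\}$ such that, as $\{a,b\}$ runs through its $(p-1)/2$ pairs, the differences $\pm(a-b)$ run through all nonzero residues (i.e. the classes $\{\pm(a-b)\}$ represent all classes of $\mathbb F_p^\times/\{\pm1\}$). Order the nonzero residues as $1<2<\dots<p-1$. For a starter $A$ let $\varepsilon(A)=(-1)^{\operatorname{cr}(A)}$, where $\operatorname{cr}(A)$ is the number of unordered pairs of edges $\{a,c\},\{b,d\}\in A$ with $a<b<c<d$. Put $T_p=\sum_{A\text{ starter}}\varepsilon(A)\in\mathbb Z$. -}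

module Defs where

open import Data.Fin using (Fin; toℕ; _<_)
open import Data.Fin.Properties using (_≟_; _<?_; all?; any?)
open import Data.Integer using (ℤ; +_; 0ℤ; 1ℤ; -1ℤ; _+_; _-_; _*_; -_; _^_)
open import Data.Integer.Divisibility.Signed using (_∣_; _∣?_)
open import Data.List using (List; []; _∷_; _++_; map; filter; foldr; length; allFin; cartesianProduct)
open import Data.List.Relation.Unary.All as All using (All)
open import Data.List.Relation.Unary.Any as Any using (Any)
open import Data.Nat as ℕ using (ℕ)
open import Data.Product using (_×_; _,_; ∃)
open import Data.Sum using (_⊎_)
open import Relation.Binary.PropositionalEquality using (_≡_; _≢_)
open import Relation.Nullary using (Dec; yes; no)
open import Relation.Nullary.Decidable using (¬?; _×-dec_; _⊎-dec_; _→-dec_)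

infix 4 _≡_[mod_] _≡?_[mod_]

_≡_[mod_] : ℤ → ℤ → ℕ → Set
x ≡ y [mod n ] = + n ∣ x - y

_≡?_[mod_] : ∀ x y n → Dec (x ≡ y [mod n ])
x ≡? y [mod n ] = + n ∣? x - y

-- Elements of 𝔽_p are represented by their least residues, i.e. by Fin p.
⟦_⟧ : ∀ {p} → Fin p → ℤ
⟦ r ⟧ = + toℕ r

IsSquare : ℕ → ℤ → Set
IsSquare p a = ∃ λ (x : Fin p) → ⟦ x ⟧ * ⟦ x ⟧ ≡ a [mod p ]

isSquare? : ∀ p a → Dec (IsSquare p a)
isSquare? p a = any? λ x → ⟦ x ⟧ * ⟦ x ⟧ ≡? a [mod p ]

legendre : ℤ → ℕ → ℤ
legendre a p with + p ∣? a | isSquare? p a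
... | yes _ | _     = 0ℤ
... | no  _ | yes _ = 1ℤ
... | no  _ | no  _ = -1ℤ

NonZeroResidue : ∀ {p} → Fin p → Set
NonZeroResidue r = toℕ r ≢ 0

nonZeroResidue? : ∀ {p} (r : Fin p) → Dec (NonZeroResidue r)
nonZeroResidue? r = ¬? (toℕ r ℕ.≟ 0)

-- The unordered pair {a, b} is represented by (a , b) with a < b.
IsEdge : ∀ {p} → Fin p × Fin p → Set
IsEdge (a , b) = NonZeroResidue a × NonZeroResidue b × a < b

isEdge? : ∀ {p} (e : Fin p × Fin p) → Dec (IsEdge e)
isEdge? (a , b) = nonZeroResidue? a ×-dec nonZeroResidue? b ×-dec a <? b

edges : ∀ p → List (Fin p × Fin p)
edges p = filter isEdge? (cartesianProduct (allFin p) (allFin p))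

Incident : ∀ {p} → Fin p → Fin p × Fin p → Set
Incident r (a , b) = r ≡ a ⊎ r ≡ b

incident? : ∀ {p} (r : Fin p) (e : Fin p × Fin p) → Dec (Incident r e)
incident? r (a , b) = r ≟ a ⊎-dec r ≟ b

IsPerfectMatching : ∀ {p} → List (Fin p × Fin p) → Set
IsPerfectMatching A =
  All IsEdge A × (∀ r → NonZeroResidue r → length (filter (incident? r) A) ≡ 1)

isPerfectMatching? : ∀ {p} (A : List (Fin p × Fin p)) → Dec (IsPerfectMatching A)
isPerfectMatching? A =
  All.all? isEdge? A ×-dec
  all? (λ r → nonZeroResidue? r →-dec length (filter (incident? r) A) ℕ.≟ 1)

IsDifference : ∀ {p} → Fin p → Fin p × Fin p → Set
IsDifference {p} r (a , b) =
  ⟦ r ⟧ ≡ ⟦ a ⟧ - ⟦ b ⟧ [mod p ] ⊎ ⟦ r ⟧ ≡ - (⟦ a ⟧ - ⟦ b ⟧) [mod p ]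

isDifference? : ∀ {p} (r : Fin p) (e : Fin p × Fin p) → Dec (IsDifference r e)
isDifference? {p} r (a , b) =
  ⟦ r ⟧ ≡? ⟦ a ⟧ - ⟦ b ⟧ [mod p ] ⊎-dec ⟦ r ⟧ ≡? - (⟦ a ⟧ - ⟦ b ⟧) [mod p ]

IsStarter : ∀ {p} → List (Fin p × Fin p) → Set
IsStarter A =
  IsPerfectMatching A × (∀ r → NonZeroResidue r → Any (IsDifference r) A)

isStarter? : ∀ {p} (A : List (Fin p × Fin p)) → Dec (IsStarter A)
isStarter? A =
  isPerfectMatching? A ×-dec
  all? (λ r → nonZeroResidue? r →-dec Any.any? (isDifference? r) A)

Crosses : ∀ {p} → (Fin p × Fin p) × (Fin p × Fin p) → Set
Crosses ((a , c) , (b , d)) = a < b × b < c × c < d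

crosses? : ∀ {p} (ef : (Fin p × Fin p) × (Fin p × Fin p)) → Dec (Crosses ef)
crosses? ((a , c) , (b , d)) = a <? b ×-dec b <? c ×-dec c <? d

-- Crosses is asymmetric in its two edges, so each crossing unordered pair of
-- edges is counted exactly once among the ordered pairs.
cr : ∀ {p} → List (Fin p × Fin p) → ℕ
cr A = length (filter crosses? (cartesianProduct A A))

ε : ∀ {p} → List (Fin p × Fin p) → ℤ
ε A = -1ℤ ^ cr A

-- All sublists; on a list without repetitions, such as edges p, this lists
-- every subset exactly once.
sublists : ∀ {X : Set} → List X → List (List X)
sublists []       = [] ∷ []
sublists (x ∷ xs) = map (x ∷_) (sublists xs) ++ sublists xs

starters : ∀ p → List (List (Fin p × Fin p))
starters p = filter isStarter? (sublists (edges p))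

T : ℕ → ℤ
T p = foldr _+_ 0ℤ (map ε (starters p))

{-# OPTIONS --safe #-}

-- Write p = 2n + 1. For odd functions f₁, …, fₙ on 𝔽_p let Q(f₁, …, fₙ) be the sum over all
-- sequences (a₁, b₁, …, aₙ, bₙ) in {1, …, 2n} of the sign of the sequence (0 unless it is a
-- permutation) times ∏ fᵢ(bᵢ − aᵢ). With f_d(x) = [x = d] − [x = −d] only the starters contribute
-- to Q(f₁, …, fₙ), each of them 2ⁿ times and with the sign ε times a sign that depends on p only.
--
-- Modulo p, f_d(x) is the polynomial (x + d)^(p−1) − (x − d)^(p−1) of degree p − 2, and
-- f_d − d f₁ has degree at most p − 3. Antisymmetrising a polynomial in 2n variables of total
-- degree less than 0 + 1 + ⋯ + (2n − 1) = n(p − 2) gives 0, because some two exponents of each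
-- monomial agree. So Q(f₁, …, fₙ) ≡ n! Q(f₁, f₁, …, f₁), and the right-hand side counts the tilings
-- of the path 1, …, 2n by ordered and oriented dominoes: it is n! · 2ⁿ n!. Wilson's theorem
-- and the supplementary law for 2 turn the resulting value of the signed sum into −(2/p).
module Submission where

open import Data.Integer as ℤ using (ℤ; +_; 0ℤ; 1ℤ; -1ℤ; _+_; _-_; _*_; -_; _^_; ∣_∣)
import Data.Integer.DivMod as ℤ/
import Data.Integer.Properties as ℤₚ
import Data.Integer.Divisibility.Signed as ℤ∣
open import Data.Integer.Tactic.RingSolver using (solve-∀)
open import Data.List using (List; []; _∷_; _++_; map; filter; foldr; length; applyDownFrom; replicate; allFin; tabulate; cartesianProduct)
import Data.List.Properties as Listₚ
open import Data.List.Membership.Propositional using (_∈_; _∉_)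
open import Data.List.Membership.Propositional.Properties
  using (∈-∃++; ∈-map⁻; ∈-applyDownFrom⁺; ∈-applyDownFrom⁻; ∈-filter⁻)
open import Data.List.Membership.DecPropositional using () renaming (_∈?_ to mem?)
open import Data.List.Relation.Binary.Permutation.Propositional
  using (_↭_; refl; prep; swap; ↭-sym; ↭-trans) renaming (trans to transᵖ)
import Data.List.Relation.Binary.Permutation.Propositional.Properties as ↭ₚ
open import Data.List.Relation.Binary.Subset.Propositional using (_⊆_)
open import Data.List.Relation.Unary.All as All using (All; []; _∷_)
import Data.List.Relation.Unary.All.Properties as Allₚ
open import Data.List.Relation.Unary.AllPairs using ([]; _∷_)
open import Data.List.Relation.Unary.Any using (Any; here; there)
open import Data.List.Relation.Unary.Linked using (Linked; []; [-]; _∷_)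
open import Data.List.Relation.Unary.Unique.Propositional using (Unique)
import Data.List.Relation.Unary.Unique.Propositional.Properties as Uniqueₚ
open import Data.Nat as ℕ using (ℕ; zero; suc; z≤n; s≤s; _≤_; _<_; _∸_)
import Data.Nat.Properties as ℕₚ
open import Data.List.Sort ℕₚ.≤-decTotalOrder using (sort-↭; sort-↗)
import Data.Nat.Divisibility as ℕ∣
import Data.Nat.Tactic.RingSolver as ℕRing
open import Data.Nat.ListAction using (sum)
import Data.Nat.ListAction.Properties as Sumₚ
open import Data.Nat.Divisibility using (_∣_)
open import Data.Nat.Primality using (Prime; euclidsLemma; prime⇒nonTrivial; ¬prime[1])
open import Data.Fin as Fin using (Fin; toℕ)
import Data.Fin.Properties as Finₚ
open import Data.Product using (_×_; _,_; ∃; proj₁; proj₂)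
open import Data.Sum using (_⊎_; inj₁; inj₂; [_,_]′)
open import Function using (_∘_; id; _$_)
open import Relation.Binary.PropositionalEquality
  using (_≡_; _≢_; refl; sym; trans; cong; cong₂; subst; subst₂; module ≡-Reasoning)
open import Relation.Binary using (Setoid)
import Relation.Binary.Reasoning.Setoid as ≈-Reasoning
open import Relation.Binary.Definitions using (tri<; tri≈; tri>)
open import Relation.Nullary using (¬_; Dec; yes; no; contradiction)
open import Relation.Nullary.Decidable using (map′; _×-dec_; ¬?)
open import Defs

-- The exchange of f_d for d f₁ (`Q-g`) is an identity in ℤ for every list of values. The modulus
-- enters only through Fermat's theorem, when indicator weights are traded for polynomials and back.
-- The degree count is tight: one factor f_d - d f₁ brings the total degree from n(p - 2) to just
-- one below.
--
-- Signs of sequences are 0 on repetitions, so all sums run over unrestricted tuples and treat the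
-- pairs one at a time. T, however, sums over sublists of the list of edges, while Q sums over
-- sequences with one pair for each d; `S-transversals` translates between the two.
--
-- The sign of a starter, read as a sequence of pairs a < b, is ε. But f_d contributes -1 whenever b
-- - a > n, and the product of these signs over a starter is κ = (-1)^n (-1)^(n(n+1)/2), by counting
-- parities. So T ≡ κ (n!)², where one n! is the product of the d and the other counts tilings. Here
-- (-1)^n (n!)² ≡ -1 by Wilson's theorem, and (-1)^(n(n+1)/2) is (2/p).

private variable
  X Y : Set

𝟙 : {P : Set} → Dec P → ℤ
𝟙 (yes _) = 1ℤ
𝟙 (no  _) = 0ℤ

𝟙-true : {P : Set} (P? : Dec P) → P → 𝟙 P? ≡ 1ℤ
𝟙-true (yes _) _ = refl
𝟙-true (no ¬p) p = contradiction p ¬p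

𝟙-false : {P : Set} (P? : Dec P) → ¬ P → 𝟙 P? ≡ 0ℤ
𝟙-false (yes p) ¬p = contradiction p ¬p
𝟙-false (no _)  _  = refl

𝟙-cong : {P R : Set} (P? : Dec P) (R? : Dec R) → (P → R) → (R → P) → 𝟙 P? ≡ 𝟙 R?
𝟙-cong (yes p) R? f _ = sym (𝟙-true R? (f p))
𝟙-cong (no ¬p) R? _ g = sym (𝟙-false R? (¬p ∘ g))

-- Finite sums and products

∑ : List X → (X → ℤ) → ℤ
∑ []       f = 0ℤ
∑ (x ∷ xs) f = f x + ∑ xs f

∏ : List X → (X → ℤ) → ℤ
∏ []       f = 1ℤ
∏ (x ∷ xs) f = f x * ∏ xs f

∏ℕ : List ℕ → ℤ
∏ℕ xs = ∏ xs λ x → + x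

∑-cong-∈ : ∀ (xs : List X) {f g} → (∀ {x} → x ∈ xs → f x ≡ g x) → ∑ xs f ≡ ∑ xs g
∑-cong-∈ []       eq = refl
∑-cong-∈ (x ∷ xs) eq = cong₂ _+_ (eq (here refl)) (∑-cong-∈ xs (eq ∘ there))

∑-cong : ∀ (xs : List X) {f g} → (∀ x → f x ≡ g x) → ∑ xs f ≡ ∑ xs g
∑-cong xs eq = ∑-cong-∈ xs λ {x} _ → eq x

∑-zero : ∀ (xs : List X) {f} → (∀ x → f x ≡ 0ℤ) → ∑ xs f ≡ 0ℤ
∑-zero []       eq = refl
∑-zero (x ∷ xs) eq = cong₂ _+_ (eq x) (∑-zero xs eq)

∑-+ : ∀ (xs : List X) f g → ∑ xs (λ x → f x + g x) ≡ ∑ xs f + ∑ xs g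
∑-+ []       f g = refl
∑-+ (x ∷ xs) f g = trans (cong (_+_ (f x + g x)) (∑-+ xs f g)) (lem (f x) (g x) _ _)
  where
  lem : ∀ a b c d → a + b + (c + d) ≡ a + c + (b + d)
  lem = solve-∀

∑-* : ∀ (xs : List X) c f → ∑ xs (λ x → c * f x) ≡ c * ∑ xs f
∑-* []       c f = sym (ℤₚ.*-zeroʳ c)
∑-* (x ∷ xs) c f = trans (cong (_+_ (c * f x)) (∑-* xs c f)) (sym (ℤₚ.*-distribˡ-+ c (f x) _))

∑-neg : ∀ (xs : List X) f → ∑ xs (λ x → - f x) ≡ - ∑ xs f
∑-neg []       f = refl
∑-neg (x ∷ xs) f = trans (cong (_+_ (- f x)) (∑-neg xs f)) (sym (ℤₚ.neg-distrib-+ (f x) _))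

∑-++ : ∀ (xs ys : List X) f → ∑ (xs ++ ys) f ≡ ∑ xs f + ∑ ys f
∑-++ []       ys f = sym (ℤₚ.+-identityˡ _)
∑-++ (x ∷ xs) ys f = trans (cong (_+_ (f x)) (∑-++ xs ys f)) (sym (ℤₚ.+-assoc (f x) _ _))

∑-map : ∀ (h : X → Y) xs f → ∑ (map h xs) f ≡ ∑ xs (f ∘ h)
∑-map h []       f = refl
∑-map h (x ∷ xs) f = cong (_+_ (f (h x))) (∑-map h xs f)

∑-swap : ∀ (xs : List X) (ys : List Y) (f : X → Y → ℤ) →
         ∑ xs (λ x → ∑ ys λ y → f x y) ≡ ∑ ys (λ y → ∑ xs λ x → f x y)
∑-swap []       ys f = sym (∑-zero ys {λ _ → 0ℤ} λ _ → refl)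
∑-swap (x ∷ xs) ys f = trans (cong (_+_ (∑ ys (f x))) (∑-swap xs ys f)) (sym (∑-+ ys (f x) (λ y → ∑ xs λ z → f z y)))

∑-filter : ∀ {P : X → Set} (P? : ∀ x → Dec (P x)) xs f →
           ∑ (filter P? xs) f ≡ ∑ xs (λ x → 𝟙 (P? x) * f x)
∑-filter P? []       f = refl
∑-filter P? (x ∷ xs) f with P? x
... | yes _ = cong₂ _+_ (sym (ℤₚ.*-identityˡ (f x))) (∑-filter P? xs f)
... | no  _ = trans (∑-filter P? xs f)
                    (sym (trans (cong (_+ ∑ xs (λ z → 𝟙 (P? z) * f z)) (ℤₚ.*-zeroˡ (f x))) (ℤₚ.+-identityˡ _)))

∑-cartesianProduct : ∀ (xs : List X) (ys : List Y) f →
  ∑ (cartesianProduct xs ys) f ≡ ∑ xs λ x → ∑ ys λ y → f (x , y)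
∑-cartesianProduct []       ys f = refl
∑-cartesianProduct (x ∷ xs) ys f = trans (∑-++ (map (x ,_) ys) _ f)
  (cong₂ _+_ (∑-map (x ,_) ys f) (∑-cartesianProduct xs ys f))

∏-cong-∈ : ∀ (xs : List X) {f g} → (∀ {x} → x ∈ xs → f x ≡ g x) → ∏ xs f ≡ ∏ xs g
∏-cong-∈ []       eq = refl
∏-cong-∈ (x ∷ xs) eq = cong₂ _*_ (eq (here refl)) (∏-cong-∈ xs (eq ∘ there))

∏-* : ∀ (xs : List X) f g → ∏ xs (λ x → f x * g x) ≡ ∏ xs f * ∏ xs g
∏-* []       f g = refl
∏-* (x ∷ xs) f g = trans (cong (f x * g x *_) (∏-* xs f g)) (lem (f x) (g x) _ _)
  where
  lem : ∀ a b c d → a * b * (c * d) ≡ a * c * (b * d)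
  lem = solve-∀

∏-map : ∀ (h : X → Y) xs f → ∏ (map h xs) f ≡ ∏ xs (f ∘ h)
∏-map h []       f = refl
∏-map h (x ∷ xs) f = cong (f (h x) *_) (∏-map h xs f)

∏-const : ∀ (xs : List X) c → ∏ xs (λ _ → c) ≡ c ^ length xs
∏-const []       c = refl
∏-const (x ∷ xs) c = cong (c *_) (∏-const xs c)

∏-++ : ∀ (xs ys : List X) f → ∏ (xs ++ ys) f ≡ ∏ xs f * ∏ ys f
∏-++ []       ys f = sym (ℤₚ.*-identityˡ _)
∏-++ (x ∷ xs) ys f = trans (cong (f x *_) (∏-++ xs ys f)) (sym (ℤₚ.*-assoc (f x) _ _))

∏-↭ : ∀ {xs ys : List X} f → xs ↭ ys → ∏ xs f ≡ ∏ ys f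
∏-↭ f refl         = refl
∏-↭ f (prep x r)   = cong (f x *_) (∏-↭ f r)
∏-↭ f (swap x y r) = trans (cong (λ t → f x * (f y * t)) (∏-↭ f r)) (lem (f x) (f y) _)
  where
  lem : ∀ a b c → a * (b * c) ≡ b * (a * c)
  lem = solve-∀
∏-↭ f (transᵖ r s)  = trans (∏-↭ f r) (∏-↭ f s)

*-assoc-comm : ∀ a b c → a * (b * c) ≡ b * (a * c)
*-assoc-comm = solve-∀

x≡-x⇒x≡0 : ∀ {x} → x ≡ - x → x ≡ 0ℤ
x≡-x⇒x≡0 {+ zero}      _  = refl
x≡-x⇒x≡0 {+ suc n}     ()
x≡-x⇒x≡0 {ℤ.-[1+ n ]}  ()

-1^ : ∀ m → (-1ℤ ^ m) * (-1ℤ ^ m) ≡ 1ℤ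
-1^ zero    = refl
-1^ (suc m) = trans (lem (-1ℤ ^ m)) (-1^ m)
  where
  lem : ∀ a → (-1ℤ * a) * (-1ℤ * a) ≡ a * a
  lem = solve-∀

-- Congruences

infix 4 _≈_[mod_]

-- A record, unlike the function _≡_[mod_], lets both sides be inferred.
record _≈_[mod_] (x y : ℤ) (n : ℕ) : Set where
  constructor cong⁺
  field cong⁻ : x ≡ y [mod n ]
open _≈_[mod_]

≡⇒≈ : ∀ {n x y} → x ≡ y → x ≈ y [mod n ]
≡⇒≈ {n} {x} refl = cong⁺ (ℤ∣.divides 0ℤ (trans (ℤₚ.+-inverseʳ x) refl))

mod-sym : ∀ {n x y} → x ≈ y [mod n ] → y ≈ x [mod n ]
mod-sym {n} {x} {y} (cong⁺ e) = cong⁺ $ subst (+ n ℤ∣.∣_) (lem x y) (ℤ∣.∣m⇒∣-m e)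
  where
  lem : ∀ x y → - (x - y) ≡ y - x
  lem = solve-∀

mod-trans : ∀ {n x y z} → x ≈ y [mod n ] → y ≈ z [mod n ] → x ≈ z [mod n ]
mod-trans {n} {x} {y} {z} (cong⁺ e) (cong⁺ e′) = cong⁺ $ subst (+ n ℤ∣.∣_) (lem x y z) (ℤ∣.∣m∣n⇒∣m+n e e′)
  where
  lem : ∀ x y z → (x - y) + (y - z) ≡ x - z
  lem = solve-∀

mod-+ : ∀ {n x y u v} → x ≈ y [mod n ] → u ≈ v [mod n ] → x + u ≈ y + v [mod n ]
mod-+ {n} {x} {y} {u} {v} (cong⁺ e) (cong⁺ e′) = cong⁺ $ subst (+ n ℤ∣.∣_) (lem x y u v) (ℤ∣.∣m∣n⇒∣m+n e e′)
  where
  lem : ∀ x y u v → (x - y) + (u - v) ≡ (x + u) - (y + v)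
  lem = solve-∀

mod-* : ∀ {n x y u v} → x ≈ y [mod n ] → u ≈ v [mod n ] → x * u ≈ y * v [mod n ]
mod-* {n} {x} {y} {u} {v} (cong⁺ e) (cong⁺ e′) = cong⁺ $
  subst (+ n ℤ∣.∣_) (lem x y u v) (ℤ∣.∣m∣n⇒∣m+n (ℤ∣.∣m⇒∣m*n u e) (ℤ∣.∣n⇒∣m*n y e′))
  where
  lem : ∀ x y u v → (x - y) * u + y * (u - v) ≡ x * u - y * v
  lem = solve-∀

mod-neg : ∀ {n x y} → x ≈ y [mod n ] → - x ≈ - y [mod n ]
mod-neg {n} {x} {y} (cong⁺ e) = cong⁺ $ subst (+ n ℤ∣.∣_) (lem x y) (ℤ∣.∣m⇒∣-m e)
  where
  lem : ∀ x y → - (x - y) ≡ - x - - y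
  lem = solve-∀

mod-- : ∀ {n x y u v} → x ≈ y [mod n ] → u ≈ v [mod n ] → x - u ≈ y - v [mod n ]
mod-- e e′ = mod-+ e (mod-neg e′)

mod-^ : ∀ {n x y} k → x ≈ y [mod n ] → x ^ k ≈ y ^ k [mod n ]
mod-^ zero    e = ≡⇒≈ refl
mod-^ (suc k) e = mod-* e (mod-^ k e)

mod-∑ : ∀ {n} (xs : List X) {f g} → (∀ x → f x ≈ g x [mod n ]) → ∑ xs f ≈ ∑ xs g [mod n ]
mod-∑ []       eq = ≡⇒≈ refl
mod-∑ (x ∷ xs) eq = mod-+ (eq x) (mod-∑ xs eq)

mod-∏ : ∀ {n} (xs : List X) {f g} → (∀ {x} → x ∈ xs → f x ≈ g x [mod n ]) → ∏ xs f ≈ ∏ xs g [mod n ]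
mod-∏ []       eq = ≡⇒≈ refl
mod-∏ (x ∷ xs) eq = mod-* (eq (here refl)) (mod-∏ xs (eq ∘ there))

mod-setoid : ℕ → Setoid _ _
mod-setoid n = record
  { Carrier = ℤ
  ; _≈_ = λ x y → x ≈ y [mod n ]
  ; isEquivalence = record { refl = ≡⇒≈ refl ; sym = mod-sym ; trans = mod-trans }
  }

-- Alternating functions of a list

s : ℕ → ℕ → ℤ
s x y = 𝟙 (x ℕ.<? y) - 𝟙 (y ℕ.<? x)

s-anti : ∀ x y → s x y ≡ - s y x
s-anti x y = lem (𝟙 (x ℕ.<? y)) (𝟙 (y ℕ.<? x))
  where
  lem : ∀ a b → a - b ≡ - (b - a)
  lem = solve-∀

s-self : ∀ x → s x x ≡ 0ℤ
s-self x = ℤₚ.+-inverseʳ (𝟙 (x ℕ.<? x))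

s-< : ∀ {x y} → x < y → s x y ≡ 1ℤ
s-< {x} {y} x<y = cong₂ _-_ (𝟙-true (x ℕ.<? y) x<y) (𝟙-false (y ℕ.<? x) (ℕₚ.<⇒≯ x<y))

s-> : ∀ {x y} → y < x → s x y ≡ -1ℤ
s-> {x} {y} y<x = trans (s-anti x y) (cong -_ (s-< y<x))

-- The sign of the permutation that sorts the list, as a product over all pairs of positions. Since
-- `s` is 0 on equal entries, a repetition makes the product 0.
sgn : List ℕ → ℤ
sgn []      = 1ℤ
sgn (x ∷ v) = ∏ v (s x) * sgn v

-- Adjacent transpositions generate all permutations. The property survives fixing a prefix, which
-- is what the recursions over tuples rely on.
record Alternating (H : List ℕ → ℤ) : Set where
  constructor alternating
  field transpose : ∀ u x y v → H (u ++ x ∷ y ∷ v) ≡ - H (u ++ y ∷ x ∷ v)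
open Alternating

alt-++ : ∀ {H} → Alternating H → ∀ w → Alternating (H ∘ (w ++_))
alt-++ {H} alt w .transpose u x y v = subst₂ (λ a b → H a ≡ - H b)
  (Listₚ.++-assoc w u _) (Listₚ.++-assoc w u _) (transpose alt (w ++ u) x y v)

alt-∷ : ∀ {H} → Alternating H → ∀ x → Alternating (H ∘ (x ∷_))
alt-∷ alt x = alt-++ alt (x ∷ [])

-- Moving one pair past another takes four adjacent transpositions, an even number.
alt-pair : ∀ {H} → Alternating H → ∀ u a b c d v →
           H (u ++ a ∷ b ∷ c ∷ d ∷ v) ≡ H (u ++ c ∷ d ∷ a ∷ b ∷ v)
alt-pair {H} alt u a b c d v = begin
  H (u ++ a ∷ b ∷ c ∷ d ∷ v)             ≡⟨ transpose (alt-++ alt u) (a ∷ []) b c _ ⟩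
  - H (u ++ a ∷ c ∷ b ∷ d ∷ v)           ≡⟨ cong -_ (transpose (alt-++ alt u) [] a c _) ⟩
  - - H (u ++ c ∷ a ∷ b ∷ d ∷ v)         ≡⟨ ℤₚ.neg-involutive _ ⟩
  H (u ++ c ∷ a ∷ b ∷ d ∷ v)             ≡⟨ transpose (alt-++ alt u) (c ∷ a ∷ []) b d v ⟩
  - H (u ++ c ∷ a ∷ d ∷ b ∷ v)           ≡⟨ cong -_ (transpose (alt-++ alt u) (c ∷ []) a d _) ⟩
  - - H (u ++ c ∷ d ∷ a ∷ b ∷ v)         ≡⟨ ℤₚ.neg-involutive _ ⟩
  H (u ++ c ∷ d ∷ a ∷ b ∷ v)             ∎
  where open ≡-Reasoning

sgn-alt : Alternating sgn
sgn-alt .transpose []      x y v = trans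
  (cong (λ t → t * ∏ v (s x) * (∏ v (s y) * sgn v)) (s-anti x y))
  (lem (s y x) (∏ v (s x)) (∏ v (s y)) (sgn v))
  where
  lem : ∀ a b c d → - a * b * (c * d) ≡ - (a * c * (b * d))
  lem = solve-∀
sgn-alt .transpose (z ∷ u) x y v = begin
  ∏ (u ++ x ∷ y ∷ v) (s z) * sgn (u ++ x ∷ y ∷ v)
    ≡⟨ cong₂ _*_ (∏-↭ (s z) (↭ₚ.++⁺ˡ u (swap x y refl))) (transpose sgn-alt u x y v) ⟩
  ∏ (u ++ y ∷ x ∷ v) (s z) * - sgn (u ++ y ∷ x ∷ v)
    ≡⟨ ℤₚ.neg-distribʳ-* (∏ (u ++ y ∷ x ∷ v) (s z)) _ ⟨
  - (∏ (u ++ y ∷ x ∷ v) (s z) * sgn (u ++ y ∷ x ∷ v)) ∎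
  where open ≡-Reasoning

sgn-≢0⇒Unique : ∀ v → sgn v ≢ 0ℤ → Unique v
sgn-≢0⇒Unique []      _  = []
sgn-≢0⇒Unique (x ∷ v) nz =
  Allₚ.¬Any⇒All¬ v (λ x∈v → nz (trans (cong (_* sgn v) (∏≡0 v x∈v)) (ℤₚ.*-zeroˡ (sgn v))))
  ∷ sgn-≢0⇒Unique v (λ eq → nz (trans (cong (∏ v (s x) *_) eq) (ℤₚ.*-zeroʳ (∏ v (s x)))))
  where
  ∏≡0 : ∀ v → x ∈ v → ∏ v (s x) ≡ 0ℤ
  ∏≡0 (y ∷ v) (here refl) = trans (cong (_* ∏ v (s x)) (s-self x)) (ℤₚ.*-zeroˡ (∏ v (s x)))
  ∏≡0 (y ∷ v) (there x∈v) = trans (cong (s x y *_) (∏≡0 v x∈v)) (ℤₚ.*-zeroʳ (s x y))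

-- Alternating sums of monomials

module _ (X : List ℕ) where

  -- The sum of x₁^e₁ ⋯ x_l^e_l H(x₁, ..., x_l) over all tuples in `X`. For `H` = `sgn` and `X` =
  -- {1, ..., l} it is a generalised Vandermonde determinant.
  E : List ℕ → (List ℕ → ℤ) → ℤ
  E []       H = H []
  E (e ∷ es) H = ∑ X λ x → (+ x) ^ e * E es (H ∘ (x ∷_))

  E-cong : ∀ es {H K} → (∀ v → H v ≡ K v) → E es H ≡ E es K
  E-cong []       eq = eq []
  E-cong (e ∷ es) eq = ∑-cong X λ x → cong ((+ x) ^ e *_) (E-cong es λ v → eq (x ∷ v))

  E-+ : ∀ es H K → E es (λ v → H v + K v) ≡ E es H + E es K
  E-+ []       H K = refl
  E-+ (e ∷ es) H K = trans
    (∑-cong X λ x → trans (cong ((+ x) ^ e *_) (E-+ es _ _)) (ℤₚ.*-distribˡ-+ ((+ x) ^ e) _ _))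
    (∑-+ X _ _)

  E-* : ∀ es c H → E es (λ v → c * H v) ≡ c * E es H
  E-* []       c H = refl
  E-* (e ∷ es) c H = trans
    (∑-cong X λ x → trans (cong ((+ x) ^ e *_) (E-* es c _)) (*-assoc-comm ((+ x) ^ e) c _))
    (∑-* X c _)

  E-++ : ∀ es es′ H → E (es ++ es′) H ≡ E es (λ v → E es′ λ u → H (v ++ u))
  E-++ []       es′ H = refl
  E-++ (e ∷ es) es′ H = ∑-cong X λ x → cong ((+ x) ^ e *_) (E-++ es es′ _)

  -- Interchanging the two outer summations amounts to exchanging the first two arguments of `H`.
  E-swap : ∀ a b es {H} → Alternating H → E (a ∷ b ∷ es) H ≡ - E (b ∷ a ∷ es) H
  E-swap a b es {H} alt = begin
    ∑ X (λ x → (+ x) ^ a * ∑ X (λ y → (+ y) ^ b * E es (λ v → H (x ∷ y ∷ v))))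
      ≡⟨ (∑-cong X λ x → sym (∑-* X ((+ x) ^ a) _)) ⟩
    ∑ X (λ x → ∑ X (λ y → (+ x) ^ a * ((+ y) ^ b * E es (λ v → H (x ∷ y ∷ v)))))
      ≡⟨ ∑-swap X X _ ⟩
    ∑ X (λ y → ∑ X (λ x → (+ x) ^ a * ((+ y) ^ b * E es (λ v → H (x ∷ y ∷ v)))))
      ≡⟨ (∑-cong X λ y → trans (∑-cong X λ x → term x y) (∑-* X (-1ℤ * (+ y) ^ b) _)) ⟩
    ∑ X (λ y → -1ℤ * (+ y) ^ b * ∑ X (λ x → (+ x) ^ a * E es (λ v → H (y ∷ x ∷ v))))
      ≡⟨ (∑-cong X λ y → ℤₚ.*-assoc -1ℤ ((+ y) ^ b) _) ⟩
    ∑ X (λ y → -1ℤ * ((+ y) ^ b * ∑ X (λ x → (+ x) ^ a * E es (λ v → H (y ∷ x ∷ v)))))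
      ≡⟨ ∑-* X -1ℤ _ ⟩
    -1ℤ * E (b ∷ a ∷ es) H
      ≡⟨ ℤₚ.-1*i≡-i _ ⟩
    - E (b ∷ a ∷ es) H ∎
    where
    open ≡-Reasoning
    lem : ∀ x y e → x * (y * (-1ℤ * e)) ≡ -1ℤ * y * (x * e)
    lem = solve-∀
    term : ∀ x y → (+ x) ^ a * ((+ y) ^ b * E es (λ v → H (x ∷ y ∷ v)))
                 ≡ -1ℤ * (+ y) ^ b * ((+ x) ^ a * E es (λ v → H (y ∷ x ∷ v)))
    term x y = trans
      (cong (λ t → (+ x) ^ a * ((+ y) ^ b * t))
        (trans (E-cong es λ v → trans (transpose alt [] x y v) (sym (ℤₚ.-1*i≡-i _))) (E-* es -1ℤ _)))
      (lem ((+ x) ^ a) ((+ y) ^ b) _)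

  E-prep : ∀ es es′ δ e → (∀ {H} → Alternating H → E es H ≡ δ * E es′ H) →
           ∀ {H} → Alternating H → E (e ∷ es) H ≡ δ * E (e ∷ es′) H
  E-prep es es′ δ e eq alt = trans
    (∑-cong X λ x → trans (cong ((+ x) ^ e *_) (eq (alt-∷ alt x))) (*-assoc-comm ((+ x) ^ e) δ _))
    (∑-* X δ _)

  -- The factor is chosen before `H`: under `prep` the function `H` changes with the value x put in
  -- front, and one common factor must come out of the sum over x.
  E-↭ : ∀ {es es′} → es ↭ es′ → ∃ λ δ → ∀ {H} → Alternating H → E es H ≡ δ * E es′ H
  E-↭ refl = 1ℤ , λ _ → sym (ℤₚ.*-identityˡ _)
  E-↭ (prep {xs = es} {ys = es′} e r) with E-↭ r
  ... | δ , eq = δ , λ {H} → E-prep es es′ δ e eq {H}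
  E-↭ (swap {xs = es} {ys = es′} a b r) with E-↭ r
  ... | δ , eq = - δ , λ {H} alt → begin
    E (a ∷ b ∷ es) H        ≡⟨ E-swap a b es alt ⟩
    - E (b ∷ a ∷ es) H      ≡⟨ cong -_ (prep² b a alt) ⟩
    - (δ * E (b ∷ a ∷ es′) H) ≡⟨ ℤₚ.neg-distribˡ-* δ _ ⟩
    - δ * E (b ∷ a ∷ es′) H ∎
    where
    open ≡-Reasoning
    prep² : ∀ a b {H} → Alternating H → E (a ∷ b ∷ es) H ≡ δ * E (a ∷ b ∷ es′) H
    prep² a b = E-prep (b ∷ es) (b ∷ es′) δ a (E-prep es es′ δ b eq)
  E-↭ (transᵖ r r′) with E-↭ r | E-↭ r′
  ... | δ , eq | δ′ , eq′ = δ * δ′ , λ alt →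
    trans (eq alt) (trans (cong (δ *_) (eq′ alt)) (sym (ℤₚ.*-assoc δ δ′ _)))

  -- If two neighbouring exponents agree, `E-swap` gives E = - E, hence E = 0 in ℤ.
  E-repeat : ∀ {es} → Linked _≤_ es → Linked _<_ es ⊎ (∀ {H} → Alternating H → E es H ≡ 0ℤ)
  E-repeat []      = inj₁ []
  E-repeat [-]     = inj₁ [-]
  E-repeat {a ∷ b ∷ es} (a≤b ∷ es↗) with ℕₚ.m≤n⇒m<n∨m≡n a≤b
  ... | inj₂ refl = inj₂ λ alt → x≡-x⇒x≡0 (E-swap a a es alt)
  ... | inj₁ a<b with E-repeat es↗
  ...   | inj₁ es⇑ = inj₁ (a<b ∷ es⇑)
  ...   | inj₂ eq  = inj₂ λ alt → ∑-zero X λ x →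
    trans (cong ((+ x) ^ a *_) (eq (alt-∷ alt x))) (ℤₚ.*-zeroʳ ((+ x) ^ a))

-- The series k + (k + 1) + ⋯ + (k + l - 1), the least sum of l distinct exponents that are at least
-- k.
tri : ℕ → ℕ → ℕ
tri k zero    = 0
tri k (suc l) = k ℕ.+ tri (suc k) l

tri-mono : ∀ {j k} l → j ≤ k → tri j l ≤ tri k l
tri-mono zero    j≤k = z≤n
tri-mono (suc l) j≤k = ℕₚ.+-mono-≤ j≤k (tri-mono l (s≤s j≤k))

tri-≤-sum : ∀ {e es} → Linked _<_ (e ∷ es) → tri e (length (e ∷ es)) ≤ sum (e ∷ es)
tri-≤-sum {e} [-] = ℕₚ.≤-refl
tri-≤-sum {e} {es = es} (e<e′ ∷ es⇑) =
  ℕₚ.+-monoʳ-≤ e (ℕₚ.≤-trans (tri-mono (length es) e<e′) (tri-≤-sum es⇑))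

tri-≤-sum₀ : ∀ {es} → Linked _<_ es → tri 0 (length es) ≤ sum es
tri-≤-sum₀ []              = z≤n
tri-≤-sum₀ {e ∷ es} es⇑ = ℕₚ.≤-trans (tri-mono (length (e ∷ es)) z≤n) (tri-≤-sum es⇑)

-- The closed form, doubled and with l moved to the left, so that neither division nor truncated
-- subtraction occurs.
tri-closed : ∀ k l → tri k l ℕ.+ tri k l ℕ.+ l ≡ l ℕ.* (k ℕ.+ k ℕ.+ l)
tri-closed k zero    = refl
tri-closed k (suc l) = trans (lem k l (tri (suc k) l)) (trans (cong (λ t → t ℕ.+ (k ℕ.+ k ℕ.+ 1)) (tri-closed (suc k) l)) (lem′ k l))
  where
  lem : ∀ k l t → (k ℕ.+ t) ℕ.+ (k ℕ.+ t) ℕ.+ (1 ℕ.+ l) ≡ (t ℕ.+ t ℕ.+ l) ℕ.+ (k ℕ.+ k ℕ.+ 1)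
  lem = ℕRing.solve-∀
  lem′ : ∀ k l → l ℕ.* ((1 ℕ.+ k) ℕ.+ (1 ℕ.+ k) ℕ.+ l) ℕ.+ (k ℕ.+ k ℕ.+ 1) ≡ (1 ℕ.+ l) ℕ.* (k ℕ.+ k ℕ.+ (1 ℕ.+ l))
  lem′ = ℕRing.solve-∀

E-vanish : ∀ X es {H} → Alternating H → sum es < tri 0 (length es) → E X es H ≡ 0ℤ
E-vanish X es alt small with E-↭ X (↭-sym (sort-↭ es)) | E-repeat X (sort-↗ es)
... | δ , eq | inj₂ eq₀ = trans (eq alt) (trans (cong (δ *_) (eq₀ alt)) (ℤₚ.*-zeroʳ δ))
... | _      | inj₁ es⇑ = contradiction
  (subst₂ _≤_ (cong (tri 0) (↭ₚ.↭-length (sort-↭ es))) (Sumₚ.sum-↭ (sort-↭ es)) (tri-≤-sum₀ es⇑))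
  (ℕₚ.<⇒≱ small)

-- Sums over pairs with polynomial weights

Weight : Set
Weight = ℕ → ℕ → ℤ

-- Deg k w: the weight w (a , b) is a polynomial in a and b of total degree at most k.
data Deg (k : ℕ) (w : Weight) : Set where
  monomial : ∀ c i j → i ℕ.+ j ≤ k → (∀ a b → w a b ≡ c * ((+ a) ^ i * (+ b) ^ j)) → Deg k w
  plus     : ∀ {u v} → Deg k u → Deg k v → (∀ a b → w a b ≡ u a b + v a b) → Deg k w

deg-mono : ∀ {k l w} → k ≤ l → Deg k w → Deg l w
deg-mono k≤l (monomial c i j le e) = monomial c i j (ℕₚ.≤-trans le k≤l) e
deg-mono k≤l (plus d d′ e)         = plus (deg-mono k≤l d) (deg-mono k≤l d′) e

deg-* : ∀ {k w} c → Deg k w → Deg k (λ a b → c * w a b)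
deg-* c (monomial c′ i j le e) = monomial (c * c′) i j le λ a b →
  trans (cong (c *_) (e a b)) (sym (ℤₚ.*-assoc c c′ _))
deg-* c (plus d d′ e) = plus (deg-* c d) (deg-* c d′) λ a b →
  trans (cong (c *_) (e a b)) (ℤₚ.*-distribˡ-+ c _ _)

deg-const : ∀ k c → Deg k (λ _ _ → c)
deg-const k c = monomial c 0 0 z≤n λ _ _ → sym (ℤₚ.*-identityʳ c)

deg-*ˡ : ∀ {k w} → Deg k w → Deg (suc k) (λ a b → + a * w a b)
deg-*ˡ (monomial c i j le e) = monomial c (suc i) j (s≤s le) λ a b →
  trans (cong (+ a *_) (e a b)) (lem (+ a) c ((+ a) ^ i) ((+ b) ^ j))
  where
  lem : ∀ x c y z → x * (c * (y * z)) ≡ c * (x * y * z)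
  lem = solve-∀
deg-*ˡ (plus d d′ e) = plus (deg-*ˡ d) (deg-*ˡ d′) λ a b →
  trans (cong (+ a *_) (e a b)) (ℤₚ.*-distribˡ-+ (+ a) _ _)

deg-*ʳ : ∀ {k w} → Deg k w → Deg (suc k) (λ a b → + b * w a b)
deg-*ʳ {k} (monomial c i j le e) =
  monomial c i (suc j) (subst (_≤ suc k) (sym (ℕₚ.+-suc i j)) (s≤s le)) λ a b →
  trans (cong (+ b *_) (e a b)) (lem (+ b) c ((+ a) ^ i) ((+ b) ^ j))
  where
  lem : ∀ x c y z → x * (c * (y * z)) ≡ c * (y * (x * z))
  lem = solve-∀
deg-*ʳ (plus d d′ e) = plus (deg-*ʳ d) (deg-*ʳ d′) λ a b →
  trans (cong (+ b *_) (e a b)) (ℤₚ.*-distribˡ-+ (+ b) _ _)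

deg-shift : ∀ {k w} d → Deg k w → Deg (suc k) (λ a b → (+ b - + a + d) * w a b)
deg-shift {k} {w} d D = plus {u = λ a b → + b * w a b} (deg-*ʳ D)
  (plus {u = λ a b → -1ℤ * (+ a * w a b)} (deg-* -1ℤ (deg-*ˡ D)) (deg-mono (ℕₚ.n≤1+n k) (deg-* d D)) λ _ _ → refl)
  λ a b → lem (+ a) (+ b) d (w a b)
  where
  lem : ∀ a b d w → (b - a + d) * w ≡ b * w + (-1ℤ * (a * w) + d * w)
  lem = solve-∀

deg-power : ∀ k d → Deg k (λ a b → (+ b - + a + d) ^ k)
deg-power zero    d = deg-const 0 1ℤ
deg-power (suc k) d = deg-shift d (deg-power k d)

-- The binomial expansion with its two leading terms in x = b - a kept explicit; these are the terms
-- that have to cancel later. The summand `0ℤ` gives the powers of x the form treated by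
-- `deg-power`.
power-expansion : ∀ k d → ∃ λ R → Deg k R ×
  (∀ a b → (+ b - + a + d) ^ suc (suc k) ≡
           (+ b - + a + 0ℤ) ^ suc (suc k) + (+ suc (suc k) * d * (+ b - + a + 0ℤ) ^ suc k + R a b))
power-expansion zero d = (λ _ _ → d * d) , deg-const 0 (d * d) , λ a b → lem (+ b - + a) d
  where
  lem : ∀ x d → (x + d) * ((x + d) * 1ℤ) ≡ (x + 0ℤ) * ((x + 0ℤ) * 1ℤ) + ((1ℤ + 1ℤ) * d * ((x + 0ℤ) * 1ℤ) + d * d)
  lem = solve-∀
power-expansion (suc k) d with power-expansion k d
... | R , degR , eq =
  _ ,
  plus (deg-* (d * (+ suc (suc k) * d)) (deg-power (suc k) 0ℤ)) (deg-shift d degR) (λ _ _ → refl) ,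
  λ a b → trans (cong ((+ b - + a + d) *_) (eq a b))
    (lem (+ b - + a) d (+ suc (suc k)) ((+ b - + a + 0ℤ) ^ suc k) (R a b))
  where
  lem : ∀ x d m y r → (x + d) * ((x + 0ℤ) * y + (m * d * y + r)) ≡
                      (x + 0ℤ) * ((x + 0ℤ) * y) + ((1ℤ + m) * d * ((x + 0ℤ) * y) + (d * (m * d) * y + (x + d) * r))
  lem = solve-∀

module _ (X : List ℕ) where

  -- `Q ws sgn` is the sum Q of the overview. A general `H` is needed because the recursion stores
  -- the pairs already chosen in it.
  Q : List Weight → (List ℕ → ℤ) → ℤ
  Q []       H = H []
  Q (w ∷ ws) H = ∑ X λ a → ∑ X λ b → w a b * Q ws (λ v → H (a ∷ b ∷ v))

  ∑∑-cong : ∀ {f g : Weight} → (∀ a b → f a b ≡ g a b) → ∑ X (λ a → ∑ X (f a)) ≡ ∑ X (λ a → ∑ X (g a))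
  ∑∑-cong eq = ∑-cong X λ a → ∑-cong X (eq a)

  ∑∑-+ : ∀ (f g : Weight) → ∑ X (λ a → ∑ X λ b → f a b + g a b) ≡ ∑ X (λ a → ∑ X (f a)) + ∑ X (λ a → ∑ X (g a))
  ∑∑-+ f g = trans (∑-cong X λ a → ∑-+ X (f a) (g a)) (∑-+ X _ _)

  ∑∑-* : ∀ c (f : Weight) → ∑ X (λ a → ∑ X λ b → c * f a b) ≡ c * ∑ X (λ a → ∑ X (f a))
  ∑∑-* c f = trans (∑-cong X λ a → ∑-* X c (f a)) (∑-* X c _)

  Q-cong : ∀ ws {H K} → (∀ v → H v ≡ K v) → Q ws H ≡ Q ws K
  Q-cong []       eq = eq []
  Q-cong (w ∷ ws) eq = ∑∑-cong λ a b → cong (w a b *_) (Q-cong ws λ v → eq (a ∷ b ∷ v))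

  Q-ext : ∀ us {u w} ws H → (∀ a b → w a b ≡ u a b) → Q (us ++ w ∷ ws) H ≡ Q (us ++ u ∷ ws) H
  Q-ext []       ws H eq = ∑∑-cong λ a b → cong (_* Q ws (λ v → H (a ∷ b ∷ v))) (eq a b)
  Q-ext (x ∷ us) ws H eq = ∑∑-cong λ a b → cong (x a b *_) (Q-ext us ws _ eq)

  -- Together with `Q-ext` and `Q-*` this is multilinearity in the weights; the prefix `us` marks
  -- the slot that is changed.
  Q-+ : ∀ us u w ws H → Q (us ++ (λ a b → u a b + w a b) ∷ ws) H ≡ Q (us ++ u ∷ ws) H + Q (us ++ w ∷ ws) H
  Q-+ []       u w ws H = trans (∑∑-cong λ a b → ℤₚ.*-distribʳ-+ (Q ws (λ v → H (a ∷ b ∷ v))) (u a b) (w a b)) (∑∑-+ _ _)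
  Q-+ (x ∷ us) u w ws H = trans
    (∑∑-cong λ a b → trans (cong (x a b *_) (Q-+ us u w ws _)) (ℤₚ.*-distribˡ-+ (x a b) _ _)) (∑∑-+ _ _)

  Q-* : ∀ us c w ws H → Q (us ++ (λ a b → c * w a b) ∷ ws) H ≡ c * Q (us ++ w ∷ ws) H
  Q-* []       c w ws H = trans (∑∑-cong λ a b → ℤₚ.*-assoc c (w a b) _) (∑∑-* c _)
  Q-* (x ∷ us) c w ws H = trans
    (∑∑-cong λ a b → trans (cong (x a b *_) (Q-* us c w ws _)) (*-assoc-comm (x a b) c _)) (∑∑-* c _)

  data Degs : ℕ → List Weight → Set where
    []  : Degs 0 []
    _∷_ : ∀ {k l w ws} → Deg k w → Degs l ws → Degs (k ℕ.+ l) (w ∷ ws)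

  degs-++ : ∀ {k l us ws} → Degs k us → Degs l ws → Degs (k ℕ.+ l) (us ++ ws)
  degs-++ []                              ds′ = ds′
  degs-++ {ws = ws} (_∷_ {k} {l} {u} {us} d ds) ds′ =
    subst (λ m → Degs m (u ∷ us ++ ws)) (sym (ℕₚ.+-assoc k l _)) (d ∷ degs-++ ds ds′)

  -- An intermediate stage of the expansion into monomials: the first variables already carry the
  -- exponents `es`, the others still carry polynomial weights. Each monomial of the next weight
  -- moves two exponents into `es` and leaves the bound on the total degree intact, until `E-vanish`
  -- applies. The companion lemma is the inner induction over the sum of monomials that makes up one
  -- weight.
  EQ-vanish : ∀ es {K ws H} → Degs K ws → Alternating H →
              sum es ℕ.+ K < tri 0 (length es ℕ.+ (length ws ℕ.+ length ws)) →
              E X es (λ v → Q ws (λ u → H (v ++ u))) ≡ 0ℤ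
  EQ-vanish-∷ : ∀ es {k l w ws H} → Deg k w → Degs l ws → Alternating H →
                sum es ℕ.+ (k ℕ.+ l) < tri 0 (length es ℕ.+ (suc (length ws) ℕ.+ suc (length ws))) →
                E X es (λ v → Q (w ∷ ws) (λ u → H (v ++ u))) ≡ 0ℤ
  EQ-vanish es {H = H} [] alt small = trans
    (E-cong X es λ v → cong H (Listₚ.++-identityʳ v))
    (E-vanish X es alt (subst₂ (λ m l → m < tri 0 l) (ℕₚ.+-identityʳ (sum es)) (ℕₚ.+-identityʳ (length es)) small))
  EQ-vanish es (d ∷ ds) alt small = EQ-vanish-∷ es d ds alt small

  EQ-vanish-∷ es {k} {l} {w} {ws} {H} (monomial c i j le eq) ds alt small = begin
    E X es (λ v → Q (w ∷ ws) (λ u → H (v ++ u)))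
      ≡⟨ (E-cong X es λ v → trans (∑∑-cong λ a b → mono v a b)
           (trans (∑∑-* c _) (cong (c *_) (∑-cong X λ a → ∑-* X ((+ a) ^ i) _)))) ⟩
    E X es (λ v → c * E X (i ∷ j ∷ []) (λ u → Q ws (λ u′ → H (v ++ u ++ u′))))
      ≡⟨ E-* X es c _ ⟩
    c * E X es (λ v → E X (i ∷ j ∷ []) (λ u → Q ws (λ u′ → H (v ++ u ++ u′))))
      ≡⟨ cong (c *_) (trans (E-cong X es λ v → E-cong X (i ∷ j ∷ []) λ u → Q-cong ws λ u′ →
           cong H (sym (Listₚ.++-assoc v u u′))) (sym (E-++ X es (i ∷ j ∷ []) _))) ⟩
    c * E X (es ++ i ∷ j ∷ []) (λ v → Q ws (λ u → H (v ++ u)))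
      ≡⟨ cong (c *_) (EQ-vanish (es ++ i ∷ j ∷ []) ds alt small′) ⟩
    c * 0ℤ
      ≡⟨ ℤₚ.*-zeroʳ c ⟩
    0ℤ ∎
    where
    open ≡-Reasoning
    mono : ∀ v a b → w a b * Q ws (λ u → H (v ++ a ∷ b ∷ u))
                   ≡ c * ((+ a) ^ i * ((+ b) ^ j * Q ws (λ u → H (v ++ a ∷ b ∷ u))))
    mono v a b = trans (cong (_* Q ws _) (eq a b)) (lem c ((+ a) ^ i) ((+ b) ^ j) _)
      where
      lem : ∀ c x y q → c * (x * y) * q ≡ c * (x * (y * q))
      lem = solve-∀
    small′ : sum (es ++ i ∷ j ∷ []) ℕ.+ l < tri 0 (length (es ++ i ∷ j ∷ []) ℕ.+ (length ws ℕ.+ length ws))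
    small′ = ℕₚ.≤-<-trans
      (ℕₚ.≤-trans (ℕₚ.≤-reflexive (trans (cong (ℕ._+ l) (Sumₚ.sum-++ es _)) (lem₁ (sum es) i j l)))
        (ℕₚ.+-monoʳ-≤ (sum es) (ℕₚ.+-monoˡ-≤ l le)))
      (subst (λ m → sum es ℕ.+ (k ℕ.+ l) < tri 0 m)
        (trans (lem₂ (length es) (length ws)) (cong (ℕ._+ _) (sym (Listₚ.length-++ es)))) small)
      where
      lem₁ : ∀ s i j l → s ℕ.+ (i ℕ.+ (j ℕ.+ 0)) ℕ.+ l ≡ s ℕ.+ (i ℕ.+ j ℕ.+ l)
      lem₁ = ℕRing.solve-∀
      lem₂ : ∀ e w → e ℕ.+ ((1 ℕ.+ w) ℕ.+ (1 ℕ.+ w)) ≡ e ℕ.+ 2 ℕ.+ (w ℕ.+ w)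
      lem₂ = ℕRing.solve-∀
  EQ-vanish-∷ es {w = w} {ws} {H} (plus {u} {u′} d d′ eq) ds alt small = begin
    E X es (λ v → Q (w ∷ ws) (λ u → H (v ++ u)))
      ≡⟨ (E-cong X es λ v → trans (Q-ext [] ws (λ z → H (v ++ z)) eq) (Q-+ [] u u′ ws (λ z → H (v ++ z)))) ⟩
    E X es (λ v → Q (u ∷ ws) (λ u → H (v ++ u)) + Q (u′ ∷ ws) (λ u → H (v ++ u)))
      ≡⟨ E-+ X es _ _ ⟩
    E X es (λ v → Q (u ∷ ws) (λ u → H (v ++ u))) + E X es (λ v → Q (u′ ∷ ws) (λ u → H (v ++ u)))
      ≡⟨ cong₂ _+_ (EQ-vanish-∷ es d ds alt small) (EQ-vanish-∷ es d′ ds alt small) ⟩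
    0ℤ ∎
    where open ≡-Reasoning

  Q-vanish : ∀ {K ws H} → Degs K ws → Alternating H →
             K < tri 0 (length ws ℕ.+ length ws) → Q ws H ≡ 0ℤ
  Q-vanish = EQ-vanish []

-- For N = p − 1 this is [b − a = d] − [b − a = −d] in 𝔽_p, by Fermat's little theorem.
g : ℕ → ℕ → Weight
g N d a b = (+ b - + a + + d) ^ N - (+ b - + a + - + d) ^ N

-- The powers x^N of (x + d)^N and (x - d)^N cancel, which leaves the leading term 2 N d x^(N-1).
g-deg : ∀ k d → Deg (suc k) (g (suc (suc k)) d)
g-deg k d with power-expansion k (+ d) | power-expansion k (- + d)
... | R , degR , eq | R′ , degR′ , eq′ = plus
  (deg-* (+ suc (suc k) * (+ d - - + d)) (deg-power (suc k) 0ℤ))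
  (deg-mono (ℕₚ.n≤1+n k) (plus degR (deg-* -1ℤ degR′) λ _ _ → refl))
  λ a b → trans (cong₂ _-_ (eq a b) (eq′ a b)) (lem ((+ b - + a + 0ℤ) ^ suc (suc k)) (+ suc (suc k)) (+ d) ((+ b - + a + 0ℤ) ^ suc k) (R a b) (R′ a b))
  where
  lem : ∀ y m d z r r′ → y + (m * d * z + r) - (y + (m * - d * z + r′)) ≡ m * (d - - d) * z + (r + -1ℤ * r′)
  lem = solve-∀

-- The coefficient 2 N d of x^(N-1) is linear in d, so subtracting d times the weight for 1 removes
-- this term too.
g-linear-deg : ∀ k d → Deg k (λ a b → g (suc (suc k)) d a b - + d * g (suc (suc k)) 1 a b)
g-linear-deg k d with power-expansion k (+ d) | power-expansion k (- + d) | power-expansion k 1ℤ | power-expansion k -1ℤ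
... | R₁ , deg₁ , eq₁ | R₂ , deg₂ , eq₂ | R₃ , deg₃ , eq₃ | R₄ , deg₄ , eq₄ = plus
  (plus deg₁ (deg-* -1ℤ deg₂) λ _ _ → refl)
  (plus (deg-* (- + d) deg₃) (deg-* (+ d) deg₄) λ _ _ → refl)
  λ a b → trans
    (cong₂ (λ x y → x - + d * y) (cong₂ _-_ (eq₁ a b) (eq₂ a b)) (cong₂ _-_ (eq₃ a b) (eq₄ a b)))
    (lem ((+ b - + a + 0ℤ) ^ suc (suc k)) (+ suc (suc k)) (+ d) ((+ b - + a + 0ℤ) ^ suc k) (R₁ a b) (R₂ a b) (R₃ a b) (R₄ a b))
  where
  lem : ∀ y m d z r₁ r₂ r₃ r₄ →
    (y + (m * d * z + r₁) - (y + (m * - d * z + r₂))) -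
    d * (y + (m * 1ℤ * z + r₃) - (y + (m * -1ℤ * z + r₄))) ≡
    (r₁ + -1ℤ * r₂) + (- d * r₃ + d * r₄)
  lem = solve-∀

degs-all : ∀ X {k ws} → All (Deg k) ws → Degs X (length ws ℕ.* k) ws
degs-all X []       = []
degs-all X (d ∷ ds) = d ∷ degs-all X ds

tri₀-even : ∀ n k → suc (suc k) ≡ n ℕ.+ n → tri 0 (n ℕ.+ n) ≡ n ℕ.* suc k
tri₀-even n k eq = ℕₚ.*-cancelˡ-≡ _ _ 2 (ℕₚ.+-cancelʳ-≡ (n ℕ.+ n) _ _ (begin
  2 ℕ.* tri 0 (n ℕ.+ n) ℕ.+ (n ℕ.+ n)                ≡⟨ lem₁ (tri 0 (n ℕ.+ n)) (n ℕ.+ n) ⟩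
  tri 0 (n ℕ.+ n) ℕ.+ tri 0 (n ℕ.+ n) ℕ.+ (n ℕ.+ n)  ≡⟨ tri-closed 0 (n ℕ.+ n) ⟩
  (n ℕ.+ n) ℕ.* (n ℕ.+ n)                            ≡⟨ cong ((n ℕ.+ n) ℕ.*_) eq ⟨
  (n ℕ.+ n) ℕ.* suc (suc k)                          ≡⟨ lem₂ n k ⟩
  2 ℕ.* (n ℕ.* suc k) ℕ.+ (n ℕ.+ n)                  ∎))
  where
  open ≡-Reasoning
  lem₁ : ∀ t m → 2 ℕ.* t ℕ.+ m ≡ t ℕ.+ t ℕ.+ m
  lem₁ = ℕRing.solve-∀
  lem₂ : ∀ n k → (n ℕ.+ n) ℕ.* (2 ℕ.+ k) ≡ 2 ℕ.* (n ℕ.* (1 ℕ.+ k)) ℕ.+ (n ℕ.+ n)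
  lem₂ = ℕRing.solve-∀

-- Replacing the weight for d by d times the weight for 1

module _ (X : List ℕ) (n k : ℕ) (k+2≡2n : suc (suc k) ≡ n ℕ.+ n) {H : List ℕ → ℤ} (alt : Alternating H) where

  private
    N = suc (suc k)

  -- The difference of the two weights has degree k, one less than the bound k + 1 for each of the
  -- other n - 1 slots. As n(k + 1) is exactly the threshold of `Q-vanish`, this loss of one is
  -- enough.
  Q-g-step : ∀ us d ws → All (Deg (suc k)) us → All (Deg (suc k)) ws → length us ℕ.+ suc (length ws) ≡ n →
             Q X (us ++ g N d ∷ ws) H ≡ + d * Q X (us ++ g N 1 ∷ ws) H
  Q-g-step us d ws degus degws len = begin
    Q X (us ++ g N d ∷ ws) H
      ≡⟨ Q-ext X us ws H (λ a b → lem (g N d a b) (+ d * g N 1 a b)) ⟩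
    Q X (us ++ (λ a b → + d * g N 1 a b + (g N d a b - + d * g N 1 a b)) ∷ ws) H
      ≡⟨ Q-+ X us (λ a b → + d * g N 1 a b) (λ a b → g N d a b - + d * g N 1 a b) ws H ⟩
    Q X (us ++ (λ a b → + d * g N 1 a b) ∷ ws) H + Q X (us ++ (λ a b → g N d a b - + d * g N 1 a b) ∷ ws) H
      ≡⟨ cong₂ _+_ (Q-* X us (+ d) (g N 1) ws H)
           (Q-vanish X (degs-++ X (degs-all X degus) (g-linear-deg k d ∷ degs-all X degws)) alt small) ⟩
    + d * Q X (us ++ g N 1 ∷ ws) H + 0ℤ
      ≡⟨ ℤₚ.+-identityʳ _ ⟩
    + d * Q X (us ++ g N 1 ∷ ws) H ∎
    where
    open ≡-Reasoning
    lem : ∀ x y → x ≡ y + (x - y)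
    lem = solve-∀
    len′ : ∀ {w : Weight} → length (us ++ w ∷ ws) ≡ n
    len′ = trans (Listₚ.length-++ us) len
    small : length us ℕ.* suc k ℕ.+ (k ℕ.+ length ws ℕ.* suc k) <
            tri 0 (length (us ++ (λ a b → g N d a b - + d * g N 1 a b) ∷ ws) ℕ.+ length (us ++ (λ a b → g N d a b - + d * g N 1 a b) ∷ ws))
    small = subst (λ l → length us ℕ.* suc k ℕ.+ (k ℕ.+ length ws ℕ.* suc k) < tri 0 (l ℕ.+ l)) (sym len′)
      (ℕₚ.≤-reflexive (trans (lem′ (length us) (length ws) k)
        (trans (cong (ℕ._* suc k) len) (sym (tri₀-even n k k+2≡2n)))))
      where
      lem′ : ∀ u w k → 1 ℕ.+ (u ℕ.* (1 ℕ.+ k) ℕ.+ (k ℕ.+ w ℕ.* (1 ℕ.+ k))) ≡ (u ℕ.+ (1 ℕ.+ w)) ℕ.* (1 ℕ.+ k)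
      lem′ = ℕRing.solve-∀

  Q-g-++ : ∀ us ds → All (Deg (suc k)) us → length us ℕ.+ length ds ≡ n →
           Q X (us ++ map (g N) ds) H ≡ ∏ℕ ds * Q X (us ++ map (λ _ → g N 1) ds) H
  Q-g-++ us []       degus len = sym (ℤₚ.*-identityˡ _)
  Q-g-++ us (d ∷ ds) degus len = begin
    Q X (us ++ g N d ∷ map (g N) ds) H
      ≡⟨ Q-g-step us d (map (g N) ds) degus (Allₚ.map⁺ (All.universal (g-deg k) ds))
           (trans (cong (λ l → length us ℕ.+ suc l) (Listₚ.length-map (g N) ds)) len) ⟩
    + d * Q X (us ++ g N 1 ∷ map (g N) ds) H
      ≡⟨ cong (λ l → + d * Q X l H) (sym (Listₚ.++-assoc us (g N 1 ∷ []) _)) ⟩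
    + d * Q X ((us ++ g N 1 ∷ []) ++ map (g N) ds) H
      ≡⟨ cong (+ d *_) (Q-g-++ (us ++ g N 1 ∷ []) ds (Allₚ.++⁺ degus (g-deg k 1 ∷ [])) len″) ⟩
    + d * (∏ℕ ds * Q X ((us ++ g N 1 ∷ []) ++ map (λ _ → g N 1) ds) H)
      ≡⟨ ℤₚ.*-assoc (+ d) (∏ℕ ds) _ ⟨
    + d * ∏ℕ ds * Q X ((us ++ g N 1 ∷ []) ++ map (λ _ → g N 1) ds) H
      ≡⟨ cong (λ l → + d * ∏ℕ ds * Q X l H) (Listₚ.++-assoc us (g N 1 ∷ []) _) ⟩
    + d * ∏ℕ ds * Q X (us ++ g N 1 ∷ map (λ _ → g N 1) ds) H ∎
    where
    open ≡-Reasoning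
    len″ : length (us ++ g N 1 ∷ []) ℕ.+ length ds ≡ n
    len″ = trans (cong (ℕ._+ length ds) (Listₚ.length-++ us))
      (trans (ℕₚ.+-assoc (length us) 1 (length ds)) len)

  Q-g : ∀ ds → length ds ≡ n → Q X (map (g N) ds) H ≡ ∏ℕ ds * Q X (map (λ _ → g N 1) ds) H
  Q-g ds = Q-g-++ [] ds []

-- Sums over tuples of pairs, and dominoes on a path

seg : ℕ → List ℕ
seg = applyDownFrom suc

flat : List (ℕ × ℕ) → List ℕ
flat []            = []
flat ((a , b) ∷ A) = a ∷ b ∷ flat A

flat-++ : ∀ A B → flat (A ++ B) ≡ flat A ++ flat B
flat-++ []            B = refl
flat-++ ((a , b) ∷ A) B = cong (λ v → a ∷ b ∷ v) (flat-++ A B)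

record Symmetric {Y : Set} (H : List Y → ℤ) : Set where
  constructor symmetric
  field exchange : ∀ u x y v → H (u ++ x ∷ y ∷ v) ≡ H (u ++ y ∷ x ∷ v)
open Symmetric

sym-∷ : ∀ {Y : Set} {H : List Y → ℤ} → Symmetric H → ∀ x → Symmetric (H ∘ (x ∷_))
sym-∷ sH x .exchange u = exchange sH (x ∷ u)

flat-symmetric : ∀ {H} → Alternating H → Symmetric (H ∘ flat)
flat-symmetric {H} alt .exchange u x y v = subst₂ (λ w w′ → H w ≡ H w′)
  (sym (flat-++ u _)) (sym (flat-++ u _)) (alt-pair alt (flat u) _ _ _ _ (flat v))

-- The sum over all choices of one entry from each list. Starters take one edge from each difference
-- class; dominoes take every entry from the same path.
V : ∀ {Y : Set} → List (List Y) → (List Y → ℤ) → ℤ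
V []       H = H []
V (R ∷ Rs) H = ∑ R λ e → V Rs (H ∘ (e ∷_))

V-cong : ∀ {Y : Set} (Rs : List (List Y)) {H K : List Y → ℤ} → (∀ v → H v ≡ K v) → V Rs H ≡ V Rs K
V-cong []       eq = eq []
V-cong (R ∷ Rs) eq = ∑-cong R λ e → V-cong Rs λ v → eq (e ∷ v)

V-zero : ∀ {Y : Set} (Rs : List (List Y)) {H : List Y → ℤ} → (∀ v → H v ≡ 0ℤ) → V Rs H ≡ 0ℤ
V-zero []       eq = eq []
V-zero (R ∷ Rs) eq = ∑-zero R λ e → V-zero Rs λ v → eq (e ∷ v)

V-* : ∀ {Y : Set} (Rs : List (List Y)) c (H : List Y → ℤ) → V Rs (λ v → c * H v) ≡ c * V Rs H
V-* []       c H = refl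
V-* (R ∷ Rs) c H = trans (∑-cong R λ e → V-* Rs c _) (∑-* R c _)

V-replicate-cong-∈ : ∀ {Y : Set} (R : List Y) k {H K : List Y → ℤ} →
  (∀ {v} → All (_∈ R) v → H v ≡ K v) → V (replicate k R) H ≡ V (replicate k R) K
V-replicate-cong-∈ R zero    eq = eq []
V-replicate-cong-∈ R (suc k) eq = ∑-cong-∈ R λ e∈R → V-replicate-cong-∈ R k λ v⊆R → eq (e∈R ∷ v⊆R)

-- By symmetry `H` vanishes wherever x occurs, not only when x is in front.
V-drop : ∀ {Y : Set} (x : Y) R k {H : List Y → ℤ} → Symmetric H → (∀ v → H (x ∷ v) ≡ 0ℤ) →
         V (replicate k (x ∷ R)) H ≡ V (replicate k R) H
V-drop x R zero    sH zH = refl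
V-drop x R (suc k) sH zH = trans
  (cong₂ _+_ (V-zero (replicate k (x ∷ R)) zH)
    (∑-cong R λ e → V-drop x R k (sym-∷ sH e) λ v → trans (exchange sH [] e x v) (zH (e ∷ v))))
  (ℤₚ.+-identityˡ _)

-- In a nonzero term x occurs at most once. If it occurs, it sits in one of k + 1 slots, and all of
-- these contribute equally by symmetry.
V-∷ : ∀ {Y : Set} (x : Y) R k {H : List Y → ℤ} → Symmetric H → (∀ v → H (x ∷ x ∷ v) ≡ 0ℤ) →
      V (replicate (suc k) (x ∷ R)) H ≡
      V (replicate (suc k) R) H + + suc k * V (replicate k R) (H ∘ (x ∷_))
V-∷ x R zero {H} sH zH = lem (H (x ∷ [])) _
  where
  lem : ∀ a b → a + b ≡ b + 1ℤ * a
  lem = solve-∀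
V-∷ x R (suc k) {H} sH zH = begin
  V (replicate (suc k) (x ∷ R)) (H ∘ (x ∷_)) + ∑ R (λ e → V (replicate (suc k) (x ∷ R)) (H ∘ (e ∷_)))
    ≡⟨ cong₂ _+_ (V-drop x R (suc k) (sym-∷ sH x) zH) (∑-cong R λ e → V-∷ x R k (sym-∷ sH e) (zH′ e)) ⟩
  a + ∑ R (λ e → V (replicate (suc k) R) (H ∘ (e ∷_)) + + suc k * V (replicate k R) (λ v → H (e ∷ x ∷ v)))
    ≡⟨ cong (_+_ a) (trans (∑-+ R _ _) (cong (_+_ b) (∑-* R (+ suc k) _))) ⟩
  a + (b + + suc k * ∑ R (λ e → V (replicate k R) (λ v → H (e ∷ x ∷ v))))
    ≡⟨ cong (λ t → a + (b + + suc k * t)) (∑-cong R λ e → V-cong (replicate k R) λ v → exchange sH [] e x v) ⟩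
  a + (b + + suc k * a)
    ≡⟨ lem a b (+ suc k) ⟩
  b + + suc (suc k) * a ∎
  where
  open ≡-Reasoning
  a = V (replicate (suc k) R) (H ∘ (x ∷_))
  b = V (replicate (suc (suc k)) R) H
  zH′ : ∀ e v → H (e ∷ x ∷ x ∷ v) ≡ 0ℤ
  zH′ e v = trans (exchange sH [] e x (x ∷ v)) (trans (exchange sH (x ∷ []) e x v) (zH (e ∷ v)))
  lem : ∀ a b m → a + (b + m * a) ≡ b + (1ℤ + m) * a
  lem = solve-∀

path : ℕ → List (ℕ × ℕ)
path zero          = []
path (suc zero)    = []
path (suc (suc m)) = (suc m , suc (suc m)) ∷ path (suc m)

path-≤ : ∀ m {a b} → (a , b) ∈ path m → a ≤ m × b ≤ m
path-≤ (suc (suc m)) (here refl) = ℕₚ.n≤1+n _ , ℕₚ.≤-refl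
path-≤ (suc (suc m)) (there e) with path-≤ (suc m) e
... | a≤ , b≤ = ℕₚ.m≤n⇒m≤1+n a≤ , ℕₚ.m≤n⇒m≤1+n b≤

sgn-≡0 : ∀ v → ¬ Unique v → sgn v ≡ 0ℤ
sgn-≡0 v ¬u with sgn v ℤₚ.≟ 0ℤ
... | yes eq = eq
... | no ≢0  = contradiction (sgn-≢0⇒Unique v ≢0) ¬u

-- Both top entries exceed every entry of `w`, so each entry of `w` contributes -1 twice.
sgn-drop-top : ∀ m w → All (_≤ m) w → sgn (suc m ∷ suc (suc m) ∷ w) ≡ sgn w
sgn-drop-top m w w≤m = begin
  s (suc m) (suc (suc m)) * ∏ w (s (suc m)) * (∏ w (s (suc (suc m))) * sgn w)
    ≡⟨ cong₂ (λ x y → x * (y * sgn w))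
         (cong₂ _*_ (s-< {suc m} ℕₚ.≤-refl) (below (suc m) ℕₚ.≤-refl)) (below (suc (suc m)) (ℕₚ.n≤1+n _)) ⟩
  1ℤ * -1ℤ ^ length w * (-1ℤ ^ length w * sgn w)
    ≡⟨ lem (-1ℤ ^ length w) (sgn w) ⟩
  -1ℤ ^ length w * -1ℤ ^ length w * sgn w
    ≡⟨ cong (_* sgn w) (-1^ (length w)) ⟩
  1ℤ * sgn w
    ≡⟨ ℤₚ.*-identityˡ _ ⟩
  sgn w ∎
  where
  open ≡-Reasoning
  lem : ∀ x y → 1ℤ * x * (x * y) ≡ x * x * y
  lem = solve-∀
  below : ∀ x → m < x → ∏ w (s x) ≡ -1ℤ ^ length w
  below x m<x = trans
    (∏-cong-∈ w λ y∈w → s-> (ℕₚ.≤-<-trans (All.lookup w≤m y∈w) m<x)) (∏-const w -1ℤ)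

-- Tuples of disjoint edges all have sign 1, because no vertex lies strictly between two consecutive
-- ones; other tuples have sign 0. So this is k! times the number of matchings with k edges in the
-- path 1, ..., m.
dominoes : ℕ → ℕ → ℤ
dominoes m k = V (replicate k (path m)) (sgn ∘ flat)

dominoes-rec : ∀ m k → dominoes (suc (suc m)) (suc k) ≡ dominoes (suc m) (suc k) + + suc k * dominoes m k
dominoes-rec m k = trans
  (V-∷ top (path (suc m)) k (flat-symmetric sgn-alt) λ v → sgn-≡0 (flat (top ∷ top ∷ v)) λ where
    ((_ ∷ a≢a ∷ _) ∷ _) → a≢a refl)
  (cong (λ t → dominoes (suc m) (suc k) + + suc k * t) (trans (shorten m)
    (V-replicate-cong-∈ (path m) k λ {v} v⊆ → sgn-drop-top m (flat v) (bound v v⊆))))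
  where
  top = (suc m , suc (suc m))
  shorten : ∀ m → V (replicate k (path (suc m))) (λ v → sgn (suc m ∷ suc (suc m) ∷ flat v)) ≡
                  V (replicate k (path m)) (λ v → sgn (suc m ∷ suc (suc m) ∷ flat v))
  shorten zero    = refl
  shorten (suc m) = V-drop (suc m , suc (suc m)) (path (suc m)) k
    (sym-∷ (flat-symmetric sgn-alt) (suc (suc m) , suc (suc (suc m))))
    λ v → sgn-≡0 (suc (suc m) ∷ suc (suc (suc m)) ∷ suc m ∷ suc (suc m) ∷ flat v) λ where
      ((_ ∷ _ ∷ a≢a ∷ _) ∷ _) → a≢a refl
  bound : ∀ v → All (_∈ path m) v → All (_≤ m) (flat v)
  bound []            []         = []
  bound ((a , b) ∷ v) (e∈ ∷ v⊆) with path-≤ m e∈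
  ... | a≤ , b≤ = a≤ ∷ b≤ ∷ bound v v⊆

dominoes-short : ∀ m k → m < k ℕ.+ k → dominoes m k ≡ 0ℤ
dominoes-short zero          (suc k) _ = refl
dominoes-short (suc zero)    (suc k) _ = refl
dominoes-short (suc (suc m)) (suc k) m<2k = trans (dominoes-rec m k)
  (trans (cong₂ (λ x y → x + + suc k * y)
           (dominoes-short (suc m) (suc k) (ℕₚ.<-trans ℕₚ.≤-refl m<2k))
           (dominoes-short m k (ℕₚ.≤-pred (ℕₚ.≤-pred (subst (suc (suc (suc m)) ≤_) (cong suc (ℕₚ.+-suc k k)) m<2k)))))
         (trans (ℤₚ.+-identityˡ _) (ℤₚ.*-zeroʳ (+ suc k))))

-- Leaving out the top edge would force k disjoint edges into 2k - 1 vertices. So the top edge is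
-- always present, in any of the slots, and the recursion becomes that of the factorial.
dominoes-perfect : ∀ k → dominoes (k ℕ.+ k) k ≡ ∏ℕ (seg k)
dominoes-perfect zero    = refl
dominoes-perfect (suc k) rewrite ℕₚ.+-suc k k = trans (dominoes-rec (k ℕ.+ k) k)
  (trans (cong₂ (λ x y → x + + suc k * y)
           (dominoes-short (suc (k ℕ.+ k)) (suc k) (s≤s (subst (suc (k ℕ.+ k) ≤_) (sym (ℕₚ.+-suc k k)) ℕₚ.≤-refl)))
           (dominoes-perfect k))
         (ℤₚ.+-identityˡ _))

-- The weights [b − a = d] − [b − a = −d] and the edges of class d

AntiSym : Weight → Set
AntiSym K = ∀ a b → K a b ≡ - K b a

-- A product of two antisymmetric functions is symmetric and vanishes on the diagonal. This is the
-- source of the factor 2 for each pair, and so of 2ⁿ.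
∑∑-antisym : ∀ X {w K} → AntiSym w → AntiSym K →
  ∑ X (λ a → ∑ X λ b → w a b * K a b) ≡ + 2 * ∑ X (λ a → ∑ X λ b → 𝟙 (a ℕ.<? b) * (w a b * K a b))
∑∑-antisym X {w} {K} aw aK = begin
  ∑ X (λ a → ∑ X λ b → F a b)
    ≡⟨ ∑∑-cong X split ⟩
  ∑ X (λ a → ∑ X λ b → 𝟙 (a ℕ.<? b) * F a b + 𝟙 (b ℕ.<? a) * F b a)
    ≡⟨ ∑∑-+ X (λ a b → 𝟙 (a ℕ.<? b) * F a b) (λ a b → 𝟙 (b ℕ.<? a) * F b a) ⟩
  S + ∑ X (λ a → ∑ X λ b → 𝟙 (b ℕ.<? a) * F b a)
    ≡⟨ cong (_+_ S) (∑-swap X X (λ a b → 𝟙 (b ℕ.<? a) * F b a)) ⟩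
  S + S
    ≡⟨ lem S ⟩
  + 2 * S ∎
  where
  open ≡-Reasoning
  F : Weight
  F a b = w a b * K a b
  S = ∑ X (λ a → ∑ X λ b → 𝟙 (a ℕ.<? b) * F a b)
  lem : ∀ x → x + x ≡ (1ℤ + 1ℤ) * x
  lem = solve-∀
  lem₁ : ∀ x y → x ≡ 1ℤ * x + 0ℤ * y
  lem₁ = solve-∀
  lem₂ : ∀ x y → - x * - y ≡ 0ℤ * (- x * - y) + 1ℤ * (x * y)
  lem₂ = solve-∀
  split : ∀ a b → F a b ≡ 𝟙 (a ℕ.<? b) * F a b + 𝟙 (b ℕ.<? a) * F b a
  split a b with ℕₚ.<-cmp a b
  ... | tri< a<b _ b≮a = trans (lem₁ (F a b) (F b a))
    (sym (cong₂ (λ x y → x * F a b + y * F b a) (𝟙-true (a ℕ.<? b) a<b) (𝟙-false (b ℕ.<? a) b≮a)))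
  ... | tri> a≮b _ b<a = trans
    (trans (cong₂ _*_ (aw a b) (aK a b)) (trans (lem₂ (w b a) (K b a)) (cong (λ t → 0ℤ * t + 1ℤ * F b a) (sym (cong₂ _*_ (aw a b) (aK a b))))))
    (sym (cong₂ (λ x y → x * F a b + y * F b a) (𝟙-false (a ℕ.<? b) a≮b) (𝟙-true (b ℕ.<? a) b<a)))
  ... | tri≈ a≮a refl _ = trans F≡0 (sym (cong₂ _+_ zero′ zero′))
    where
    F≡0 : F a a ≡ 0ℤ
    F≡0 = trans (cong (w a a *_) (x≡-x⇒x≡0 (aK a a))) (ℤₚ.*-zeroʳ (w a a))
    zero′ : 𝟙 (a ℕ.<? a) * F a a ≡ 0ℤ
    zero′ = trans (cong (𝟙 (a ℕ.<? a) *_) F≡0) (ℤₚ.*-zeroʳ (𝟙 (a ℕ.<? a)))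

-- Against antisymmetric `K` the weight `w` acts like twice the list `R` with signs `c`. Testing
-- against such `K` suffices, since what stands next to a weight in `Q` alternates in the two ends
-- of the pair.
record Represents (X : List ℕ) (c : ℕ × ℕ → ℤ) (w : Weight) (R : List (ℕ × ℕ)) : Set where
  constructor represents
  field expand : ∀ {K} → AntiSym K →
                 ∑ X (λ a → ∑ X λ b → w a b * K a b) ≡ + 2 * ∑ R (λ e → c e * K (proj₁ e) (proj₂ e))
open Represents

Q-neg : ∀ X ws H → Q X ws (λ v → - H v) ≡ - Q X ws H
Q-neg X []       H = refl
Q-neg X (w ∷ ws) H = trans
  (∑∑-cong X λ a b → trans (cong (w a b *_) (Q-neg X ws λ v → H (a ∷ b ∷ v))) (sym (ℤₚ.neg-distribʳ-* (w a b) _)))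
  (trans (∑-cong X λ a → ∑-neg X _) (∑-neg X _))

-- Serves twice: with the difference classes and the signs `flip` it yields the starters, with the
-- path and constant sign 1 it yields the dominoes.
Q-represents : ∀ X c {Y : Set} (w : Y → Weight) R ds {H} → (∀ {d} → d ∈ ds → Represents X c (w d) (R d)) →
  Alternating H → Q X (map w ds) H ≡ (+ 2) ^ length ds * V (map R ds) (λ A → ∏ A c * H (flat A))
Q-represents X c w R []       rep alt = sym (trans (ℤₚ.*-identityˡ _) (ℤₚ.*-identityˡ _))
Q-represents X c w R (d ∷ ds) {H} rep alt = begin
  ∑ X (λ a → ∑ X λ b → w d a b * Q X (map w ds) (λ v → H (a ∷ b ∷ v)))
    ≡⟨ expand (rep (here refl)) (λ a b → trans
         (Q-cong X (map w ds) λ v → Alternating.transpose alt [] a b v) (Q-neg X (map w ds) _)) ⟩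
  + 2 * ∑ (R d) (λ e → c e * Q X (map w ds) (λ v → H (proj₁ e ∷ proj₂ e ∷ v)))
    ≡⟨ cong (+ 2 *_) (∑-cong (R d) term) ⟩
  + 2 * ∑ (R d) (λ e → (+ 2) ^ length ds * V (map R ds) (λ A → ∏ (e ∷ A) c * H (flat (e ∷ A))))
    ≡⟨ cong (+ 2 *_) (∑-* (R d) ((+ 2) ^ length ds) _) ⟩
  + 2 * ((+ 2) ^ length ds * V (map R (d ∷ ds)) (λ A → ∏ A c * H (flat A)))
    ≡⟨ ℤₚ.*-assoc (+ 2) ((+ 2) ^ length ds) _ ⟨
  (+ 2) ^ length (d ∷ ds) * V (map R (d ∷ ds)) (λ A → ∏ A c * H (flat A)) ∎
  where
  open ≡-Reasoning
  term : ∀ e → c e * Q X (map w ds) (λ v → H (proj₁ e ∷ proj₂ e ∷ v)) ≡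
               (+ 2) ^ length ds * V (map R ds) (λ A → ∏ (e ∷ A) c * H (flat (e ∷ A)))
  term e = trans
    (cong (c e *_) (Q-represents X c w R ds (λ d∈ → rep (there d∈)) (alt-++ alt (proj₁ e ∷ proj₂ e ∷ []))))
    (trans (*-assoc-comm (c e) ((+ 2) ^ length ds) _)
      (cong ((+ 2) ^ length ds *_) (trans (sym (V-* (map R ds) (c e) _))
        (V-cong (map R ds) λ A → sym (ℤₚ.*-assoc (c e) (∏ A c) _)))))

-- Residues

mod-refl : ∀ {p} x → x ≡ x [mod p ]
mod-refl x = cong⁻ (≡⇒≈ {x = x} refl)

+-∸ : ∀ {a b} → a ≤ b → + b - + a ≡ + (b ∸ a)
+-∸ {a} {b} a≤b = trans (ℤₚ.m-n≡m⊖n b a) (ℤₚ.⊖-≥ a≤b)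

∣-<⇒≡0 : ∀ {p k} → k < p → + p ℤ∣.∣ + k → k ≡ 0
∣-<⇒≡0 {k = zero}  _   _   = refl
∣-<⇒≡0 {k = suc k} k<p p∣k = contradiction (ℤ∣.∣⇒∣ᵤ p∣k) (ℕ∣.>⇒∤ k<p)

mod-injective : ∀ {p a b} → a < p → b < p → + a ≡ + b [mod p ] → a ≡ b
mod-injective {p} {a} {b} a<p b<p a≡b with ℕₚ.≤-total a b
... | inj₁ a≤b = ℕₚ.≤-antisym a≤b (ℕₚ.m∸n≡0⇒m≤n (∣-<⇒≡0 (ℕₚ.≤-<-trans (ℕₚ.m∸n≤m b a) b<p)
      (subst (+ p ℤ∣.∣_) (+-∸ a≤b) (cong⁻ (mod-sym {x = + a} {+ b} (cong⁺ a≡b))))))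
... | inj₂ b≤a = ℕₚ.≤-antisym (ℕₚ.m∸n≡0⇒m≤n (∣-<⇒≡0 (ℕₚ.≤-<-trans (ℕₚ.m∸n≤m a b) a<p)
      (subst (+ p ℤ∣.∣_) (+-∸ b≤a) a≡b))) b≤a

mod-opposite : ∀ {p a b} → 0 < b → a < p → b ≤ p → + a ≡ - + b [mod p ] → a ≡ p ∸ b
mod-opposite {p} {a} {b} b>0 a<p b≤p a≡-b =
  mod-injective a<p (ℕₚ.∸-monoʳ-< b>0 b≤p) (cong⁻ (mod-trans {x = + a} { - + b} {+ (p ∸ b)} (cong⁺ a≡-b) (cong⁺ (ℤ∣.divides -1ℤ
    (trans (cong (λ t → - + b - t) (sym (+-∸ b≤p))) (lem (+ b) (+ p)))))))
  where
  lem : ∀ b p → - b - (p - b) ≡ -1ℤ * p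
  lem = solve-∀

≡⇒mod-opposite : ∀ {p a b} → b ≤ p → a ≡ p ∸ b → + a ≡ - + b [mod p ]
≡⇒mod-opposite {p} {a} {b} b≤p refl = ℤ∣.divides 1ℤ (trans (cong (λ t → t - - + b) (sym (+-∸ b≤p))) (lem (+ b) (+ p)))
  where
  lem : ∀ b p → (p - b) - - b ≡ 1ℤ * p
  lem = solve-∀

mod-swap : ∀ {n} a b {d} → + b - + a ≡ d [mod n ] → + a - + b ≡ - d [mod n ]
mod-swap a b {d} e = cong⁻ (mod-trans (≡⇒≈ (lem (+ a) (+ b))) (mod-neg (cong⁺ e)))
  where
  lem : ∀ a b → a - b ≡ - (b - a)
  lem = solve-∀

f : ℕ → ℕ → Weight
f p d a b = 𝟙 (+ b - + a ≡? + d [mod p ]) - 𝟙 (+ b - + a ≡? - + d [mod p ])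

f-antisym : ∀ p d → AntiSym (f p d)
f-antisym p d a b = trans
  (cong₂ _-_
    (𝟙-cong (+ b - + a ≡? + d [mod p ]) (+ a - + b ≡? - + d [mod p ]) (mod-swap a b)
      (λ e → subst (λ t → + b - + a ≡ t [mod p ]) (ℤₚ.neg-involutive (+ d)) (mod-swap b a e)))
    (𝟙-cong (+ b - + a ≡? - + d [mod p ]) (+ a - + b ≡? + d [mod p ])
      (λ e → subst (λ t → + a - + b ≡ t [mod p ]) (ℤₚ.neg-involutive (+ d)) (mod-swap a b e)) (mod-swap b a)))
  (lem (𝟙 (+ a - + b ≡? - + d [mod p ])) (𝟙 (+ a - + b ≡? + d [mod p ])))
  where
  lem : ∀ x y → x - y ≡ - (y - x)
  lem = solve-∀

∈-seg⁻ : ∀ {m a} → a ∈ seg m → 0 < a × a ≤ m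
∈-seg⁻ a∈ with ∈-applyDownFrom⁻ suc a∈
... | _ , i<m , refl = s≤s z≤n , i<m

∈-seg⁺ : ∀ {m a} → 0 < a → a ≤ m → a ∈ seg m
∈-seg⁺ {a = suc a} _ a≤m = ∈-applyDownFrom⁺ suc a≤m

length-seg : ∀ m → length (seg m) ≡ m
length-seg = Listₚ.length-applyDownFrom suc

module _ (n : ℕ) where

  private
    p = suc (n ℕ.+ n)

  n≤p : n ≤ p
  n≤p = ℕₚ.m≤n⇒m≤1+n (ℕₚ.m≤m+n n n)

  -- δ ≡ (−1)^(flp δ) · cls δ modulo p.
  cls flp : ℕ → ℕ
  cls δ with δ ℕ.≤? n
  ... | yes _ = δ
  ... | no  _ = p ∸ δ
  flp δ with δ ℕ.≤? n
  ... | yes _ = 0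
  ... | no  _ = 1

  cl : ℕ × ℕ → ℕ
  cl (a , b) = cls (b ∸ a)

  flip : ℕ × ℕ → ℤ
  flip (a , b) = -1ℤ ^ flp (b ∸ a)

  p∸δ≤n : ∀ {δ} → ¬ δ ≤ n → p ∸ δ ≤ n
  p∸δ≤n {δ} δ≰n = ℕₚ.≤-trans (ℕₚ.∸-monoʳ-≤ p (ℕₚ.≰⇒> δ≰n)) (ℕₚ.≤-reflexive (ℕₚ.m+n∸m≡n n n))

  p∸d≰n : ∀ {d} → d ≤ n → ¬ p ∸ d ≤ n
  p∸d≰n {d} d≤n p∸d≤n = ℕₚ.<⇒≱ (ℕₚ.n<1+n (n ℕ.+ n))
    (subst (_≤ n ℕ.+ n) (ℕₚ.m∸n+n≡m (ℕₚ.≤-trans d≤n n≤p)) (ℕₚ.+-mono-≤ p∸d≤n d≤n))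

  cls-range : ∀ {δ} → 0 < δ → δ < p → 0 < cls δ × cls δ ≤ n
  cls-range {δ} δ>0 δ<p with δ ℕ.≤? n
  ... | yes δ≤n = δ>0 , δ≤n
  ... | no  δ≰n = ℕₚ.m<n⇒0<n∸m δ<p , p∸δ≤n δ≰n

  cls-sound : ∀ {δ} → δ < p → + cls δ ≡ + δ [mod p ] ⊎ + cls δ ≡ - + δ [mod p ]
  cls-sound {δ} δ<p with δ ℕ.≤? n
  ... | yes _ = inj₁ (mod-refl (+ δ))
  ... | no  _ = inj₂ (≡⇒mod-opposite (ℕₚ.<⇒≤ δ<p) refl)

  cls-complete : ∀ {δ d} → 0 < δ → δ < p → 0 < d → d ≤ n →
                 + d ≡ + δ [mod p ] ⊎ + d ≡ - + δ [mod p ] → cls δ ≡ d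
  cls-complete {δ} δ>0 δ<p d>0 d≤n (inj₁ e) with mod-injective (ℕₚ.≤-<-trans d≤n (s≤s (ℕₚ.m≤m+n n n))) δ<p e
  ... | refl with δ ℕ.≤? n
  ...   | yes _ = refl
  ...   | no δ≰n = contradiction d≤n δ≰n
  cls-complete {δ} δ>0 δ<p d>0 d≤n (inj₂ e) with mod-opposite δ>0 (ℕₚ.≤-<-trans d≤n (s≤s (ℕₚ.m≤m+n n n))) (ℕₚ.<⇒≤ δ<p) e
  ... | refl with δ ℕ.≤? n
  ...   | yes δ≤n = contradiction d≤n (p∸d≰n δ≤n)
  ...   | no  _   = refl

  -- As 0 < d ≤ n, the residue -d is p - d > n. So for δ ≤ n only δ = d can count, with sign 1, and
  -- for δ > n only δ = p - d, with sign -1.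
  f-cls : ∀ {δ d} → 0 < δ → δ < p → 0 < d → d ≤ n →
          𝟙 (+ δ ≡? + d [mod p ]) - 𝟙 (+ δ ≡? - + d [mod p ]) ≡ 𝟙 (cls δ ℕ.≟ d) * -1ℤ ^ flp δ
  f-cls {δ} {d} δ>0 δ<p d>0 d≤n with δ ℕ.≤? n
  ... | yes δ≤n = trans (cong₂ _-_
      (𝟙-cong (+ δ ≡? + d [mod p ]) (δ ℕ.≟ d) (mod-injective δ<p d<p) (λ { refl → mod-refl (+ δ) }))
      (𝟙-false (+ δ ≡? - + d [mod p ]) λ e → p∸d≰n d≤n (subst (_≤ n) (mod-opposite d>0 δ<p (ℕₚ.<⇒≤ d<p) e) δ≤n)))
    (lem (𝟙 (δ ℕ.≟ d)))
    where
    d<p = ℕₚ.≤-<-trans d≤n (s≤s (ℕₚ.m≤m+n n n))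
    lem : ∀ x → x - 0ℤ ≡ x * 1ℤ
    lem = solve-∀
  ... | no δ≰n = trans (cong₂ _-_
      (𝟙-false (+ δ ≡? + d [mod p ]) λ e → δ≰n (subst (_≤ n) (sym (mod-injective δ<p d<p e)) d≤n))
      (𝟙-cong (+ δ ≡? - + d [mod p ]) (p ∸ δ ℕ.≟ d)
        (λ e → trans (cong (p ∸_) (mod-opposite d>0 δ<p (ℕₚ.<⇒≤ d<p) e)) (ℕₚ.m∸[m∸n]≡n (ℕₚ.<⇒≤ d<p)))
        (λ { refl → ≡⇒mod-opposite (ℕₚ.m∸n≤m p δ) (sym (ℕₚ.m∸[m∸n]≡n (ℕₚ.<⇒≤ δ<p))) })))
    (lem (𝟙 (p ∸ δ ℕ.≟ d)))
    where
    d<p = ℕₚ.≤-<-trans d≤n (s≤s (ℕₚ.m≤m+n n n))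
    lem : ∀ x → 0ℤ - x ≡ x * (-1ℤ * 1ℤ)
    lem = solve-∀

  f-cl : ∀ {a b d} → a ∈ seg (n ℕ.+ n) → b ∈ seg (n ℕ.+ n) → a < b → 0 < d → d ≤ n →
         f p d a b ≡ 𝟙 (cl (a , b) ℕ.≟ d) * flip (a , b)
  f-cl {a} {b} a∈ b∈ a<b d>0 d≤n rewrite +-∸ (ℕₚ.<⇒≤ a<b) =
    f-cls (ℕₚ.m<n⇒0<n∸m a<b) (ℕₚ.≤-<-trans (ℕₚ.m∸n≤m b a) (s≤s (proj₂ (∈-seg⁻ b∈)))) d>0 d≤n

  -- The hypothesis on `L` says that `L` enumerates the pairs a < b in {1, ..., 2n}. It is phrased
  -- through sums, so that the order in which the edges are listed does not matter.
  represents-class : ∀ L → (∀ h → ∑ L h ≡ ∑ (seg (n ℕ.+ n)) (λ a → ∑ (seg (n ℕ.+ n)) λ b → 𝟙 (a ℕ.<? b) * h (a , b))) →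
    ∀ {d} → 0 < d → d ≤ n →
    Represents (seg (n ℕ.+ n)) flip (f p d) (filter (λ e → cl e ℕ.≟ d) L)
  represents-class L ∑L {d} d>0 d≤n .expand {K} aK = trans (∑∑-antisym (seg (n ℕ.+ n)) (f-antisym p d) aK)
    (cong (+ 2 *_) (sym (trans (∑-filter (λ e → cl e ℕ.≟ d) L _) (trans (∑L _)
      (∑-cong-∈ (seg (n ℕ.+ n)) λ {a} a∈ → ∑-cong-∈ (seg (n ℕ.+ n)) λ {b} b∈ → term a∈ b∈)))))
    where
    term : ∀ {a b} → a ∈ seg (n ℕ.+ n) → b ∈ seg (n ℕ.+ n) →
      𝟙 (a ℕ.<? b) * (𝟙 (cl (a , b) ℕ.≟ d) * (flip (a , b) * K a b)) ≡ 𝟙 (a ℕ.<? b) * (f p d a b * K a b)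
    term {a} {b} a∈ b∈ with a ℕ.<? b
    ... | no  _   = refl
    ... | yes a<b = cong (1ℤ *_) (trans (sym (ℤₚ.*-assoc (𝟙 (cl (a , b) ℕ.≟ d)) _ _))
                      (cong (_* K a b) (sym (f-cl a∈ b∈ a<b d>0 d≤n))))

∑-path : ∀ m (K : Weight) → ∑ (seg m) (λ a → ∑ (seg m) λ b → 𝟙 (b ℕ.≟ suc a) * K a b) ≡ ∑ (path m) (λ e → K (proj₁ e) (proj₂ e))
∑-path zero          K = refl
∑-path (suc zero)    K = refl
∑-path (suc (suc m)) K = begin
  F top top + ∑ (seg (suc m)) (F top) + ∑ (seg (suc m)) (λ a → F a top + ∑ (seg (suc m)) (F a))
    ≡⟨ cong₂ _+_ (cong₂ _+_ (zero′ top top (ℕₚ.n≮n _ ∘ ℕₚ.≤-reflexive ∘ sym)) (∑-zero-∈ (seg (suc m)) (F top) λ {b} b∈ →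
         zero′ top b λ { refl → ℕₚ.1+n≰n (ℕₚ.≤-trans (ℕₚ.n≤1+n _) (proj₂ (∈-seg⁻ b∈))) }))
       (trans (∑-+ (seg (suc m)) (λ a → F a top) (λ a → ∑ (seg (suc m)) (F a))) (cong₂ _+_ column (∑-path (suc m) K))) ⟩
  0ℤ + (K (suc m) top + ∑ (path (suc m)) (λ e → K (proj₁ e) (proj₂ e)))
    ≡⟨ ℤₚ.+-identityˡ _ ⟩
  ∑ (path (suc (suc m))) (λ e → K (proj₁ e) (proj₂ e)) ∎
  where
  open ≡-Reasoning
  top = suc (suc m)
  F : Weight
  F a b = 𝟙 (b ℕ.≟ suc a) * K a b
  zero′ : ∀ a b → b ≢ suc a → F a b ≡ 0ℤ
  zero′ a b ne = cong (_* K a b) (𝟙-false (b ℕ.≟ suc a) ne)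
  ∑-zero-∈ : ∀ {X : Set} (xs : List X) h → (∀ {x} → x ∈ xs → h x ≡ 0ℤ) → ∑ xs h ≡ 0ℤ
  ∑-zero-∈ xs h eq = trans (∑-cong-∈ xs {h} {λ _ → 0ℤ} eq) (∑-zero xs λ _ → refl)
  column : ∑ (seg (suc m)) (λ a → F a top) ≡ K (suc m) top
  column = trans (cong₂ _+_
    (trans (cong (_* K (suc m) top) (𝟙-true (top ℕ.≟ top) refl)) (ℤₚ.*-identityˡ _))
    (∑-zero-∈ (seg m) (λ a → F a top) λ {a} a∈ → zero′ a top λ { refl → ℕₚ.1+n≰n (proj₂ (∈-seg⁻ a∈)) }))
    (ℤₚ.+-identityʳ _)

-- Between elements of {1, ..., 2n} the difference b - a stays below 2n ≡ -1. The absence of 0 thus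
-- cuts the cycle of neighbours in 𝔽_p open into a path.
represents-path : ∀ n → 0 < n → Represents (seg (n ℕ.+ n)) (λ _ → 1ℤ) (f (suc (n ℕ.+ n)) 1) (path (n ℕ.+ n))
represents-path n n>0 .expand {K} aK = trans (∑∑-antisym (seg m) (f-antisym p 1) aK)
  (cong (+ 2 *_) (trans
    (∑-cong-∈ (seg m) λ a∈ → ∑-cong-∈ (seg m) λ b∈ → term a∈ b∈)
    (trans (∑-path m K) (∑-cong (path m) λ e → sym (ℤₚ.*-identityˡ _)))))
  where
  m = n ℕ.+ n
  p = suc m
  1<p : 1 < p
  1<p = s≤s (ℕₚ.≤-trans n>0 (ℕₚ.m≤m+n n n))
  term : ∀ {a b} → a ∈ seg m → b ∈ seg m →
         𝟙 (a ℕ.<? b) * (f p 1 a b * K a b) ≡ 𝟙 (b ℕ.≟ suc a) * K a b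
  term {a} {b} a∈ b∈ with a ℕ.<? b
  ... | no  a≮b = sym (cong (_* K a b) (𝟙-false (b ℕ.≟ suc a) λ { refl → a≮b ℕₚ.≤-refl }))
  ... | yes a<b rewrite +-∸ (ℕₚ.<⇒≤ a<b) = trans (ℤₚ.*-identityˡ _) (cong (_* K a b) (trans (cong₂ _-_
      (𝟙-cong (+ (b ∸ a) ≡? + 1 [mod p ]) (b ℕ.≟ suc a)
        (λ e → trans (sym (ℕₚ.m∸n+n≡m (ℕₚ.<⇒≤ a<b))) (cong (ℕ._+ a) (mod-injective δ<p 1<p e)))
        (λ { refl → subst (λ t → + t ≡ + 1 [mod p ]) (sym (ℕₚ.m+n∸n≡m 1 a)) (mod-refl (+ 1)) }))
      (𝟙-false (+ (b ∸ a) ≡? -1ℤ [mod p ]) λ e → ℕₚ.<-irrefl (mod-opposite (s≤s z≤n) δ<p (ℕₚ.<⇒≤ 1<p) e)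
        (ℕₚ.<-≤-trans (ℕₚ.∸-monoʳ-< (proj₁ (∈-seg⁻ a∈)) (ℕₚ.<⇒≤ a<b)) (proj₂ (∈-seg⁻ b∈)))))
      (ℤₚ.+-identityʳ (𝟙 (b ℕ.≟ suc a)))))
    where
    δ<p : b ∸ a < p
    δ<p = ℕₚ.≤-<-trans (ℕₚ.m∸n≤m b a) (s≤s (proj₂ (∈-seg⁻ b∈)))

-- Sums over sublists

_↭?_ : (xs ys : List ℕ) → Dec (xs ↭ ys)
[]       ↭? []       = yes refl
[]       ↭? (y ∷ ys) = no (↭ₚ.¬x∷xs↭[] ∘ ↭-sym)
(x ∷ xs) ↭? ys with mem? ℕ._≟_ x ys
... | no  x∉ys = no λ r → x∉ys (↭ₚ.∈-resp-↭ r (here refl))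
... | yes x∈ys with ∈-∃++ x∈ys
...   | us , vs , refl = map′ (λ r → ↭-trans (prep x r) (↭-sym (↭ₚ.shift x us vs)))
                              (λ r → ↭ₚ.drop-∷ (↭-trans r (↭ₚ.shift x us vs))) (xs ↭? (us ++ vs))

module _ {Y : Set} where

  S : List Y → (List Y → ℤ) → ℤ
  S []       g = g []
  S (x ∷ xs) g = S xs (g ∘ (x ∷_)) + S xs g

  ∑-sublists : ∀ xs g → ∑ (sublists xs) g ≡ S xs g
  ∑-sublists []       g = ℤₚ.+-identityʳ (g [])
  ∑-sublists (x ∷ xs) g = trans (∑-++ (map (x ∷_) (sublists xs)) _ g)
    (cong₂ _+_ (trans (∑-map (x ∷_) (sublists xs) g) (∑-sublists xs _)) (∑-sublists xs g))

  S-cong-∈ : ∀ xs {g h} → (∀ {A} → All (_∈ xs) A → g A ≡ h A) → S xs g ≡ S xs h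
  S-cong-∈ []       eq = eq []
  S-cong-∈ (x ∷ xs) eq = cong₂ _+_ (S-cong-∈ xs λ A⊆ → eq (here refl ∷ All.map there A⊆))
                                   (S-cong-∈ xs λ A⊆ → eq (All.map there A⊆))

  S-cong : ∀ xs {g h} → (∀ A → g A ≡ h A) → S xs g ≡ S xs h
  S-cong xs eq = S-cong-∈ xs λ {A} _ → eq A

  S-* : ∀ xs c g → S xs (λ A → c * g A) ≡ c * S xs g
  S-* []       c g = refl
  S-* (x ∷ xs) c g = trans (cong₂ _+_ (S-* xs c _) (S-* xs c g)) (sym (ℤₚ.*-distribˡ-+ c _ _))

  S-zero : ∀ xs {g} → (∀ A → g A ≡ 0ℤ) → S xs g ≡ 0ℤ
  S-zero []       eq = eq []
  S-zero (x ∷ xs) eq = cong₂ _+_ (S-zero xs (eq ∘ (x ∷_))) (S-zero xs eq)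

  S-[] : ∀ xs {g} → (∀ x A → g (x ∷ A) ≡ 0ℤ) → S xs g ≡ g []
  S-[] []       eq = refl
  S-[] (x ∷ xs) eq = trans (cong₂ _+_ (S-zero xs (eq x)) (S-[] xs eq)) (ℤₚ.+-identityˡ _)

  module _ (key : Y → ℕ) where

    class : List Y → ℕ → List Y
    class E d = filter (λ x → key x ℕ.≟ d) E

    -- The hypotheses leave only sublists with exactly one entry of key d, and symmetry brings it to
    -- the front. The inner sum may run over all of `E` again, because `twice` kills every sublist
    -- with a further entry of that key.
    S-class : ∀ d E {g} → Symmetric g → (∀ A → d ∉ map key A → g A ≡ 0ℤ) →
      (∀ x y A → key x ≡ d → key y ≡ d → g (x ∷ y ∷ A) ≡ 0ℤ) →
      S E g ≡ ∑ (class E d) λ x → S E (g ∘ (x ∷_))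
    S-class d []      sg none twice = none [] λ ()
    S-class d (x ∷ E) {g} sg none twice with key x ℕ.≟ d
    ... | yes kx = begin
      S E (g ∘ (x ∷_)) + S E g
        ≡⟨ cong (_+_ (S E (g ∘ (x ∷_)))) (S-class d E sg none twice) ⟩
      S E (g ∘ (x ∷_)) + ∑ (class E d) (λ y → S E (g ∘ (y ∷_)))
        ≡⟨ cong₂ _+_ (skip x kx) (∑-cong-∈ (class E d) λ {y} y∈ → skip y (proj₂ (∈-filter⁻ (λ x → key x ℕ.≟ d) {xs = E} y∈))) ⟩
      S (x ∷ E) (g ∘ (x ∷_)) + ∑ (class E d) (λ y → S (x ∷ E) (g ∘ (y ∷_)))
        ≡⟨ cong (λ l → ∑ l λ y → S (x ∷ E) (g ∘ (y ∷_))) (Listₚ.filter-accept (λ x → key x ℕ.≟ d) kx) ⟨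
      ∑ (class (x ∷ E) d) (λ y → S (x ∷ E) (g ∘ (y ∷_))) ∎
      where
      open ≡-Reasoning
      skip : ∀ y → key y ≡ d → S E (g ∘ (y ∷_)) ≡ S (x ∷ E) (g ∘ (y ∷_))
      skip y ky = sym (trans (cong (_+ S E (g ∘ (y ∷_))) (S-zero E λ A → twice y x A ky kx)) (ℤₚ.+-identityˡ _))
    ... | no kx = begin
      S E (g ∘ (x ∷_)) + S E g
        ≡⟨ cong₂ _+_ (S-class d E (sym-∷ sg x)
             (λ A d∉ → none (x ∷ A) λ { (here refl) → kx refl ; (there d∈) → d∉ d∈ })
             (λ y z A ky kz → trans (exchange sg [] x y (z ∷ A))
               (trans (exchange sg (y ∷ []) x z A) (twice y z (x ∷ A) ky kz))))
             (S-class d E sg none twice) ⟩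
      ∑ (class E d) (λ y → S E (λ A → g (x ∷ y ∷ A))) + ∑ (class E d) (λ y → S E (g ∘ (y ∷_)))
        ≡⟨ ∑-+ (class E d) _ _ ⟨
      ∑ (class E d) (λ y → S E (λ A → g (x ∷ y ∷ A)) + S E (g ∘ (y ∷_)))
        ≡⟨ (∑-cong (class E d) λ y → cong (_+ S E (g ∘ (y ∷_))) (S-cong E λ A → exchange sg [] x y A)) ⟩
      ∑ (class E d) (λ y → S (x ∷ E) (g ∘ (y ∷_)))
        ≡⟨ cong (λ l → ∑ l λ y → S (x ∷ E) (g ∘ (y ∷_))) (Listₚ.filter-reject (λ x → key x ℕ.≟ d) kx) ⟨
      ∑ (class (x ∷ E) d) (λ y → S (x ∷ E) (g ∘ (y ∷_))) ∎
      where open ≡-Reasoning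

    -- As the keys in `ds` are distinct, a sublist with these keys has exactly one entry for each of
    -- them, and so corresponds to a single choice in `V`. The classes are split off one by one.
    S-transversals : ∀ ds E {G} → Unique ds → Symmetric G →
      S E (λ A → 𝟙 (map key A ↭? ds) * G A) ≡ V (map (class E) ds) G
    S-transversals [] E {G} _ sG = trans
      (S-[] E λ x A → cong (_* G (x ∷ A)) (𝟙-false (map key (x ∷ A) ↭? []) ↭ₚ.¬x∷xs↭[]))
      (ℤₚ.*-identityˡ (G []))
    S-transversals (d ∷ ds) E {G} (d∉ds ∷ uds) sG = trans
      (S-class d E sg
        (λ A d∉ → cong (_* G A) (𝟙-false (map key A ↭? (d ∷ ds)) λ r → d∉ (↭ₚ.∈-resp-↭ (↭-sym r) (here refl))))
        (λ { x y A refl ky → cong (_* G (x ∷ y ∷ A)) (𝟙-false (map key (x ∷ y ∷ A) ↭? (d ∷ ds)) λ r →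
          All.lookup d∉ds (↭ₚ.∈-resp-↭ (↭ₚ.drop-∷ r) (here (sym ky))) refl) }))
      (∑-cong-∈ (class E d) λ {x} x∈ → trans (S-cong E (remove (proj₂ (∈-filter⁻ (λ x → key x ℕ.≟ d) {xs = E} x∈))))
        (S-transversals ds E uds (sym-∷ sG x)))
      where
      sg : Symmetric (λ A → 𝟙 (map key A ↭? (d ∷ ds)) * G A)
      sg .exchange u x y v = cong₂ _*_ (𝟙-cong (map key (u ++ x ∷ y ∷ v) ↭? (d ∷ ds)) (map key (u ++ y ∷ x ∷ v) ↭? (d ∷ ds))
          (↭-trans (↭ₚ.map⁺ key (↭ₚ.++⁺ˡ u (swap y x refl)))) (↭-trans (↭ₚ.map⁺ key (↭ₚ.++⁺ˡ u (swap x y refl)))))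
        (exchange sG u x y v)
      remove : ∀ {x} → key x ≡ d → ∀ A → 𝟙 (map key (x ∷ A) ↭? (d ∷ ds)) * G (x ∷ A) ≡ 𝟙 (map key A ↭? ds) * G (x ∷ A)
      remove {x} refl A = cong (_* G (x ∷ A)) (𝟙-cong (map key (x ∷ A) ↭? (d ∷ ds)) (map key A ↭? ds) ↭ₚ.drop-∷ (prep d))

S-map : ∀ {Y Z : Set} (h : Y → Z) xs g → S (map h xs) g ≡ S xs (g ∘ map h)
S-map h []       g = refl
S-map h (x ∷ xs) g = cong₂ _+_ (S-map h xs _) (S-map h xs g)

-- Signs of matchings

unique-⊆-length : ∀ {X : Set} {xs ys : List X} → Unique xs → xs ⊆ ys → length xs ≤ length ys
unique-⊆-length [] _ = z≤n
unique-⊆-length {xs = x ∷ xs} (x∉xs ∷ u) xs⊆ys with ∈-∃++ (xs⊆ys (here refl))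
... | us , vs , refl = subst (suc (length xs) ≤_) (sym (↭ₚ.↭-length (↭ₚ.shift x us vs)))
  (s≤s (unique-⊆-length u λ z∈ → sub z∈))
  where
  sub : xs ⊆ us ++ vs
  sub z∈ with ↭ₚ.∈-resp-↭ (↭ₚ.shift x us vs) (xs⊆ys (there z∈))
  ... | here refl = contradiction refl (All.lookup x∉xs z∈)
  ... | there z∈′ = z∈′

unique-⊆-↭ : ∀ {X : Set} {xs ys : List X} → Unique xs → xs ⊆ ys → length ys ≤ length xs → xs ↭ ys
unique-⊆-↭ {ys = []} [] _ _ = refl
unique-⊆-↭ {ys = y ∷ ys} [] _ ()
unique-⊆-↭ {xs = x ∷ xs} (x∉xs ∷ u) xs⊆ys le with ∈-∃++ (xs⊆ys (here refl))
... | us , vs , refl = ↭-trans (prep x (unique-⊆-↭ u sub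
    (ℕₚ.≤-pred (subst (_≤ suc (length xs)) (↭ₚ.↭-length (↭ₚ.shift x us vs)) le))))
    (↭-sym (↭ₚ.shift x us vs))
  where
  sub : xs ⊆ us ++ vs
  sub z∈ with ↭ₚ.∈-resp-↭ (↭ₚ.shift x us vs) (xs⊆ys (there z∈))
  ... | here refl = contradiction refl (All.lookup x∉xs z∈)
  ... | there z∈′ = z∈′

unique-map : ∀ {X Y : Set} {h : X → Y} {xs} → Unique xs →
             (∀ {x y} → x ∈ xs → y ∈ xs → h x ≡ h y → x ≡ y) → Unique (map h xs)
unique-map [] _ = []
unique-map {h = h} {x ∷ xs} (x∉xs ∷ u) inj =
  Allₚ.map⁺ (All.tabulate λ y∈ eq → All.lookup x∉xs y∈ (inj (here refl) (there y∈) eq)) ∷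
  unique-map u λ x∈ y∈ → inj (there x∈) (there y∈)

unique-↭ : ∀ {X : Set} {xs ys : List X} → xs ↭ ys → Unique xs → Unique ys
unique-↭ refl u = u
unique-↭ (prep x r) (x∉ ∷ u) = ↭ₚ.All-resp-↭ r x∉ ∷ unique-↭ r u
unique-↭ (swap x y r) ((x≢y ∷ x∉) ∷ y∉ ∷ u) =
  ((x≢y ∘ sym) ∷ ↭ₚ.All-resp-↭ r y∉) ∷ ↭ₚ.All-resp-↭ r x∉ ∷ unique-↭ r u
unique-↭ (transᵖ r r′) u = unique-↭ r′ (unique-↭ r u)

± : {P : Set} → Dec P → ℤ
± (yes _) = -1ℤ
± (no  _) = 1ℤ

±-true : {P : Set} (P? : Dec P) → P → ± P? ≡ -1ℤ
±-true (yes _) _ = refl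
±-true (no ¬p) p = contradiction p ¬p

±-false : {P : Set} (P? : Dec P) → ¬ P → ± P? ≡ 1ℤ
±-false (yes p) ¬p = contradiction p ¬p
±-false (no _)  _  = refl

-1^length-filter : ∀ {X : Set} {P : X → Set} (P? : ∀ x → Dec (P x)) xs →
                   -1ℤ ^ length (filter P? xs) ≡ ∏ xs (λ x → ± (P? x))
-1^length-filter P? []       = refl
-1^length-filter P? (x ∷ xs) with P? x
... | yes _ = cong (-1ℤ *_) (-1^length-filter P? xs)
... | no  _ = trans (-1^length-filter P? xs) (sym (ℤₚ.*-identityˡ _))

∏-cartesianProduct : ∀ {X Y : Set} (xs : List X) (ys : List Y) h →
  ∏ (cartesianProduct xs ys) h ≡ ∏ xs λ x → ∏ ys λ y → h (x , y)
∏-cartesianProduct []       ys h = refl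
∏-cartesianProduct (x ∷ xs) ys h = trans (∏-++ (map (x ,_) ys) _ h)
  (cong₂ _*_ (∏-map (x ,_) ys h) (∏-cartesianProduct xs ys h))

module _ {p : ℕ} where

  toℕ² : Fin p × Fin p → ℕ × ℕ
  toℕ² (a , b) = toℕ a , toℕ b

  χ : Fin p × Fin p → Fin p × Fin p → ℤ
  χ e e′ = ± (crosses? (e , e′))

  ε-∏ : ∀ A → ε A ≡ ∏ A λ e → ∏ A (χ e)
  ε-∏ A = trans (-1^length-filter crosses? (cartesianProduct A A)) (∏-cartesianProduct A A _)

  ε-∷ : ∀ e A → ε (e ∷ A) ≡ ∏ A (λ e′ → χ e e′ * χ e′ e) * ε A
  ε-∷ e A = begin
    ε (e ∷ A)
      ≡⟨ ε-∏ (e ∷ A) ⟩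
    χ e e * ∏ A (χ e) * ∏ A (λ e′ → χ e′ e * ∏ A (χ e′))
      ≡⟨ cong₂ (λ x y → x * ∏ A (χ e) * y) (±-false (crosses? (e , e)) λ (a<a , _) → ℕₚ.n≮n _ a<a)
           (∏-* A (λ e′ → χ e′ e) (λ e′ → ∏ A (χ e′))) ⟩
    1ℤ * ∏ A (χ e) * (∏ A (λ e′ → χ e′ e) * ∏ A (λ e′ → ∏ A (χ e′)))
      ≡⟨ lem (∏ A (χ e)) (∏ A λ e′ → χ e′ e) (∏ A (λ e′ → ∏ A (χ e′))) ⟩
    ∏ A (χ e) * ∏ A (λ e′ → χ e′ e) * ∏ A (λ e′ → ∏ A (χ e′))
      ≡⟨ cong₂ _*_ (sym (∏-* A (χ e) (λ e′ → χ e′ e))) (sym (ε-∏ A)) ⟩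
    ∏ A (λ e′ → χ e e′ * χ e′ e) * ε A ∎
    where
    open ≡-Reasoning
    lem : ∀ x y z → 1ℤ * x * (y * z) ≡ x * y * z
    lem = solve-∀

  -- The index is the value of `s a c * s b c`: it is -1 exactly when c lies strictly between a and
  -- b.
  data Position (a b c : ℕ) : ℤ → Set where
    left   : c < a → Position a b c 1ℤ
    middle : a < c → c < b → Position a b c -1ℤ
    right  : b < c → Position a b c 1ℤ

  position : ∀ {a b} c → a < b → a ≢ c → b ≢ c → Position a b c (s a c * s b c)
  position {a} {b} c a<b a≢c b≢c with ℕₚ.<-cmp a c | ℕₚ.<-cmp b c
  ... | tri≈ _ a≡c _ | _            = contradiction a≡c a≢c
  ... | _            | tri≈ _ b≡c _ = contradiction b≡c b≢c
  ... | tri> _ _ c<a | _            = subst (Position a b c) (sym (cong₂ _*_ (s-> c<a) (s-> (ℕₚ.<-trans c<a a<b)))) (left c<a)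
  ... | tri< a<c _ _ | tri> _ _ c<b = subst (Position a b c) (sym (cong₂ _*_ (s-< a<c) (s-> c<b))) (middle a<c c<b)
  ... | tri< a<c _ _ | tri< b<c _ _ = subst (Position a b c) (sym (cong₂ _*_ (s-< a<c) (s-< b<c))) (right b<c)

  -- Two edges without common ends cross exactly when one end of the second, and not the other, lies
  -- between the ends of the first. The two factors cover the two possible orders of the edges.
  χ-χ : ∀ {a b c d} → toℕ c < toℕ d → ∀ {t t′} → Position (toℕ a) (toℕ b) (toℕ c) t → Position (toℕ a) (toℕ b) (toℕ d) t′ →
        χ (a , b) (c , d) * χ (c , d) (a , b) ≡ t * t′
  χ-χ {a} {b} {c} {d} c<d = λ where
      (left c<a)       (left d<a)       → both (λ (a<c , _) → ℕₚ.<-asym a<c c<a) λ (_ , a<d , _) → ℕₚ.<-asym a<d d<a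
      (left c<a)       (middle a<d d<b) → cong₂ _*_ (±-false ef? λ (a<c , _) → ℕₚ.<-asym a<c c<a) (±-true fe? (c<a , a<d , d<b))
      (left c<a)       (right b<d)      → both (λ (a<c , _) → ℕₚ.<-asym a<c c<a) λ (_ , _ , d<b) → ℕₚ.<-asym d<b b<d
      (middle a<c c<b) (left d<a)       → contradiction (ℕₚ.<-trans c<d d<a) (ℕₚ.<⇒≯ a<c)
      (middle a<c c<b) (middle a<d d<b) → both (λ (_ , _ , b<d) → ℕₚ.<-asym b<d d<b) λ (c<a , _) → ℕₚ.<-asym c<a a<c
      (middle a<c c<b) (right b<d)      → cong₂ _*_ (±-true ef? (a<c , c<b , b<d)) (±-false fe? λ (c<a , _) → ℕₚ.<-asym c<a a<c)
      (right b<c)      (left d<a)       → both (λ (_ , c<b , _) → ℕₚ.<-asym c<b b<c) λ (_ , a<d , _) → ℕₚ.<-asym a<d d<a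
      (right b<c)      (middle a<d d<b) → contradiction (ℕₚ.<-trans b<c c<d) (ℕₚ.<⇒≯ d<b)
      (right b<c)      (right b<d)      → both (λ (_ , c<b , _) → ℕₚ.<-asym c<b b<c) λ (_ , _ , d<b) → ℕₚ.<-asym d<b b<d
    where
    ef? = crosses? ((a , b) , (c , d))
    fe? = crosses? ((c , d) , (a , b))
    both : ¬ Crosses ((a , b) , (c , d)) → ¬ Crosses ((c , d) , (a , b)) → ± ef? * ± fe? ≡ 1ℤ
    both ¬ef ¬fe = cong₂ _*_ (±-false ef? ¬ef) (±-false fe? ¬fe)

  -- An edge itself contributes 1, as its ends are in increasing order. The four comparisons between
  -- two edges multiply to -1 exactly when the edges cross.
  sgn-ε : ∀ {A} → All IsEdge A → Unique (flat (map toℕ² A)) → sgn (flat (map toℕ² A)) ≡ ε A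
  sgn-ε [] _ = refl
  sgn-ε {(a , b) ∷ A} ((_ , _ , a<b) ∷ edges) ((_ ∷ a∉) ∷ b∉ ∷ u) = begin
    s (toℕ a) (toℕ b) * ∏ F (s (toℕ a)) * (∏ F (s (toℕ b)) * sgn F)
      ≡⟨ cong (λ t → t * ∏ F (s (toℕ a)) * (∏ F (s (toℕ b)) * sgn F)) (s-< a<b) ⟩
    1ℤ * ∏ F (s (toℕ a)) * (∏ F (s (toℕ b)) * sgn F)
      ≡⟨ lem (∏ F (s (toℕ a))) (∏ F (s (toℕ b))) (sgn F) ⟩
    ∏ F (s (toℕ a)) * ∏ F (s (toℕ b)) * sgn F
      ≡⟨ cong (_* sgn F) (∏-* F (s (toℕ a)) (s (toℕ b))) ⟨
    ∏ F (λ c → s (toℕ a) c * s (toℕ b) c) * sgn F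
      ≡⟨ cong₂ _*_ (crossings A edges a∉ b∉) (sgn-ε edges u) ⟩
    ∏ A (λ e → χ (a , b) e * χ e (a , b)) * ε A
      ≡⟨ ε-∷ (a , b) A ⟨
    ε ((a , b) ∷ A) ∎
    where
    open ≡-Reasoning
    F = flat (map toℕ² A)
    lem : ∀ x y z → 1ℤ * x * (y * z) ≡ x * y * z
    lem = solve-∀
    crossings : ∀ A → All IsEdge A → All (toℕ a ≢_) (flat (map toℕ² A)) → All (toℕ b ≢_) (flat (map toℕ² A)) →
      ∏ (flat (map toℕ² A)) (λ c → s (toℕ a) c * s (toℕ b) c) ≡ ∏ A (λ e → χ (a , b) e * χ e (a , b))
    crossings [] [] _ _ = refl
    crossings ((c , d) ∷ A) ((_ , _ , c<d) ∷ es) (a≢c ∷ a≢d ∷ a∉) (b≢c ∷ b≢d ∷ b∉) = trans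
      (sym (ℤₚ.*-assoc (s (toℕ a) (toℕ c) * s (toℕ b) (toℕ c)) (s (toℕ a) (toℕ d) * s (toℕ b) (toℕ d)) _))
      (cong₂ _*_ (sym (χ-χ {a} {b} c<d (position (toℕ c) a<b a≢c b≢c) (position (toℕ d) a<b a≢d b≢d)))
        (crossings A es a∉ b∉))

-- Starters as matchings that meet every class once

length-flat : ∀ A → length (flat A) ≡ length A ℕ.+ length A
length-flat []            = refl
length-flat ((a , b) ∷ A) = cong suc (trans (cong suc (length-flat A)) (sym (ℕₚ.+-suc (length A) (length A))))

signs : List ℕ → ℤ
signs xs = ∏ xs λ x → -1ℤ ^ x

signs² : ∀ xs → signs xs * signs xs ≡ 1ℤ
signs² []       = refl
signs² (x ∷ xs) = trans (lem (-1ℤ ^ x) (signs xs)) (cong₂ _*_ (-1^ x) (signs² xs))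
  where
  lem : ∀ a b → a * b * (a * b) ≡ a * a * (b * b)
  lem = solve-∀

module _ (n : ℕ) where

  private
    m = n ℕ.+ n
    p = suc m

  Edges : Set
  Edges = List (Fin p × Fin p)

  count : Fin p → Edges → ℕ
  count r A = length (filter (incident? r) A)

  count-accept : ∀ r {e} A → Incident r e → count r (e ∷ A) ≡ suc (count r A)
  count-accept r A inc = cong length (Listₚ.filter-accept (incident? r) inc)

  count-reject : ∀ r {e} A → ¬ Incident r e → count r (e ∷ A) ≡ count r A
  count-reject r A ¬inc = cong length (Listₚ.filter-reject (incident? r) ¬inc)

  count≤count-∷ : ∀ r e A → count r A ≤ count r (e ∷ A)
  count≤count-∷ r e A with incident? r e
  ... | yes inc = subst (count r A ≤_) (sym (count-accept r A inc)) (ℕₚ.n≤1+n _)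
  ... | no ¬inc = ℕₚ.≤-reflexive (sym (count-reject r A ¬inc))

  ∈-flat⇒count : ∀ r A → toℕ r ∈ flat (map toℕ² A) → 1 ≤ count r A
  ∈-flat⇒count r ((a , b) ∷ A) (here eq)         = subst (1 ≤_) (sym (count-accept r A (inj₁ (Finₚ.toℕ-injective eq)))) (s≤s z≤n)
  ∈-flat⇒count r ((a , b) ∷ A) (there (here eq)) = subst (1 ≤_) (sym (count-accept r A (inj₂ (Finₚ.toℕ-injective eq)))) (s≤s z≤n)
  ∈-flat⇒count r ((a , b) ∷ A) (there (there r∈)) = ℕₚ.≤-trans (∈-flat⇒count r A r∈) (count≤count-∷ r (a , b) A)

  count⇒∈-flat : ∀ r A → 1 ≤ count r A → toℕ r ∈ flat (map toℕ² A)
  count⇒∈-flat r ((a , b) ∷ A) 1≤ with incident? r (a , b)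
  ... | yes (inj₁ refl) = here refl
  ... | yes (inj₂ refl) = there (here refl)
  ... | no ¬inc = there (there (count⇒∈-flat r A (subst (1 ≤_) (count-reject r A ¬inc) 1≤)))

  unique-flat : ∀ A → All IsEdge A → (∀ r → NonZeroResidue r → count r A ≤ 1) → Unique (flat (map toℕ² A))
  unique-flat [] _ _ = []
  unique-flat ((a , b) ∷ A) ((a≢0 , b≢0 , a<b) ∷ edges) once =
    ((ℕₚ.<⇒≢ a<b) ∷ fresh a a≢0 (inj₁ refl)) ∷ fresh b b≢0 (inj₂ refl) ∷
    unique-flat A edges λ r r≢0 → ℕₚ.≤-trans (count≤count-∷ r (a , b) A) (once r r≢0)
    where
    fresh : ∀ r → NonZeroResidue r → Incident r (a , b) → All (toℕ r ≢_) (flat (map toℕ² A))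
    fresh r r≢0 inc = Allₚ.¬Any⇒All¬ _ λ r∈ → ℕₚ.<⇒≱ (s≤s (∈-flat⇒count r A r∈))
      (subst (_≤ 1) (count-accept r A inc) (once r r≢0))

  unique-flat⇒count≤1 : ∀ A → Unique (flat (map toℕ² A)) → ∀ r → count r A ≤ 1
  unique-flat⇒count≤1 [] _ r = z≤n
  unique-flat⇒count≤1 ((a , b) ∷ A) ((_ ∷ a∉) ∷ b∉ ∷ u) r with incident? r (a , b)
  ... | no ¬inc = subst (_≤ 1) (sym (count-reject r A ¬inc)) (unique-flat⇒count≤1 A u r)
  ... | yes inc = subst (_≤ 1) (sym (count-accept r A inc)) (s≤s (ℕₚ.≮⇒≥ λ 1≤ → absurd inc (count⇒∈-flat r A 1≤)))
    where
    absurd : Incident r (a , b) → toℕ r ∉ flat (map toℕ² A)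
    absurd (inj₁ refl) r∈ = All.lookup a∉ r∈ refl
    absurd (inj₂ refl) r∈ = All.lookup b∉ r∈ refl

  ∈-seg : ∀ (r : Fin p) → NonZeroResidue r → toℕ r ∈ seg m
  ∈-seg r r≢0 = ∈-seg⁺ (ℕₚ.n≢0⇒n>0 r≢0) (Finₚ.toℕ≤pred[n] r)

  flat⊆seg : ∀ (A : Edges) → All IsEdge A → flat (map toℕ² A) ⊆ seg m
  flat⊆seg ((a , b) ∷ A) ((a≢0 , b≢0 , _) ∷ es) (here refl)         = ∈-seg a a≢0
  flat⊆seg ((a , b) ∷ A) ((a≢0 , b≢0 , _) ∷ es) (there (here refl)) = ∈-seg b b≢0
  flat⊆seg ((a , b) ∷ A) (_ ∷ es) (there (there x∈))                = flat⊆seg A es x∈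

  unique-seg : ∀ k → Unique (seg k)
  unique-seg k = Uniqueₚ.applyDownFrom⁺₁ suc k λ j<i _ eq → ℕₚ.<⇒≢ j<i (sym (ℕₚ.suc-injective eq))

  isDifference⇒ : ∀ {r a b} → toℕ a < toℕ b → IsDifference {p} r (a , b) →
                  ⟦ r ⟧ ≡ + (toℕ b ∸ toℕ a) [mod p ] ⊎ ⟦ r ⟧ ≡ - + (toℕ b ∸ toℕ a) [mod p ]
  isDifference⇒ {r} {a} {b} a<b (inj₁ e) = inj₂ (subst (λ t → ⟦ r ⟧ ≡ t [mod p ])
    (trans (lem (⟦ a ⟧) (⟦ b ⟧)) (cong -_ (+-∸ (ℕₚ.<⇒≤ a<b)))) e)
    where
    lem : ∀ a b → a - b ≡ - (b - a)
    lem = solve-∀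
  isDifference⇒ {r} {a} {b} a<b (inj₂ e) = inj₁ (subst (λ t → ⟦ r ⟧ ≡ t [mod p ])
    (trans (lem (⟦ a ⟧) (⟦ b ⟧)) (+-∸ (ℕₚ.<⇒≤ a<b))) e)
    where
    lem : ∀ a b → - (a - b) ≡ b - a
    lem = solve-∀

  ⇒isDifference : ∀ {r a b} → toℕ a < toℕ b →
                  ⟦ r ⟧ ≡ + (toℕ b ∸ toℕ a) [mod p ] ⊎ ⟦ r ⟧ ≡ - + (toℕ b ∸ toℕ a) [mod p ] → IsDifference {p} r (a , b)
  ⇒isDifference {r} {a} {b} a<b (inj₁ e) = inj₂ (subst (λ t → ⟦ r ⟧ ≡ t [mod p ])
    (trans (sym (+-∸ (ℕₚ.<⇒≤ a<b))) (lem (⟦ a ⟧) (⟦ b ⟧))) e)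
    where
    lem : ∀ a b → b - a ≡ - (a - b)
    lem = solve-∀
  ⇒isDifference {r} {a} {b} a<b (inj₂ e) = inj₁ (subst (λ t → ⟦ r ⟧ ≡ t [mod p ])
    (trans (cong -_ (sym (+-∸ (ℕₚ.<⇒≤ a<b)))) (lem (⟦ a ⟧) (⟦ b ⟧))) e)
    where
    lem : ∀ a b → - (b - a) ≡ a - b
    lem = solve-∀

  classes : Edges → List ℕ
  classes A = map (cl n) (map toℕ² A)

  ∸-bounds : ∀ {a b : Fin p} → IsEdge (a , b) → 0 < toℕ b ∸ toℕ a × toℕ b ∸ toℕ a < p
  ∸-bounds {a} {b} (_ , _ , a<b) = ℕₚ.m<n⇒0<n∸m a<b , ℕₚ.≤-<-trans (ℕₚ.m∸n≤m (toℕ b) (toℕ a)) (Finₚ.toℕ<n b)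

  differences⇒classes : ∀ A → All IsEdge A → (∀ r → NonZeroResidue r → Any (IsDifference r) A) → seg n ⊆ classes A
  differences⇒classes A edges diff {d} d∈ with ∈-seg⁻ d∈
  ... | d>0 , d≤n = find edges (diff r r≢0)
    where
    d<p : d < p
    d<p = ℕₚ.≤-<-trans d≤n (s≤s (ℕₚ.m≤m+n n n))
    r : Fin p
    r = Fin.fromℕ< d<p
    r≡d : toℕ r ≡ d
    r≡d = Finₚ.toℕ-fromℕ< d<p
    r≢0 : NonZeroResidue r
    r≢0 eq = ℕₚ.<⇒≢ d>0 (trans (sym eq) r≡d)
    find : ∀ {A} → All IsEdge A → Any (IsDifference r) A → d ∈ classes A
    find (e ∷ es) (there x) = there (find es x)
    find {(a , b) ∷ _} (e ∷ es) (here x) = here (sym (cls-complete n (proj₁ (∸-bounds e)) (proj₂ (∸-bounds e)) d>0 d≤n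
      (subst (λ t → + t ≡ + (toℕ b ∸ toℕ a) [mod p ] ⊎ + t ≡ - + (toℕ b ∸ toℕ a) [mod p ]) r≡d
        (isDifference⇒ {r} {a} {b} (proj₂ (proj₂ e)) x))))

  same-class : ∀ {x y} → x < p → y < p → cls n x ≡ cls n y → + x ≡ + y [mod p ] ⊎ + x ≡ - + y [mod p ]
  same-class {x} {y} x<p y<p eq = combine {+ cls n x} (cls-sound n x<p) (subst (λ t → + t ≡ + y [mod p ] ⊎ + t ≡ - + y [mod p ]) (sym eq) (cls-sound n y<p))
    where
    combine : ∀ {c} → c ≡ + x [mod p ] ⊎ c ≡ - + x [mod p ] → c ≡ + y [mod p ] ⊎ c ≡ - + y [mod p ] → + x ≡ + y [mod p ] ⊎ + x ≡ - + y [mod p ]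
    combine {c} (inj₁ e) (inj₁ e′) = inj₁ (cong⁻ (mod-trans {x = + x} {c} {+ y} (mod-sym {x = c} (cong⁺ e)) (cong⁺ e′)))
    combine {c} (inj₁ e) (inj₂ e′) = inj₂ (cong⁻ (mod-trans {x = + x} {c} { - + y} (mod-sym {x = c} (cong⁺ e)) (cong⁺ e′)))
    combine {c} (inj₂ e) (inj₁ e′) = inj₂ (subst (λ t → t ≡ - + y [mod p ]) (ℤₚ.neg-involutive (+ x))
      (cong⁻ (mod-neg (mod-trans {x = - + x} {c} {+ y} (mod-sym {x = c} (cong⁺ e)) (cong⁺ e′)))))
    combine {c} (inj₂ e) (inj₂ e′) = inj₁ (subst₂ (λ t u → t ≡ u [mod p ]) (ℤₚ.neg-involutive (+ x)) (ℤₚ.neg-involutive (+ y))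
      (cong⁻ (mod-neg (mod-trans {x = - + x} {c} { - + y} (mod-sym {x = c} (cong⁺ e)) (cong⁺ e′)))))

  classes⇒differences : ∀ A → All IsEdge A → seg n ⊆ classes A → ∀ r → NonZeroResidue r → Any (IsDifference r) A
  classes⇒differences A edges sub r r≢0 = find edges (sub (∈-seg⁺ (proj₁ range) (proj₂ range)))
    where
    range = cls-range n (ℕₚ.n≢0⇒n>0 r≢0) (Finₚ.toℕ<n r)
    find : ∀ {A} → All IsEdge A → cls n (toℕ r) ∈ classes A → Any (IsDifference r) A
    find {(a , b) ∷ _} (e ∷ es) (here x)  = here (⇒isDifference {r} {a} {b} (proj₂ (proj₂ e)) (same-class (Finₚ.toℕ<n r) (proj₂ (∸-bounds e)) x))
    find {(a , b) ∷ _} (e ∷ es) (there x) = there (find es x)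

  length-classes : ∀ A → length (classes A) ≡ length (map toℕ² A)
  length-classes A = Listₚ.length-map (cl n) (map toℕ² A)

  starter⇒flat : ∀ {A} → IsPerfectMatching {p} A → Unique (flat (map toℕ² A)) × flat (map toℕ² A) ↭ seg m
  starter⇒flat {A} (edges , once) = u , unique-⊆-↭ u (flat⊆seg A edges) (unique-⊆-length (unique-seg m) covered)
    where
    u = unique-flat A edges λ r r≢0 → ℕₚ.≤-reflexive (once r r≢0)
    covered : seg m ⊆ flat (map toℕ² A)
    covered {x} x∈ = subst (_∈ flat (map toℕ² A)) r≡x (count⇒∈-flat r A (ℕₚ.≤-reflexive (sym (once r r≢0))))
      where
      x<p : x < p
      x<p = s≤s (proj₂ (∈-seg⁻ x∈))
      r = Fin.fromℕ< x<p
      r≡x = Finₚ.toℕ-fromℕ< x<p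
      r≢0 : NonZeroResidue r
      r≢0 eq = ℕₚ.<⇒≢ (proj₁ (∈-seg⁻ x∈)) (trans (sym eq) r≡x)

  -- A matching has n edges, and its differences meet all n classes, so each class occurs exactly
  -- once.
  starter⇒classes : ∀ {A} → IsStarter {p} A → classes A ↭ seg n
  starter⇒classes {A} (pm@(edges , _) , diff) = ↭-sym (unique-⊆-↭ (unique-seg n) (differences⇒classes A edges diff)
    (ℕₚ.≤-reflexive (trans (length-classes A) (trans half (sym (length-seg n))))))
    where
    half : length (map toℕ² A) ≡ n
    half = ℕₚ.*-cancelˡ-≡ _ _ 2 (trans (lem (length (map toℕ² A))) (trans (sym (length-flat (map toℕ² A)))
      (trans (↭ₚ.↭-length (proj₂ (starter⇒flat {A} pm))) (trans (length-seg m) (sym (lem n))))))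
      where
      lem : ∀ x → 2 ℕ.* x ≡ x ℕ.+ x
      lem = ℕRing.solve-∀

  -- The classes show that there are n edges; their 2n ends are distinct and hence exhaust 1, ...,
  -- 2n.
  classes⇒starter : ∀ {A} → All IsEdge A → classes A ↭ seg n → Unique (flat (map toℕ² A)) → IsStarter {p} A
  classes⇒starter {A} edges cls↭ u =
    (edges , λ r r≢0 → ℕₚ.≤-antisym (unique-flat⇒count≤1 A u r)
      (∈-flat⇒count r A (↭ₚ.∈-resp-↭ (↭-sym flat↭) (∈-seg r r≢0)))) ,
    classes⇒differences A edges (↭ₚ.∈-resp-↭ (↭-sym cls↭))
    where
    half : length (map toℕ² A) ≡ n
    half = trans (sym (length-classes A)) (trans (↭ₚ.↭-length cls↭) (length-seg n))
    flat↭ : flat (map toℕ² A) ↭ seg m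
    flat↭ = unique-⊆-↭ u (flat⊆seg A edges) (ℕₚ.≤-reflexive (trans (length-seg m)
      (sym (trans (length-flat (map toℕ² A)) (cong₂ ℕ._+_ half half)))))

  -- As p is odd, p - δ and δ have opposite parities, and `flp` records just this change.
  sign-cls : ∀ δ → δ < p → -1ℤ ^ δ ≡ -1ℤ ^ cls n δ * -1ℤ ^ flp n δ
  sign-cls δ δ<p with δ ℕ.≤? n
  ... | yes _ = sym (ℤₚ.*-identityʳ _)
  ... | no  _ = begin
    -1ℤ ^ δ                                ≡⟨ lem (-1ℤ ^ δ) ⟩
    1ℤ * -1ℤ ^ δ * (-1ℤ * -1ℤ)             ≡⟨ cong (λ t → t * -1ℤ ^ δ * (-1ℤ * -1ℤ)) (-1^ (p ∸ δ)) ⟨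
    x * x * -1ℤ ^ δ * (-1ℤ * -1ℤ)          ≡⟨ lem′ x (-1ℤ ^ δ) ⟩
    x * -1ℤ * (x * -1ℤ ^ δ * -1ℤ)          ≡⟨ cong (λ t → x * -1ℤ * (t * -1ℤ)) (ℤₚ.^-distribˡ-+-* -1ℤ (p ∸ δ) δ) ⟨
    x * -1ℤ * (-1ℤ ^ (p ∸ δ ℕ.+ δ) * -1ℤ)  ≡⟨ cong (λ t → x * -1ℤ * (-1ℤ ^ t * -1ℤ)) (ℕₚ.m∸n+n≡m (ℕₚ.<⇒≤ δ<p)) ⟩
    x * -1ℤ * (-1ℤ ^ p * -1ℤ)              ≡⟨ cong (λ t → x * -1ℤ * (-1ℤ * t * -1ℤ)) (trans (ℤₚ.^-distribˡ-+-* -1ℤ n n) (-1^ n)) ⟩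
    x * -1ℤ * 1ℤ                           ≡⟨ ℤₚ.*-identityʳ _ ⟩
    x * -1ℤ                                ≡⟨⟩
    x * (-1ℤ * 1ℤ)                         ∎
    where
    open ≡-Reasoning
    x = -1ℤ ^ (p ∸ δ)
    lem : ∀ y → y ≡ 1ℤ * y * (-1ℤ * -1ℤ)
    lem = solve-∀
    lem′ : ∀ x y → x * x * y * (-1ℤ * -1ℤ) ≡ x * -1ℤ * (x * y * -1ℤ)
    lem′ = solve-∀

  parity : ∀ {a b} → a ≤ b → b ∸ a < p → -1ℤ ^ a * -1ℤ ^ b ≡ -1ℤ ^ cl n (a , b) * flip n (a , b)
  parity {a} {b} a≤b δ<p = trans (cong (λ t → -1ℤ ^ a * -1ℤ ^ t) (sym (ℕₚ.m+[n∸m]≡n a≤b)))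
    (trans (cong (-1ℤ ^ a *_) (ℤₚ.^-distribˡ-+-* -1ℤ a (b ∸ a)))
    (trans (sym (ℤₚ.*-assoc (-1ℤ ^ a) (-1ℤ ^ a) _)) (trans (cong (_* -1ℤ ^ (b ∸ a)) (-1^ a)) (trans (ℤₚ.*-identityˡ _) (sign-cls (b ∸ a) δ<p)))))

  signs-flat : ∀ A → All IsEdge A → signs (flat (map toℕ² A)) ≡ signs (classes A) * ∏ (map toℕ² A) (flip n)
  signs-flat [] [] = refl
  signs-flat ((a , b) ∷ A) (e@(_ , _ , a<b) ∷ es) = trans (sym (ℤₚ.*-assoc (-1ℤ ^ toℕ a) (-1ℤ ^ toℕ b) _))
    (trans (cong₂ _*_ (parity (ℕₚ.<⇒≤ a<b) (proj₂ (∸-bounds e))) (signs-flat A es))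
      (lem (-1ℤ ^ cl n (toℕ a , toℕ b)) (flip n (toℕ a , toℕ b)) _ _))
    where
    lem : ∀ x y z w → x * y * (z * w) ≡ x * z * (y * w)
    lem = solve-∀

  -- The product of the flips over a starter. It does not depend on the starter: the endpoints
  -- of the edges are 1, …, 2n and their classes are 1, …, n, and b − a has the parity of b + a.
  κ : ℤ
  κ = signs (seg m) * signs (seg n)

  weight : List (ℕ × ℕ) → ℤ
  weight A = ∏ A (flip n) * sgn (flat A)

  -- For a starter the flips multiply to `κ`, whose square is 1. A list of edges that meets each
  -- class once without being a starter has a repeated end, so its sign is 0.
  starter-weight : ∀ {A} → All IsEdge A →
    𝟙 (isStarter? A) * ε A ≡ κ * (𝟙 (classes A ↭? seg n) * weight (map toℕ² A))
  starter-weight {A} edges with isStarter? A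
  ... | yes st@(pm , _) = begin
    1ℤ * ε A
      ≡⟨ cong (1ℤ *_) (sym (sgn-ε edges (proj₁ (starter⇒flat {A} pm)))) ⟩
    1ℤ * sgn F
      ≡⟨ cong (_* sgn F) (sym κη≡1) ⟩
    κ * η * sgn F
      ≡⟨ lem κ η (sgn F) ⟩
    κ * (1ℤ * (η * sgn F))
      ≡⟨ cong (λ t → κ * (t * (η * sgn F))) (sym (𝟙-true (classes A ↭? seg n) (starter⇒classes {A} st))) ⟩
    κ * (𝟙 (classes A ↭? seg n) * (η * sgn F)) ∎
    where
    open ≡-Reasoning
    F = flat (map toℕ² A)
    η = ∏ (map toℕ² A) (flip n)
    lem : ∀ x y z → x * y * z ≡ x * (1ℤ * (y * z))
    lem = solve-∀
    κη≡1 : κ * η ≡ 1ℤ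
    κη≡1 = trans (ℤₚ.*-assoc (signs (seg m)) (signs (seg n)) η) (trans
      (cong (signs (seg m) *_) (trans (cong (_* η) (sym (∏-↭ _ (starter⇒classes {A} st))))
        (trans (sym (signs-flat A edges)) (∏-↭ _ (proj₂ (starter⇒flat {A} pm))))))
      (signs² (seg m)))
  ... | no ¬st with classes A ↭? seg n
  ...   | no  _ = sym (ℤₚ.*-zeroʳ κ)
  ...   | yes cls↭ = sym (trans (cong (λ t → κ * (1ℤ * t)) (trans
          (cong (∏ (map toℕ² A) (flip n) *_) (sgn-≡0 _ λ u → ¬st (classes⇒starter edges cls↭ u)))
          (ℤₚ.*-zeroʳ (∏ (map toℕ² A) (flip n))))) (ℤₚ.*-zeroʳ κ))

-- Fermat, Wilson and the quadratic character of 2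

mod-%ℕ : ∀ p .{{_ : ℕ.NonZero p}} x → + (x ℤ/.%ℕ p) ≈ x [mod p ]
mod-%ℕ p x = cong⁺ (ℤ∣.divides (- (x ℤ/./ℕ p))
  (trans (cong (λ t → + (x ℤ/.%ℕ p) - t) (ℤ/.a≡a%ℕn+[a/ℕn]*n x p)) (lem (+ (x ℤ/.%ℕ p)) (x ℤ/./ℕ p) (+ p))))
  where
  lem : ∀ r q p → r - (r + q * p) ≡ - q * p
  lem = solve-∀

∏ℕ-seg-suc : ∀ k → ∏ℕ (seg (suc k)) ≡ ∏ℕ (applyDownFrom (suc ∘ suc) k)
∏ℕ-seg-suc zero    = refl
∏ℕ-seg-suc (suc k) = cong (+ suc (suc k) *_) (∏ℕ-seg-suc k)

module _ (n : ℕ) (isPrime : Prime (suc (n ℕ.+ n))) where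

  private
    m = n ℕ.+ n
    p = suc m

  open ≈-Reasoning (mod-setoid p)

  euclid : ∀ x y → + p ℤ∣.∣ x * y → + p ℤ∣.∣ x ⊎ + p ℤ∣.∣ y
  euclid x y p∣xy with euclidsLemma ∣ x ∣ ∣ y ∣ isPrime (subst (p ∣_) (ℤₚ.abs-* x y) (ℤ∣.∣⇒∣ᵤ p∣xy))
  ... | inj₁ d = inj₁ (ℤ∣.∣ᵤ⇒∣ d)
  ... | inj₂ d = inj₂ (ℤ∣.∣ᵤ⇒∣ d)

  ∤-* : ∀ {x y} → ¬ + p ℤ∣.∣ x → ¬ + p ℤ∣.∣ y → ¬ + p ℤ∣.∣ x * y
  ∤-* {x} {y} p∤x p∤y p∣xy = [ p∤x , p∤y ]′ (euclid x y p∣xy)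

  mod-cancel : ∀ c {x y} → ¬ + p ℤ∣.∣ c → c * x ≈ c * y [mod p ] → x ≈ y [mod p ]
  mod-cancel c {x} {y} p∤c (cong⁺ e) with euclid c (x - y) (subst (+ p ℤ∣.∣_) (lem c x y) e)
    where
    lem : ∀ c x y → c * x - c * y ≡ c * (x - y)
    lem = solve-∀
  ... | inj₁ p∣c = contradiction p∣c p∤c
  ... | inj₂ d   = cong⁺ d

  ∤-residue : ∀ {k} → 0 < k → k < p → ¬ + p ℤ∣.∣ + k
  ∤-residue k>0 k<p p∣k = ℕₚ.<⇒≢ k>0 (sym (∣-<⇒≡0 k<p p∣k))

  ∤-seg : ∀ {k} → k ∈ seg m → ¬ + p ℤ∣.∣ + k
  ∤-seg k∈ = ∤-residue (proj₁ (∈-seg⁻ k∈)) (s≤s (proj₂ (∈-seg⁻ k∈)))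

  ∤-1 : ¬ + p ℤ∣.∣ 1ℤ
  ∤-1 p∣1 with ℕ∣.∣1⇒≡1 (ℤ∣.∣⇒∣ᵤ p∣1) | prime⇒nonTrivial isPrime
  ... | eq | nt = ℕₚ.<⇒≢ (ℕ.nonTrivial⇒n>1 p {{nt}}) (sym eq)

  ∤-∏ℕ-seg : ∀ k → k ≤ m → ¬ + p ℤ∣.∣ ∏ℕ (seg k)
  ∤-∏ℕ-seg zero    _   = ∤-1
  ∤-∏ℕ-seg (suc k) k≤m = ∤-* (∤-residue (s≤s z≤n) (s≤s k≤m)) (∤-∏ℕ-seg k (ℕₚ.<⇒≤ k≤m))

  %-seg : ∀ {x} → ¬ + p ℤ∣.∣ x → x ℤ/.%ℕ p ∈ seg m
  %-seg {x} p∤x = ∈-seg⁺ (ℕₚ.n≢0⇒n>0 λ eq → p∤x (subst (+ p ℤ∣.∣_) (lem x)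
      (cong⁻ (mod-sym (mod-trans (≡⇒≈ (cong +_ (sym eq))) (mod-%ℕ p x))))))
    (ℕₚ.≤-pred (ℤ/.n%ℕd<d x p))
    where
    lem : ∀ x → x - 0ℤ ≡ x
    lem = solve-∀

  fermat : ∀ y → ¬ + p ℤ∣.∣ y → y ^ m ≈ 1ℤ [mod p ]
  fermat y p∤y = mod-cancel (∏ℕ (seg m)) (∤-∏ℕ-seg m ℕₚ.≤-refl) (begin
    ∏ℕ (seg m) * y ^ m
      ≡⟨ ℤₚ.*-comm (∏ℕ (seg m)) _ ⟩
    y ^ m * ∏ℕ (seg m)
      ≡⟨ cong (λ l → y ^ l * ∏ℕ (seg m)) (length-seg m) ⟨
    y ^ length (seg m) * ∏ℕ (seg m)
      ≡⟨ cong (_* ∏ℕ (seg m)) (∏-const (seg m) y) ⟨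
    ∏ (seg m) (λ _ → y) * ∏ℕ (seg m)
      ≡⟨ ∏-* (seg m) (λ _ → y) (λ i → + i) ⟨
    ∏ (seg m) (λ i → y * + i)
      ≈⟨ (mod-∏ (seg m) λ {i} _ → mod-sym (mod-%ℕ p (y * + i))) ⟩
    ∏ (seg m) (λ i → + ρ i)
      ≡⟨ ∏-map ρ (seg m) (λ i → + i) ⟨
    ∏ℕ (map ρ (seg m))
      ≡⟨ ∏-↭ (λ i → + i) (unique-⊆-↭ unique sub (ℕₚ.≤-reflexive (sym (Listₚ.length-map ρ (seg m))))) ⟩
    ∏ℕ (seg m)
      ≡⟨ ℤₚ.*-identityʳ _ ⟨
    ∏ℕ (seg m) * 1ℤ ∎)
    where
    ρ : ℕ → ℕ
    ρ i = (y * + i) ℤ/.%ℕ p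
    sub : map ρ (seg m) ⊆ seg m
    sub x∈ with ∈-map⁻ ρ x∈
    ... | i , i∈ , refl = %-seg (∤-* {y} p∤y (∤-seg i∈))
    unique : Unique (map ρ (seg m))
    unique = unique-map (unique-seg n m) λ {i} {j} i∈ j∈ eq →
      mod-injective (s≤s (proj₂ (∈-seg⁻ i∈))) (s≤s (proj₂ (∈-seg⁻ j∈))) (cong⁻ (mod-cancel y {+ i} {+ j} p∤y
        (mod-trans (mod-sym (mod-%ℕ p (y * + i))) (mod-trans (≡⇒≈ (cong +_ eq)) (mod-%ℕ p (y * + j))))))

  -- The decision is a parameter, so that it can be the very one inside `f`. Positivity of n ensures
  -- 0^m = 0.
  fermat-𝟙 : ∀ y (d : Dec (+ p ℤ∣.∣ y)) → 0 < n → y ^ m ≈ 1ℤ - 𝟙 d [mod p ]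
  fermat-𝟙 y (no p∤y)  _   = fermat y p∤y
  fermat-𝟙 y (yes p∣y) n>0 = mod-trans (mod-^ m (cong⁺ {y} {0ℤ} (subst (+ p ℤ∣.∣_) (lem y) p∣y))) (≡⇒≈ (0^ m (ℕₚ.≤-trans n>0 (ℕₚ.m≤m+n n n))))
    where
    lem : ∀ y → y ≡ y - 0ℤ
    lem = solve-∀
    0^ : ∀ k → 0 < k → 0ℤ ^ k ≡ 0ℤ
    0^ (suc k) _ = refl

  f≈g : ∀ d a b → 0 < n → f p d a b ≈ g m d a b [mod p ]
  f≈g d a b n>0 = mod-sym (begin
    (x + + d) ^ m - (x + - + d) ^ m
      -- Written as x - (-d), the base is divisible by p exactly when x ≡ -d.
      ≡⟨ cong (λ t → (x + t) ^ m - (x + - + d) ^ m) (ℤₚ.neg-involutive (+ d)) ⟨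
    (x - - + d) ^ m - (x - + d) ^ m
      ≈⟨ mod-- (fermat-𝟙 (x - - + d) (x ≡? - + d [mod p ]) n>0) (fermat-𝟙 (x - + d) (x ≡? + d [mod p ]) n>0) ⟩
    (1ℤ - 𝟙 (x ≡? - + d [mod p ])) - (1ℤ - 𝟙 (x ≡? + d [mod p ]))
      ≡⟨ lem (𝟙 (x ≡? - + d [mod p ])) (𝟙 (x ≡? + d [mod p ])) ⟩
    f p d a b ∎)
    where
    x = + b - + a
    lem : ∀ u v → (1ℤ - u) - (1ℤ - v) ≡ v - u
    lem = solve-∀

  -- If x ↦ a / x acts on L without fixed points, then L splits into pairs with product a.
  ∏-pairs : ∀ a l L → length L ≡ l → Unique L → L ⊆ seg m →
    (∀ {x} → x ∈ L → ∃ λ y → y ∈ L × x ≢ y × + x * + y ≈ a [mod p ]) →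
    ∃ λ k → l ≡ k ℕ.+ k × ∏ℕ L ≈ a ^ k [mod p ]
  ∏-pairs a zero    []      _   _          _   _       = 0 , refl , ≡⇒≈ refl
  ∏-pairs a (suc zero) (x ∷ []) _ _ _ partner with partner (here refl)
  ... | y , here refl , x≢x , _ = contradiction refl x≢x
  ∏-pairs a (suc (suc l)) (x ∷ L) len (x∉L ∷ uL) L⊆ partner with partner (here refl)
  ... | y , here refl , x≢x , _ = contradiction refl x≢x
  ... | y , there y∈L , x≢y , xy≈a with ∈-∃++ y∈L
  ...   | us , vs , refl with ∏-pairs a l (us ++ vs)
            (ℕₚ.suc-injective (trans (sym (↭ₚ.↭-length (↭ₚ.shift y us vs))) (ℕₚ.suc-injective len)))
            uniqueL′ (λ z∈ → L⊆ (there (↭ₚ.∈-resp-↭ (↭-sym (↭ₚ.shift y us vs)) (there z∈)))) partner′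
    where
    ys : Unique (y ∷ us ++ vs)
    ys = unique-↭ (↭ₚ.shift y us vs) uL
    uniqueL′ : Unique (us ++ vs)
    uniqueL′ with ys
    ... | _ ∷ u = u
    y∉ : All (y ≢_) (us ++ vs)
    y∉ with ys
    ... | y∉ ∷ _ = y∉
    cancel : ∀ {u v w} → u ∈ seg m → v ∈ seg m → w ∈ seg m → + w * + u ≈ + w * + v [mod p ] → u ≡ v
    cancel {u} {v} {w} u∈ v∈ w∈ e = mod-injective (s≤s (proj₂ (∈-seg⁻ u∈))) (s≤s (proj₂ (∈-seg⁻ v∈)))
      (cong⁻ (mod-cancel (+ w) {+ u} {+ v} (∤-seg w∈) e))
    shift′ = ↭ₚ.shift y us vs
    back : ∀ {z} → z ∈ us ++ vs → z ∈ us ++ y ∷ vs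
    back z∈ = ↭ₚ.∈-resp-↭ (↭-sym shift′) (there z∈)
    -- The partner of z is neither x nor y: otherwise z would equal a / x = y or a / y = x.
    partner′ : ∀ {z} → z ∈ us ++ vs → ∃ λ w → w ∈ us ++ vs × z ≢ w × + z * + w ≈ a [mod p ]
    partner′ {z} z∈ with partner (there (back z∈))
    ... | w , here refl , _ , zw≈a = contradiction
      (cancel (L⊆ (there y∈L)) (L⊆ (there (back z∈))) (L⊆ (here refl))
        (mod-trans xy≈a (mod-trans (mod-sym zw≈a) (≡⇒≈ (ℤₚ.*-comm (+ z) (+ x))))))
      (All.lookup y∉ z∈)
    ... | w , there w∈ , z≢w , zw≈a with ↭ₚ.∈-resp-↭ shift′ w∈
    ...   | there w∈′ = w , w∈′ , z≢w , zw≈a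
    ...   | here refl = contradiction
      (cancel (L⊆ (here refl)) (L⊆ (there (back z∈))) (L⊆ (there y∈L))
        (mod-trans (≡⇒≈ (ℤₚ.*-comm (+ y) (+ x))) (mod-trans xy≈a (mod-trans (mod-sym zw≈a) (≡⇒≈ (ℤₚ.*-comm (+ z) (+ y)))))))
      (All.lookup x∉L (back z∈))
  ...     | k , refl , ∏≈ = suc k , cong suc (sym (ℕₚ.+-suc k k)) , (begin
    + x * ∏ℕ (us ++ y ∷ vs)
      ≡⟨ cong (+ x *_) (∏-↭ (λ i → + i) (↭ₚ.shift y us vs)) ⟩
    + x * (+ y * ∏ℕ (us ++ vs))
      ≡⟨ ℤₚ.*-assoc (+ x) (+ y) _ ⟨
    + x * + y * ∏ℕ (us ++ vs)
      ≈⟨ mod-* xy≈a ∏≈ ⟩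
    a * a ^ k ∎)

module _ (n : ℕ) (isPrime : Prime (suc (n ℕ.+ n))) (n>0 : 0 < n) where

  private
    m = n ℕ.+ n
    p = suc m

  open ≈-Reasoning (mod-setoid p)

  abstract
    -- By Fermat's theorem x^(p-2) inverts x, so the witness is the residue of a x^(p-2).
    quotient : ∀ a → ¬ + p ℤ∣.∣ a → ∀ {x} → x ∈ seg m → ∃ λ y → y ∈ seg m × + x * + y ≈ a [mod p ]
    quotient a p∤a {x} x∈ = y , %-seg n isPrime (∤-* n isPrime p∤a (∤-^ (m ∸ 1))) , (begin
      + x * + y                    ≈⟨ mod-* (≡⇒≈ {x = + x} refl) (mod-%ℕ p (a * (+ x) ^ (m ∸ 1))) ⟩
      + x * (a * (+ x) ^ (m ∸ 1))  ≡⟨ *-assoc-comm (+ x) a _ ⟩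
      a * (+ x) ^ suc (m ∸ 1)      ≡⟨ cong (λ k → a * (+ x) ^ k) (ℕₚ.m+[n∸m]≡n (ℕₚ.≤-trans n>0 (ℕₚ.m≤m+n n n))) ⟩
      a * (+ x) ^ m                ≈⟨ mod-* (≡⇒≈ {x = a} refl) (fermat n isPrime (+ x) (∤-seg n isPrime x∈)) ⟩
      a * 1ℤ                       ≡⟨ ℤₚ.*-identityʳ a ⟩
      a ∎)
      where
      y : ℕ
      y = (a * (+ x) ^ (m ∸ 1)) ℤ/.%ℕ p
      ∤-^ : ∀ k → ¬ + p ℤ∣.∣ (+ x) ^ k
      ∤-^ zero    = ∤-1 n isPrime
      ∤-^ (suc k) = ∤-* n isPrime {+ x} (∤-seg n isPrime x∈) (∤-^ k)

  double-injective : ∀ {j k} → j ℕ.+ j ≡ k ℕ.+ k → j ≡ k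
  double-injective {j} {k} eq = ℕₚ.*-cancelˡ-≡ j k 2 (trans (lem j) (trans eq (sym (lem k))))
    where
    lem : ∀ x → 2 ℕ.* x ≡ x ℕ.+ x
    lem = ℕRing.solve-∀

  -- For a non-square a the map x ↦ a / x has no fixed point, so the residues 1, ..., p - 1 fall
  -- into n pairs with product a.
  nonSquare⇒∏ : ∀ a → ¬ + p ℤ∣.∣ a → ¬ IsSquare p a → ∏ℕ (seg m) ≈ a ^ n [mod p ]
  nonSquare⇒∏ a p∤a ¬sq = conclude (∏-pairs n isPrime a m (seg m) (length-seg m) (unique-seg n m) id partner)
    where
    partner : ∀ {x} → x ∈ seg m → ∃ λ y → y ∈ seg m × x ≢ y × + x * + y ≈ a [mod p ]
    partner {x} x∈ with quotient a p∤a x∈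
    ... | y , y∈ , xy≈a = y , y∈ , (λ { refl → ¬sq (Fin.fromℕ< x<p ,
            subst (λ t → + t * + t ≡ a [mod p ]) (sym (Finₚ.toℕ-fromℕ< x<p)) (cong⁻ xy≈a)) }) , xy≈a
      where
      x<p : x < p
      x<p = s≤s (proj₂ (∈-seg⁻ x∈))
    conclude : (∃ λ k → m ≡ k ℕ.+ k × ∏ℕ (seg m) ≈ a ^ k [mod p ]) → ∏ℕ (seg m) ≈ a ^ n [mod p ]
    conclude (k , m≡2k , ∏≈) = subst (λ j → ∏ℕ (seg m) ≈ a ^ j [mod p ]) (sym (double-injective {n} {k} m≡2k)) ∏≈

  square-root-of-1 : ∀ {x} → x ∈ seg m → + x * + x ≈ 1ℤ [mod p ] → x ≡ 1 ⊎ x ≡ m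
  square-root-of-1 {x} x∈ (cong⁺ e) with euclid n isPrime (+ x - 1ℤ) (+ x + 1ℤ) (subst (+ p ℤ∣.∣_) (lem (+ x)) e)
    where
    lem : ∀ x → x * x - 1ℤ ≡ (x - 1ℤ) * (x + 1ℤ)
    lem = solve-∀
  ... | inj₁ d = inj₁ (mod-injective (s≤s (proj₂ (∈-seg⁻ x∈))) (s≤s (ℕₚ.≤-trans n>0 (ℕₚ.m≤m+n n n))) d)
  ... | inj₂ d = inj₂ (mod-opposite (s≤s z≤n) (s≤s (proj₂ (∈-seg⁻ x∈))) (s≤s z≤n) d)

  p-1≈-1 : + m ≈ -1ℤ [mod p ]
  p-1≈-1 = cong⁺ (ℤ∣.divides 1ℤ (trans (ℤₚ.+-comm (+ m) 1ℤ) (sym (ℤₚ.*-identityˡ (+ p)))))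

  -- The only fixed points of x ↦ 1 / x are 1 and p - 1. The numbers 2, ..., p - 2 pair off with
  -- product 1, which leaves the factor p - 1 ≡ -1.
  wilson : ∏ℕ (seg m) ≈ -1ℤ [mod p ]
  wilson = shifted m refl (ℕₚ.+-mono-≤ n>0 n>0)
    where
    -- A copy of m is split as k + 2 while the modulus stays in terms of n.
    shifted : ∀ m′ → m′ ≡ m → 2 ≤ m′ → ∏ℕ (seg m′) ≈ -1ℤ [mod p ]
    shifted (suc (suc k)) eq (s≤s (s≤s z≤n)) with ∏-pairs n isPrime 1ℤ k L (Listₚ.length-applyDownFrom (suc ∘ suc) k) unique sub partner
      where
      L = applyDownFrom (suc ∘ suc) k
      bounds : ∀ {x} → x ∈ L → 1 < x × x < m
      bounds x∈ with ∈-applyDownFrom⁻ (suc ∘ suc) x∈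
      ... | i , i<k , refl = s≤s (s≤s z≤n) , subst (suc (suc i) <_) eq (s≤s (s≤s i<k))
      unique : Unique L
      unique = Uniqueₚ.applyDownFrom⁺₁ (suc ∘ suc) k λ j<i _ e → ℕₚ.<⇒≢ j<i (sym (ℕₚ.suc-injective (ℕₚ.suc-injective e)))
      sub : L ⊆ seg m
      sub x∈ = ∈-seg⁺ (ℕₚ.<⇒≤ (proj₁ (bounds x∈))) (ℕₚ.<⇒≤ (proj₂ (bounds x∈)))
      inside : ∀ {y} → y ∈ seg m → y ≢ 1 → y ≢ m → y ∈ L
      inside {zero}        y∈ _ _ = contradiction (proj₁ (∈-seg⁻ y∈)) λ ()
      inside {suc zero}    _ y≢1 _ = contradiction refl y≢1
      inside {suc (suc y)} y∈ _ y≢m = ∈-applyDownFrom⁺ (suc ∘ suc)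
        (ℕₚ.≤-pred (ℕₚ.≤-pred (subst (suc (suc y) <_) (sym eq) (ℕₚ.≤∧≢⇒< (proj₂ (∈-seg⁻ y∈)) y≢m))))
      partner : ∀ {x} → x ∈ L → ∃ λ y → y ∈ L × x ≢ y × + x * + y ≈ 1ℤ [mod p ]
      partner {x} x∈ with quotient 1ℤ (∤-1 n isPrime) (sub x∈)
      ... | y , y∈ , xy≈1 = y , inside y∈ y≢1 y≢m , x≢y , xy≈1
        where
        x<p = s≤s (ℕₚ.<⇒≤ (proj₂ (bounds x∈)))
        y≢1 : y ≢ 1
        y≢1 refl = ℕₚ.<⇒≢ (proj₁ (bounds x∈)) (sym (mod-injective x<p
          (s≤s (ℕₚ.≤-trans n>0 (ℕₚ.m≤m+n n n))) (cong⁻ (mod-trans (≡⇒≈ (sym (ℤₚ.*-identityʳ (+ x)))) xy≈1))))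
        y≢m : y ≢ m
        y≢m refl = ℕₚ.<⇒≢ (proj₂ (bounds x∈)) (mod-opposite {b = 1} (s≤s z≤n) x<p (s≤s z≤n) (cong⁻ (begin
          + x                ≡⟨ lem (+ x) ⟩
          - (+ x * -1ℤ)      ≈⟨ mod-neg (mod-* (≡⇒≈ {x = + x} refl) (mod-sym p-1≈-1)) ⟩
          - (+ x * + m)      ≈⟨ mod-neg xy≈1 ⟩
          -1ℤ ∎)))
          where
          lem : ∀ x → x ≡ - (x * -1ℤ)
          lem = solve-∀
        x≢y : x ≢ y
        x≢y refl with square-root-of-1 y∈ xy≈1
        ... | inj₁ y≡1 = y≢1 y≡1
        ... | inj₂ y≡m = y≢m y≡m
    ... | j , _ , ∏≈ = begin
      + suc (suc k) * ∏ℕ (seg (suc k))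
        ≡⟨ cong (+ suc (suc k) *_) (∏ℕ-seg-suc k) ⟩
      + suc (suc k) * ∏ℕ (applyDownFrom (suc ∘ suc) k)
        ≈⟨ mod-* (mod-trans (≡⇒≈ (cong +_ eq)) p-1≈-1) ∏≈ ⟩
      -1ℤ * 1ℤ ^ j
        ≡⟨ cong (-1ℤ *_) (ℤₚ.^-zeroˡ j) ⟩
      -1ℤ ∎

  -- Factors change sides one at a time: when (k + 1) + l = p - 1, the factor l + 1 is ≡ -(k + 1).
  ∏-halves : ∀ k l → k ℕ.+ l ≡ m → ∏ℕ (seg m) ≈ -1ℤ ^ k * (∏ℕ (seg k) * ∏ℕ (seg l)) [mod p ]
  ∏-halves zero    l refl = ≡⇒≈ (lem (∏ℕ (seg m)))
    where
    lem : ∀ x → x ≡ 1ℤ * (1ℤ * x)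
    lem = solve-∀
  ∏-halves (suc k) l eq = begin
    ∏ℕ (seg m)
      ≈⟨ ∏-halves k (suc l) (trans (ℕₚ.+-suc k l) eq) ⟩
    -1ℤ ^ k * (∏ℕ (seg k) * (+ suc l * ∏ℕ (seg l)))
      ≈⟨ mod-* (≡⇒≈ {x = -1ℤ ^ k} refl) (mod-* (≡⇒≈ {x = ∏ℕ (seg k)} refl) (mod-* opposite (≡⇒≈ {x = ∏ℕ (seg l)} refl))) ⟩
    -1ℤ ^ k * (∏ℕ (seg k) * (- + suc k * ∏ℕ (seg l)))
      ≡⟨ lem (-1ℤ ^ k) (∏ℕ (seg k)) (+ suc k) (∏ℕ (seg l)) ⟩
    -1ℤ * -1ℤ ^ k * (+ suc k * ∏ℕ (seg k) * ∏ℕ (seg l)) ∎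
    where
    lem : ∀ s a k b → s * (a * (- k * b)) ≡ -1ℤ * s * (k * a * b)
    lem = solve-∀
    opposite : + suc l ≈ - + suc k [mod p ]
    opposite = cong⁺ (ℤ∣.divides 1ℤ (trans (cong (_+_ (+ suc l)) (ℤₚ.neg-involutive (+ suc k)))
      (trans (cong +_ (trans (ℕₚ.+-comm (suc l) (suc k)) (trans (cong suc (ℕₚ.+-suc k l)) (cong suc eq)))) (sym (ℤₚ.*-identityˡ (+ p))))))

  wilson-half : -1ℤ ^ n * (∏ℕ (seg n) * ∏ℕ (seg n)) ≈ -1ℤ [mod p ]
  wilson-half = mod-trans (mod-sym (∏-halves n n refl)) wilson

  p∤2 : ¬ + p ℤ∣.∣ + 2
  p∤2 = ∤-residue n isPrime (s≤s z≤n) (s≤s (ℕₚ.+-mono-≤ n>0 n>0))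

  -- Euler's criterion. If x² ≡ 2, then 2^n ≡ x^(p-1) and Fermat's theorem applies. Otherwise the
  -- product 1 ⋯ (p - 1) is evaluated both by Wilson's theorem and by the pairing x ↦ 2 / x.
  legendre-2≈2^n : legendre (+ 2) p ≈ (+ 2) ^ n [mod p ]
  legendre-2≈2^n with + p ℤ∣.∣? + 2 | isSquare? p (+ 2)
  ... | yes p∣2 | _ = contradiction p∣2 p∤2
  ... | no _ | yes (x , x²≡2) = mod-sym (begin
    (+ 2) ^ n                  ≈⟨ mod-^ n (mod-sym (cong⁺ {⟦ x ⟧ * ⟦ x ⟧} x²≡2)) ⟩
    (⟦ x ⟧ * ⟦ x ⟧) ^ n        ≡⟨ ^-*-distrib n ⟩
    ⟦ x ⟧ ^ n * ⟦ x ⟧ ^ n      ≡⟨ ℤₚ.^-distribˡ-+-* ⟦ x ⟧ n n ⟨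
    ⟦ x ⟧ ^ m                  ≈⟨ fermat n isPrime ⟦ x ⟧ p∤x ⟩
    1ℤ ∎)
    where
    ^-*-distrib : ∀ k → (⟦ x ⟧ * ⟦ x ⟧) ^ k ≡ ⟦ x ⟧ ^ k * ⟦ x ⟧ ^ k
    ^-*-distrib zero    = refl
    ^-*-distrib (suc k) = trans (cong (⟦ x ⟧ * ⟦ x ⟧ *_) (^-*-distrib k)) (lem ⟦ x ⟧ (⟦ x ⟧ ^ k))
      where
      lem : ∀ x y → x * x * (y * y) ≡ x * y * (x * y)
      lem = solve-∀
    p∤x : ¬ + p ℤ∣.∣ ⟦ x ⟧
    p∤x p∣x = p∤2 (subst (+ p ℤ∣.∣_) (lem (⟦ x ⟧ * ⟦ x ⟧) (+ 2)) (ℤ∣.∣m∣n⇒∣m-n (ℤ∣.∣m⇒∣m*n ⟦ x ⟧ p∣x) x²≡2))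
      where
      lem : ∀ x y → x - (x - y) ≡ y
      lem = solve-∀
  ... | no _ | no ¬sq = mod-trans (mod-sym wilson) (nonSquare⇒∏ (+ 2) p∤2 ¬sq)

  -- Gauss's lemma for 2: the classes of 2, 4, …, 2n are 1, …, n, up to signs that agree with
  -- the parities of the classes.
  2^n≈signs : (+ 2) ^ n ≈ signs (seg n) [mod p ]
  2^n≈signs = mod-cancel n isPrime (∏ℕ (seg n)) (∤-∏ℕ-seg n isPrime n (ℕₚ.m≤m+n n n)) (begin
    ∏ℕ (seg n) * (+ 2) ^ n
      ≡⟨ ℤₚ.*-comm (∏ℕ (seg n)) _ ⟩
    (+ 2) ^ n * ∏ℕ (seg n)
      ≡⟨ cong (λ l → (+ 2) ^ l * ∏ℕ (seg n)) (length-seg n) ⟨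
    (+ 2) ^ length (seg n) * ∏ℕ (seg n)
      ≡⟨ cong (_* ∏ℕ (seg n)) (∏-const (seg n) (+ 2)) ⟨
    ∏ (seg n) (λ _ → + 2) * ∏ℕ (seg n)
      ≡⟨ ∏-* (seg n) (λ _ → + 2) (λ i → + i) ⟨
    ∏ (seg n) (λ i → + 2 * + i)
      ≈⟨ mod-∏ (seg n) term ⟩
    ∏ (seg n) (λ i → -1ℤ ^ ψ i * + ψ i)
      ≡⟨ ∏-map ψ (seg n) (λ c → -1ℤ ^ c * + c) ⟨
    ∏ (map ψ (seg n)) (λ c → -1ℤ ^ c * + c)
      ≡⟨ ∏-↭ _ (unique-⊆-↭ unique sub (ℕₚ.≤-reflexive (sym (Listₚ.length-map ψ (seg n))))) ⟩
    ∏ (seg n) (λ c → -1ℤ ^ c * + c)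
      ≡⟨ ∏-* (seg n) (λ c → -1ℤ ^ c) (λ c → + c) ⟩
    signs (seg n) * ∏ℕ (seg n)
      ≡⟨ ℤₚ.*-comm (signs (seg n)) _ ⟩
    ∏ℕ (seg n) * signs (seg n) ∎)
    where
    ψ : ℕ → ℕ
    ψ i = cls n (i ℕ.+ i)
    2i-bounds : ∀ {i} → i ∈ seg n → 0 < i ℕ.+ i × i ℕ.+ i < p
    2i-bounds i∈ with ∈-seg⁻ i∈
    ... | i>0 , i≤n = ℕₚ.≤-trans i>0 (ℕₚ.m≤m+n _ _) , s≤s (ℕₚ.+-mono-≤ i≤n i≤n)
    sub : map ψ (seg n) ⊆ seg n
    sub x∈ with ∈-map⁻ ψ x∈
    ... | i , i∈ , refl with cls-range n (proj₁ (2i-bounds i∈)) (proj₂ (2i-bounds i∈))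
    ...   | c>0 , c≤n = ∈-seg⁺ c>0 c≤n
    unique : Unique (map ψ (seg n))
    unique = unique-map (unique-seg n n) λ {i} {j} i∈ j∈ eq → injective i∈ j∈ (same-class n (proj₂ (2i-bounds i∈)) (proj₂ (2i-bounds j∈)) eq)
      where
      injective : ∀ {i j} → i ∈ seg n → j ∈ seg n → + (i ℕ.+ i) ≡ + (j ℕ.+ j) [mod p ] ⊎ + (i ℕ.+ i) ≡ - + (j ℕ.+ j) [mod p ] → i ≡ j
      injective i∈ j∈ (inj₁ e) = double-injective (mod-injective (proj₂ (2i-bounds i∈)) (proj₂ (2i-bounds j∈)) e)
      -- 2i ≡ -2j would make p divide i + j, which lies between 1 and 2n.
      injective {i} {j} i∈ j∈ (inj₂ e) with euclid n isPrime (+ 2) (+ (i ℕ.+ j)) (subst (+ p ℤ∣.∣_) (lem (+ i) (+ j)) e)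
        where
        lem : ∀ i j → (i + i) - - (j + j) ≡ (1ℤ + 1ℤ) * (i + j)
        lem = solve-∀
      ... | inj₁ p∣2 = contradiction p∣2 p∤2
      ... | inj₂ p∣i+j = contradiction p∣i+j (∤-residue n isPrime
              (ℕₚ.≤-trans (proj₁ (∈-seg⁻ i∈)) (ℕₚ.m≤m+n i j)) (s≤s (ℕₚ.+-mono-≤ (proj₂ (∈-seg⁻ i∈)) (proj₂ (∈-seg⁻ j∈)))))
    residue : ∀ δ → δ < p → + δ ≈ -1ℤ ^ flp n δ * + cls n δ [mod p ]
    residue δ δ<p with δ ℕ.≤? n
    ... | yes _ = ≡⇒≈ (sym (ℤₚ.*-identityˡ (+ δ)))
    ... | no  _ = cong⁺ (ℤ∣.divides 1ℤ (trans (cong (λ t → + δ - (-1ℤ * 1ℤ) * t) (sym (+-∸ (ℕₚ.<⇒≤ δ<p)))) (lem (+ δ) (+ p))))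
      where
      lem : ∀ d p → d - (-1ℤ * 1ℤ) * (p - d) ≡ 1ℤ * p
      lem = solve-∀
    -- As 2i is even, `sign-cls` says that the sign of the flip and the sign of the class multiply
    -- to 1.
    same-sign : ∀ i → i ℕ.+ i < p → -1ℤ ^ flp n (i ℕ.+ i) ≡ -1ℤ ^ ψ i
    same-sign i 2i<p = trans (sym (ℤₚ.*-identityˡ y)) (trans (cong (_* y) (sym (-1^ (ψ i))))
      (trans (ℤₚ.*-assoc x x y) (trans (cong (x *_) xy≡1) (ℤₚ.*-identityʳ x))))
      where
      x = -1ℤ ^ ψ i
      y = -1ℤ ^ flp n (i ℕ.+ i)
      xy≡1 : x * y ≡ 1ℤ
      xy≡1 = trans (sym (sign-cls n (i ℕ.+ i) 2i<p)) (trans (ℤₚ.^-distribˡ-+-* -1ℤ i i) (-1^ i))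
    term : ∀ {i} → i ∈ seg n → + 2 * + i ≈ -1ℤ ^ ψ i * + ψ i [mod p ]
    term {i} i∈ = begin
      + 2 * + i                                ≡⟨ lem (+ i) ⟩
      + (i ℕ.+ i)                              ≈⟨ residue (i ℕ.+ i) (proj₂ (2i-bounds i∈)) ⟩
      -1ℤ ^ flp n (i ℕ.+ i) * + ψ i            ≡⟨ cong (_* + ψ i) (same-sign i (proj₂ (2i-bounds i∈))) ⟩
      -1ℤ ^ ψ i * + ψ i ∎
      where
      lem : ∀ i → (1ℤ + 1ℤ) * i ≡ i + i
      lem = solve-∀

  legendre-2 : legendre (+ 2) p ≈ signs (seg n) [mod p ]
  legendre-2 = mod-trans legendre-2≈2^n 2^n≈signs

-- The signed sum over starters

∑-applyDownFrom-suc : ∀ {X : Set} (h : ℕ → X) n k → ∑ (applyDownFrom h (suc n)) k ≡ k (h 0) + ∑ (applyDownFrom (h ∘ suc) n) k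
∑-applyDownFrom-suc h zero    k = refl
∑-applyDownFrom-suc h (suc n) k = trans (cong (_+_ (k (h (suc n)))) (∑-applyDownFrom-suc h n k))
  (lem (k (h (suc n))) (k (h 0)) _)
  where
  lem : ∀ a b c → a + (b + c) ≡ b + (a + c)
  lem = solve-∀

∑-tabulate : ∀ {X : Set} n (h : ℕ → X) k → ∑ (tabulate {n = n} (h ∘ toℕ)) k ≡ ∑ (applyDownFrom h n) k
∑-tabulate zero    h k = refl
∑-tabulate (suc n) h k = trans (cong (_+_ (k (h 0))) (∑-tabulate n (h ∘ suc) k)) (sym (∑-applyDownFrom-suc h n k))

∑-allFin : ∀ m k → k 0 ≡ 0ℤ → ∑ (allFin (suc m)) (k ∘ toℕ) ≡ ∑ (seg m) k
∑-allFin m k k0 = trans (sym (∑-map toℕ (allFin (suc m)) k)) (trans (cong (λ l → ∑ l k) (Listₚ.map-tabulate id (toℕ {suc m})))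
  (trans (∑-tabulate (suc m) id k) (trans (∑-applyDownFrom-suc id m k) (trans (cong (_+ ∑ (seg m) k) k0) (ℤₚ.+-identityˡ _)))))

∑-edges : ∀ m h → ∑ (map toℕ² (edges (suc m))) h ≡ ∑ (seg m) (λ a → ∑ (seg m) λ b → 𝟙 (a ℕ.<? b) * h (a , b))
∑-edges m h = begin
  ∑ (map toℕ² (edges (suc m))) h
    ≡⟨ ∑-map toℕ² (edges (suc m)) h ⟩
  ∑ (edges (suc m)) (h ∘ toℕ²)
    ≡⟨ ∑-filter isEdge? (cartesianProduct (allFin (suc m)) (allFin (suc m))) (h ∘ toℕ²) ⟩
  ∑ (cartesianProduct (allFin (suc m)) (allFin (suc m))) (λ e → 𝟙 (isEdge? e) * h (toℕ² e))
    ≡⟨ ∑-cartesianProduct (allFin (suc m)) (allFin (suc m)) (λ e → 𝟙 (isEdge? e) * h (toℕ² e)) ⟩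
  ∑ (allFin (suc m)) (λ a → ∑ (allFin (suc m)) λ b → 𝟙 (isEdge? (a , b)) * h (toℕ a , toℕ b))
    ≡⟨ (∑-cong (allFin (suc m)) λ a → ∑-cong (allFin (suc m)) λ b →
         cong (_* h (toℕ a , toℕ b)) (𝟙-cong (isEdge? (a , b)) (edge? (toℕ a) (toℕ b)) id id)) ⟩
  ∑ (allFin (suc m)) (λ a → ∑ (allFin (suc m)) λ b → F (toℕ a) (toℕ b))
    ≡⟨ (∑-cong (allFin (suc m)) λ a → ∑-allFin m (F (toℕ a)) (F0ʳ (toℕ a))) ⟩
  ∑ (allFin (suc m)) (λ a → ∑ (seg m) (F (toℕ a)))
    ≡⟨ ∑-allFin m (λ a → ∑ (seg m) (F a)) (∑-zero (seg m) F0ˡ) ⟩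
  ∑ (seg m) (λ a → ∑ (seg m) (F a))
    ≡⟨ (∑-cong-∈ (seg m) λ {a} a∈ → ∑-cong-∈ (seg m) λ {b} b∈ → cong (_* h (a , b))
         (𝟙-cong (edge? a b) (a ℕ.<? b) (λ (_ , _ , a<b) → a<b)
           λ a<b → (λ { refl → ℕₚ.n≮n 0 (proj₁ (∈-seg⁻ a∈)) }) , (λ { refl → ℕₚ.n≮n 0 (proj₁ (∈-seg⁻ b∈)) }) , a<b)) ⟩
  ∑ (seg m) (λ a → ∑ (seg m) λ b → 𝟙 (a ℕ.<? b) * h (a , b)) ∎
  where
  open ≡-Reasoning
  edge? : ∀ a b → Dec (a ≢ 0 × b ≢ 0 × a < b)
  edge? a b = ¬? (a ℕ.≟ 0) ×-dec ¬? (b ℕ.≟ 0) ×-dec a ℕ.<? b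
  F : Weight
  F a b = 𝟙 (edge? a b) * h (a , b)
  F0ˡ : ∀ b → F 0 b ≡ 0ℤ
  F0ˡ b = cong (_* h (0 , b)) (𝟙-false (edge? 0 b) λ (0≢0 , _) → 0≢0 refl)
  F0ʳ : ∀ a → F a 0 ≡ 0ℤ
  F0ʳ a = cong (_* h (a , 0)) (𝟙-false (edge? a 0) λ (_ , 0≢0 , _) → 0≢0 refl)

-- Among 1, ..., 2n there are n odd numbers.
signs-seg-double : ∀ n → signs (seg (n ℕ.+ n)) ≡ -1ℤ ^ n
signs-seg-double zero    = refl
signs-seg-double (suc n) rewrite ℕₚ.+-suc n n = begin
  -1ℤ * -1ℤ ^ suc (n ℕ.+ n) * (-1ℤ ^ suc (n ℕ.+ n) * signs (seg (n ℕ.+ n)))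
    ≡⟨ lem (-1ℤ ^ suc (n ℕ.+ n)) (signs (seg (n ℕ.+ n))) ⟩
  -1ℤ * (-1ℤ ^ suc (n ℕ.+ n) * -1ℤ ^ suc (n ℕ.+ n)) * signs (seg (n ℕ.+ n))
    ≡⟨ cong₂ (λ x y → -1ℤ * x * y) (-1^ (suc (n ℕ.+ n))) (signs-seg-double n) ⟩
  -1ℤ ^ suc n ∎
  where
  open ≡-Reasoning
  lem : ∀ x y → -1ℤ * x * (x * y) ≡ -1ℤ * (x * x) * y
  lem = solve-∀

mod-Q : ∀ {p X} {Y : Set} (u w : Y → Weight) ds H → (∀ d a b → u d a b ≈ w d a b [mod p ]) →
        Q X (map u ds) H ≈ Q X (map w ds) H [mod p ]
mod-Q u w []       H eq = ≡⇒≈ refl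
mod-Q {X = X} u w (d ∷ ds) H eq = mod-∑ X λ a → mod-∑ X λ b →
  mod-* (eq d a b) (mod-Q u w ds (λ v → H (a ∷ b ∷ v)) eq)

map-const : ∀ {X Y : Set} (y : Y) (xs : List X) → map (λ _ → y) xs ≡ replicate (length xs) y
map-const y []       = refl
map-const y (x ∷ xs) = cong (y ∷_) (map-const y xs)

weight-symmetric : ∀ n → Symmetric (weight n)
weight-symmetric n .exchange u x y v = cong₂ _*_ (∏-↭ (flip n) (↭ₚ.++⁺ˡ u (swap x y refl)))
  (exchange (flat-symmetric sgn-alt) u x y v)

-- Still an identity in ℤ: starters are the choices of one edge from each difference class, and
-- `weight` gives the other choices the value 0.
T-as-V : ∀ n → let L = map toℕ² (edges (suc (n ℕ.+ n))) in
         T (suc (n ℕ.+ n)) ≡ κ n * V (map (class (cl n) L) (seg n)) (weight n)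
T-as-V n = begin
  T p
    ≡⟨ foldr-map (starters p) ⟩
  ∑ (starters p) ε
    ≡⟨ ∑-filter isStarter? (sublists (edges p)) ε ⟩
  ∑ (sublists (edges p)) (λ A → 𝟙 (isStarter? A) * ε A)
    ≡⟨ ∑-sublists (edges p) (λ A → 𝟙 (isStarter? A) * ε A) ⟩
  S (edges p) (λ A → 𝟙 (isStarter? A) * ε A)
    ≡⟨ (S-cong-∈ (edges p) λ A⊆ → starter-weight n (All.map
         (λ e∈ → proj₂ (∈-filter⁻ isEdge? {xs = cartesianProduct (allFin p) (allFin p)} e∈)) A⊆)) ⟩
  S (edges p) (λ A → κ n * (𝟙 (classes n A ↭? seg n) * weight n (map toℕ² A)))
    ≡⟨ S-* (edges p) (κ n) _ ⟩
  κ n * S (edges p) (λ A → 𝟙 (classes n A ↭? seg n) * weight n (map toℕ² A))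
    ≡⟨ cong (κ n *_) (S-map toℕ² (edges p) (λ A → 𝟙 (map (cl n) A ↭? seg n) * weight n A)) ⟨
  κ n * S (map toℕ² (edges p)) (λ A → 𝟙 (map (cl n) A ↭? seg n) * weight n A)
    ≡⟨ cong (κ n *_) (S-transversals (cl n) (seg n) (map toℕ² (edges p)) (unique-seg n n) (weight-symmetric n)) ⟩
  κ n * V (map (class (cl n) (map toℕ² (edges p))) (seg n)) (weight n) ∎
  where
  open ≡-Reasoning
  p = suc (n ℕ.+ n)
  foldr-map : ∀ As → foldr _+_ 0ℤ (map ε As) ≡ ∑ As (ε {p})
  foldr-map []       = refl
  foldr-map (A ∷ As) = cong (_+_ (ε A)) (foldr-map As)

module _ (n : ℕ) (isPrime : Prime (suc (n ℕ.+ n))) (n>0 : 0 < n) where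

  private
    m = n ℕ.+ n
    p = suc m
    L = map toℕ² (edges p)
    N = ∏ℕ (seg n)
    𝒱 = V (map (class (cl n) L) (seg n)) (weight n)

  Q-dominoes : Q (seg m) (map (λ _ → f p 1) (seg n)) sgn ≡ (+ 2) ^ n * N
  Q-dominoes = trans
    (Q-represents (seg m) (λ _ → 1ℤ) (λ _ → f p 1) (λ _ → path m) (seg n) (λ _ → represents-path n n>0) sgn-alt)
    (cong₂ (λ l v → (+ 2) ^ l * v) (length-seg n) (trans
      (V-cong (map (λ _ → path m) (seg n)) λ A → trans
        (cong (_* sgn (flat A)) (trans (∏-const A 1ℤ) (ℤₚ.^-zeroˡ (length A)))) (ℤₚ.*-identityˡ _))
      (trans (cong (λ Rs → V Rs (sgn ∘ flat)) (trans (map-const (path m) (seg n)) (cong (λ l → replicate l (path m)) (length-seg n))))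
        (dominoes-perfect n))))

  𝒱≈N² : 𝒱 ≈ N * N [mod p ]
  𝒱≈N² = mod-cancel n isPrime ((+ 2) ^ n) (∤-2^ n) (begin
    (+ 2) ^ n * 𝒱
      ≡⟨ cong (λ l → (+ 2) ^ l * 𝒱) (length-seg n) ⟨
    (+ 2) ^ length (seg n) * 𝒱
      ≡⟨ Q-represents (seg m) (flip n) (f p) (class (cl n) L) (seg n)
           (λ d∈ → represents-class n L (∑-edges m) (proj₁ (∈-seg⁻ d∈)) (proj₂ (∈-seg⁻ d∈))) sgn-alt ⟨
    Q (seg m) (map (f p) (seg n)) sgn
      ≈⟨ mod-Q (f p) (g m) (seg n) sgn (λ d a b → f≈g n isPrime d a b n>0) ⟩
    Q (seg m) (map (g m) (seg n)) sgn
      -- `Q-g` takes the exponent p - 1 in the form k + 2, so here k = p - 3.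
      ≡⟨ cong (λ k → Q (seg m) (map (g k) (seg n)) sgn) m≡ ⟨
    Q (seg m) (map (g (suc (suc (m ∸ 2)))) (seg n)) sgn
      ≡⟨ Q-g (seg m) n (m ∸ 2) m≡ sgn-alt (seg n) (length-seg n) ⟩
    N * Q (seg m) (map (λ _ → g (suc (suc (m ∸ 2))) 1) (seg n)) sgn
      ≡⟨ cong (λ k → N * Q (seg m) (map (λ _ → g k 1) (seg n)) sgn) m≡ ⟩
    -- Back from polynomials to indicators, since only the indicator for d = 1 can be read as
    -- dominoes.
    N * Q (seg m) (map (λ _ → g m 1) (seg n)) sgn
      ≈⟨ mod-* (≡⇒≈ {x = N} refl) (mod-Q (λ _ → g m 1) (λ _ → f p 1) (seg n) sgn λ _ a b → mod-sym (f≈g n isPrime 1 a b n>0)) ⟩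
    N * Q (seg m) (map (λ _ → f p 1) (seg n)) sgn
      ≡⟨ cong (N *_) Q-dominoes ⟩
    N * ((+ 2) ^ n * N)
      ≡⟨ *-assoc-comm N ((+ 2) ^ n) N ⟩
    (+ 2) ^ n * (N * N) ∎)
    where
    open ≈-Reasoning (mod-setoid p)
    m≡ : suc (suc (m ∸ 2)) ≡ m
    m≡ = ℕₚ.m+[n∸m]≡n (ℕₚ.+-mono-≤ n>0 n>0)
    ∤-2^ : ∀ k → ¬ + p ℤ∣.∣ (+ 2) ^ k
    ∤-2^ zero    = ∤-1 n isPrime
    ∤-2^ (suc k) = ∤-* n isPrime {+ 2} (p∤2 n isPrime n>0) (∤-2^ k)

  -- The factor (-1)^n of `κ` is exactly what Wilson's theorem in its halved form needs to turn
  -- (n!)² into -1; the sign product over 1, ..., n remains.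
  T≈-signs : T p ≈ - signs (seg n) [mod p ]
  T≈-signs = begin
    T p
      ≡⟨ T-as-V n ⟩
    signs (seg m) * signs (seg n) * 𝒱
      ≈⟨ mod-* (≡⇒≈ {x = κ n} refl) 𝒱≈N² ⟩
    signs (seg m) * signs (seg n) * (N * N)
      ≡⟨ cong (λ t → t * signs (seg n) * (N * N)) (signs-seg-double n) ⟩
    -1ℤ ^ n * signs (seg n) * (N * N)
      ≡⟨ lem (-1ℤ ^ n) (signs (seg n)) (N * N) ⟩
    signs (seg n) * (-1ℤ ^ n * (N * N))
      ≈⟨ mod-* (≡⇒≈ {x = signs (seg n)} refl) (wilson-half n isPrime n>0) ⟩
    signs (seg n) * -1ℤ
      ≡⟨ lem′ (signs (seg n)) ⟩
    - signs (seg n) ∎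
    where
    open ≈-Reasoning (mod-setoid p)
    lem : ∀ x y z → x * y * z ≡ y * (x * z)
    lem = solve-∀
    lem′ : ∀ x → x * -1ℤ ≡ - x
    lem′ = solve-∀

odd : ∀ p → ¬ (2 ∣ p) → ∃ λ n → p ≡ suc (n ℕ.+ n)
odd zero          ¬2∣p = contradiction (ℕ∣.divides 0 refl) ¬2∣p
odd (suc zero)    _    = 0 , refl
odd (suc (suc p)) ¬2∣p with odd p (λ { (ℕ∣.divides q eq) → ¬2∣p (ℕ∣.divides (suc q) (cong (suc ∘ suc) eq)) })
... | n , refl = suc n , cong (suc ∘ suc) (sym (ℕₚ.+-suc n n))

lemma5p2 : (p : ℕ) → Prime p → ¬ (2 ∣ p) →
    (T p ≡ - legendre (+ 2) p [mod p ]) × (T p * T p ≡ 1ℤ [mod p ])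
lemma5p2 p isPrime ¬2∣p with odd p ¬2∣p
... | zero , refl = contradiction isPrime ¬prime[1]
... | n@(suc _) , refl =
  cong⁻ (mod-trans (T≈-signs n isPrime (s≤s z≤n)) (mod-neg (mod-sym (legendre-2 n isPrime (s≤s z≤n))))) ,
  -- The square is read off from the sign product, which visibly squares to 1, whereas the symbol
  -- would call for excluding its value 0.
  cong⁻ (mod-trans (mod-* (T≈-signs n isPrime (s≤s z≤n)) (T≈-signs n isPrime (s≤s z≤n)))
    (≡⇒≈ (trans (lem (signs (seg n))) (signs² (seg n)))))
  where
  lem : ∀ x → - x * - x ≡ x * x
  lem = solve-∀
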